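{- Let $X$ be a finite, connected, $3$-dimensional, pure simplicial complex with fundamental group $\Gamma$ (a finitely presented group). Assume that: (1) there is a constant $\kappa>0$ such that every finite cover of $X$ has $\kappa$-large cosystoles; (2) $\Gamma$ is $\rho$-stable for some rate function $\rho$; (3) $\Gamma$ has a central $2$-extension $0\to \mathbb Z/2\mathbb Z\xrightarrow{\iota}\widetilde{\Gamma}\xrightarrow{\pi}\Gamma\to 1$ (i.e. a short exact sequence of groups with $\iota(1)$ central in $\widetilde\Gamma$) such that $\widetilde{\Gamma}$ is not residually finite. Then $\widetilde{\Gamma}$ is not sofic.
   Context: Hamming distance with errors: for finite sets $\Omega\subseteq\Sigma$, $\sigma\in\mathrm{Sym}(\Omega)$, $\sigma'\in\mathrm{Sym}(\Sigma)$, set $d_H(\sigma,\sigma')=\Pr_{\star\in\Sigma}[\sigma.\star\neq\sigma'.\star]$ (uniform probability on $\Sigma$), where by convention $\sigma.\star$ is an error symbol not in $\Sigma$ whenever $\star\notin\Omega$. For maps $\varphi\colon S\to\mathrm{Sym}(\Omega)$, $\psi\colon S\to\mathrm{Sym}(\Sigma)$, $d_H(\varphi,\psi)=\max_{s\in S}d_H(\varphi(s),\psi(s))$. For a finitely presented group $\langle S\mid R\rangle$ and $\varphi\colon S\to\mathrm{Sym}(\Omega)$ (extended to words), the defect is $\mathrm{def}(\varphi)=\max_{r\in R}\Pr_{\star\in\Omega}[\varphi(r).\star\neq\star]$; $\varphi$ is an $\epsilon$-almost action if $\mathrm{def}(\varphi)\le\epsilon$. A rate function is $\rho\colon[0,1]\to[0,1]$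 with $\rho(\epsilon)\to0$ as $\epsilon\to0$. The group is $\rho$-stable if for every $\epsilon$-almost action $\varphi\colon S\to\mathrm{Sym}(\Omega)$ there is a finite $\Sigma\supseteq\Omega$ and a genuine action $\psi\colon S\to\mathrm{Sym}(\Sigma)$ of the group with $d_H(\varphi,\psi)\le\rho(\epsilon)$. The group is sofic if there are $\epsilon_n$-almost actions $\varphi_n\colon S\to\mathrm{Sym}(\Omega_n)$ with $\epsilon_n\to0$ such that for every word $w$ in the free group on $S$ not in the normal closure of $R$, $d_H(\varphi_n(w),\mathrm{Id}_{\Omega_n})\to1$. For a finite pure $d$-dimensional simplicial complex $Y$, $k$-cochains are functions $Y(k)\to\mathbb F_2$, with coboundary $\delta\alpha(\sigma)=\sum_{\tau\subset\sigma,\tau\in Y(k)}\alpha(\tau)$; $Z^k=\ker\delta_k$, $B^k=\mathrm{Im}\,\delta_{k-1}$. The weight of $\sigma\in Y(k)$ is $w(\sigma)=\binom{d+1}{k+1}^{ -1}\Pr_{\tau\in Y(d)}[\sigma\subseteq\tau]$ (uniform $\tau$), the norm $\|\alpha\|=\sum_{\sigma:\alpha(\sigma)=1}w(\sigma)$ and $d_w(\alpha_1,\alpha_2)=\|\alpha_1-\alpha_2\|$. $Y$ has $\kappa$-large cosystoles if for every $0\le k\le d-1$ and every $\alpha\in Z^k\setminus B^k$, $d_w(\alpha,B^k)\ge\kappa$. -}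

module Defs where

open import Data.Bool using (Bool; true; false; not; _∧_; _∨_; _xor_; if_then_else_; T)
open import Data.Nat using (ℕ; zero; suc; _∸_) renaming (_≤_ to _≤ₙ_; _+_ to _+ₙ_; _*_ to _*ₙ_)
open import Data.Nat.Combinatorics using (_C_)
open import Data.Fin using (Fin; zero; suc; combine; inject≤)
open import Data.Fin.Properties using (_≟_)
open import Data.Fin.Permutation using (Permutation′; _⟨$⟩ʳ_; _⟨$⟩ˡ_)
open import Data.Vec using (Vec; []; _∷_; lookup; tabulate; _[_]≔_; toList)
open import Data.List using (List; []; _∷_; _++_; length; map; foldr; concatMap; reverse; allFin; filter)
open import Data.List.Membership.Propositional using (_∈_)
open import Data.List.Relation.Unary.Unique.Propositional using (Unique)
open import Data.List.Relation.Unary.All using (All)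
open import Data.Product using (Σ; _×_; _,_; ∃; ∃-syntax; proj₁; proj₂)
open import Data.Sum using (_⊎_)
open import Data.Integer using (+_)
open import Data.Rational using (ℚ; _/_; _+_; _-_; _≤_; _<_; 0ℚ; 1ℚ)
open import Relation.Nullary using (¬_; Dec)
open import Relation.Nullary.Decidable using (⌊_⌋)
open import Relation.Binary.PropositionalEquality using (_≡_)

-- a / b as a rational, with the convention a / 0 = 0 (never used on 0 below
-- except where the numerator is also forced to be 0)
ratio : ℕ → ℕ → ℚ
ratio a zero    = 0ℚ
ratio a (suc b) = (+ a) / (suc b)

sumℚ : List ℚ → ℚ
sumℚ = foldr _+_ 0ℚ

count : (n : ℕ) → (Fin n → Bool) → ℕ
count zero    f = 0
count (suc n) f = (if f zero then 1 else 0) +ₙ count n (λ i → f (suc i))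

anyFin : (n : ℕ) → (Fin n → Bool) → Bool
anyFin n f = foldr (λ i b → f i ∨ b) false (allFin n)

allFinB : (n : ℕ) → (Fin n → Bool) → Bool
allFinB n f = foldr (λ i b → f i ∧ b) true (allFin n)

anyL : {A : Set} → (A → Bool) → List A → Bool
anyL p = foldr (λ a b → p a ∨ b) false

_==_ : {n : ℕ} → Fin n → Fin n → Bool
i == j = ⌊ i ≟ j ⌋

Tends0 : (ℕ → ℚ) → Set
Tends0 f = ∀ (δ : ℚ) → 0ℚ < δ → ∃[ N ] (∀ n → N ≤ₙ n → (f n ≤ δ) × (0ℚ - δ ≤ f n))

Tends1 : (ℕ → ℚ) → Set
Tends1 f = ∀ (δ : ℚ) → 0ℚ < δ → ∃[ N ] (∀ n → N ≤ₙ n → (1ℚ - δ ≤ f n) × (f n ≤ 1ℚ + δ))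

-- a letter is a generator together with a flag (true = inverse)
Letter : ℕ → Set
Letter g = Fin g × Bool

Word : ℕ → Set
Word g = List (Letter g)

invW : {g : ℕ} → Word g → Word g
invW w = reverse (map (λ l → proj₁ l , not (proj₂ l)) w)

record Presentation : Set where
  field
    gens : ℕ
    rels : List (Word gens)
open Presentation public

data _⊢_≈_ (P : Presentation) : Word (gens P) → Word (gens P) → Set where
  ≈refl  : ∀ {u} → P ⊢ u ≈ u
  ≈sym   : ∀ {u v} → P ⊢ u ≈ v → P ⊢ v ≈ u
  ≈trans : ∀ {u v w} → P ⊢ u ≈ v → P ⊢ v ≈ w → P ⊢ u ≈ w
  ≈cong  : ∀ {u u' v v'} → P ⊢ u ≈ u' → P ⊢ v ≈ v' → P ⊢ (u ++ v) ≈ (u' ++ v')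
  ≈free  : ∀ s b → P ⊢ ((s , b) ∷ (s , not b) ∷ []) ≈ []
  ≈rel   : ∀ {r} → r ∈ rels P → P ⊢ r ≈ []

Trivial : (P : Presentation) → Word (gens P) → Set
Trivial P w = P ⊢ w ≈ []

Perms : ℕ → ℕ → Set
Perms g N = Fin g → Permutation′ N

applyL : {g N : ℕ} → Perms g N → Letter g → Fin N → Fin N
applyL φ (s , false) x = φ s ⟨$⟩ʳ x
applyL φ (s , true)  x = φ s ⟨$⟩ˡ x

act : {g N : ℕ} → Perms g N → Word g → Fin N → Fin N
act φ []      x = x
act φ (l ∷ w) x = applyL φ l (act φ w x)

moved : {g N : ℕ} → Perms g N → Word g → ℚ
moved {N = N} φ w = ratio (count N (λ x → not (act φ w x == x))) N

DefectAtMost : (P : Presentation) {N : ℕ} → Perms (gens P) N → ℚ → Set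
DefectAtMost P φ ε = ∀ r → r ∈ rels P → moved φ r ≤ ε

IsAction : (P : Presentation) {N : ℕ} → Perms (gens P) N → Set
IsAction P φ = ∀ r → r ∈ rels P → ∀ x → act φ r x ≡ x

-- d_H(σ, σ') for σ ∈ Sym(Ω), σ' ∈ Sym(Σ), Ω = Fin N ⊆ Σ = Fin M (first N points);
-- points of Σ∖Ω always count as disagreements (error symbol)
dHperm : {N M : ℕ} → N ≤ₙ M → Permutation′ N → Permutation′ M → ℚ
dHperm {N} {M} le σ σ' =
  ratio (count M (λ y → disagree y)) M
  where
  disagree : Fin M → Bool
  disagree y = allFinB N (λ x → not (inject≤ x le == y))
             ∨ anyFin N (λ x → (inject≤ x le == y) ∧ not (inject≤ (σ ⟨$⟩ʳ x) le == (σ' ⟨$⟩ʳ y)))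

DistAtMost : {g N M : ℕ} → N ≤ₙ M → Perms g N → Perms g M → ℚ → Set
DistAtMost le φ ψ δ = ∀ s → dHperm le (φ s) (ψ s) ≤ δ

-- rate function ρ : [0,1] → [0,1] (restricted to rational arguments), ρ(ε) → 0
RateFunction : (ℚ → ℚ) → Set
RateFunction ρ =
  (∀ ε → 0ℚ ≤ ε → ε ≤ 1ℚ → (0ℚ ≤ ρ ε) × (ρ ε ≤ 1ℚ)) ×
  (∀ δ → 0ℚ < δ → ∃[ η ] ((0ℚ < η) × (∀ ε → 0ℚ ≤ ε → ε ≤ η → ρ ε ≤ δ)))

-- ρ-stability (Ω nonempty so that probabilities make sense)
Stable : Presentation → (ℚ → ℚ) → Set
Stable P ρ =
  ∀ (ε : ℚ) → 0ℚ ≤ ε → ε ≤ 1ℚ →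
  ∀ (N : ℕ) (φ : Perms (gens P) (suc N)) → DefectAtMost P φ ε →
  ∃[ M ] Σ (suc N ≤ₙ suc M) λ le → Σ (Perms (gens P) (suc M)) λ ψ →
    IsAction P ψ × DistAtMost le φ ψ (ρ ε)

Sofic : Presentation → Set
Sofic P =
  Σ (ℕ → ℕ) λ N → Σ ((n : ℕ) → Perms (gens P) (suc (N n))) λ φ → Σ (ℕ → ℚ) λ ε →
    (∀ n → DefectAtMost P (φ n) (ε n)) × Tends0 ε ×
    (∀ w → ¬ Trivial P w → Tends1 (λ n → moved (φ n) w))

-- residual finiteness: every nontrivial element survives in some finite
-- quotient; finite quotients are realised as actions on Fin M
ResiduallyFinite : Presentation → Set
ResiduallyFinite P =
  ∀ w → ¬ Trivial P w →
  ∃[ M ] Σ (Perms (gens P) M) λ ψ → IsAction P ψ × ∃[ x ] (¬ (act ψ w x ≡ x))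

-- Finite pure 3-dimensional simplicial complexes
-- (vertex set Fin n, given by its list of 3-simplices = facets;
--  simplices are the nonempty subsets of facets; subsets are Vec Bool n)

Subset : ℕ → Set
Subset n = Vec Bool n

size : {n : ℕ} → Subset n → ℕ
size {n} σ = count n (lookup σ)

subB : {n : ℕ} → Subset n → Subset n → Bool
subB {n} σ τ = allFinB n (λ i → not (lookup σ i) ∨ lookup τ i)

record Complex : Set where
  field
    n         : ℕ
    facets    : List (Subset n)
    facetSize : All (λ F → size F ≡ 4) facets
    distinct  : Unique facets
    nonempty  : 1 ≤ₙ length facets
    -- every vertex is a 0-simplex, i.e. lies in a facet (purity)
    vertices  : ∀ (v : Fin n) → T (anyL (λ F → lookup F v) facets)
open Complex public

-- σ is a face of Y (σ ⊆ some facet); the empty set counts as the (-1)-face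
inY : (Y : Complex) → Subset (n Y) → Bool
inY Y σ = anyL (subB σ) (facets Y)

pair : {n : ℕ} → Fin n → Fin n → Subset n
pair u v = tabulate (λ i → (i == u) ∨ (i == v))

isEdge : (Y : Complex) → Fin (n Y) → Fin (n Y) → Bool
isEdge Y u v = not (u == v) ∧ inY Y (pair u v)

data Reach {n : ℕ} (E : Fin n → Fin n → Bool) : Fin n → Fin n → Set where
  here : ∀ {u} → Reach E u u
  step : ∀ {u v w} → Reach E u v → T (E v w) → Reach E u w

Connected : Complex → Set
Connected Y = ∀ u v → Reach (isEdge Y) u v

-- Cochains over F₂ = Bool, coboundary, weights, norm, large cosystoles
-- A k-cochain is a function on subsets, of which only the values on
-- faces of size k+1 matter.

Cochain : ℕ → Set
Cochain n = Subset n → Bool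

δ : {n : ℕ} → Cochain n → Cochain n
δ {n} α σ = foldr (λ i acc → (lookup σ i ∧ α (σ [ i ]≔ false)) xor acc) false (allFin n)

allSubsets : (n : ℕ) → List (Subset n)
allSubsets zero    = [] ∷ []
allSubsets (suc n) = map (true ∷_) (allSubsets n) ++ map (false ∷_) (allSubsets n)

countL : {A : Set} → (A → Bool) → List A → ℕ
countL p = foldr (λ a k → (if p a then 1 else 0) +ₙ k) 0

-- w(σ) = C(4,|σ|)⁻¹ · Pr_{τ ∈ Y(3)}[σ ⊆ τ]   (d = 3)
weight : (Y : Complex) → Subset (n Y) → ℚ
weight Y σ = ratio (countL (subB σ) (facets Y)) ((4 C size σ) *ₙ length (facets Y))

-- norm of a (s-1)-cochain: sum of weights of faces σ with |σ| = s, α σ = 1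
norm : (Y : Complex) → ℕ → Cochain (n Y) → ℚ
norm Y s α = sumℚ (map (λ σ → if (size σ Data.Nat.≡ᵇ s) ∧ inY Y σ ∧ α σ then weight Y σ else 0ℚ)
                       (allSubsets (n Y)))

-- α ∈ Z^k  (s = k+1)
Cocycle : (Y : Complex) → ℕ → Cochain (n Y) → Set
Cocycle Y s α = ∀ σ → T (inY Y σ) → size σ ≡ suc s → δ α σ ≡ false

-- α ∈ B^k  (s = k+1)
Coboundary : (Y : Complex) → ℕ → Cochain (n Y) → Set
Coboundary Y s α = ∃[ β ] (∀ σ → T (inY Y σ) → size σ ≡ s → α σ ≡ δ β σ)

-- κ-large cosystoles: for 0 ≤ k ≤ d-1 = 2, every α ∈ Z^k ∖ B^k has d_w(α, B^k) ≥ κ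
LargeCosystoles : ℚ → Complex → Set
LargeCosystoles κ Y =
  ∀ k → k ≤ₙ 2 → ∀ (α : Cochain (n Y)) → Cocycle Y (suc k) α → ¬ Coboundary Y (suc k) α →
  ∀ (β : Cochain (n Y)) → κ ≤ norm Y (suc k) (λ σ → α σ xor δ β σ)

img : {m n : ℕ} → (Fin m → Fin n) → Subset m → Subset n
img {m} p F = tabulate (λ x → anyFin m (λ i → lookup F i ∧ (p i == x)))

InStar : (Y : Complex) → Fin (n Y) → Fin (n Y) → Set
InStar Y y a = ∃[ F ] (F ∈ facets Y × T (lookup F y) × T (lookup F a))

record Cover (X : Complex) : Set where
  field
    Y         : Complex
    p         : Fin (n Y) → Fin (n X)
    connected : Connected Y
    facetImg  : ∀ F → F ∈ facets Y → img p F ∈ facets X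
    facetInj  : ∀ F → F ∈ facets Y → ∀ i j → T (lookup F i) → T (lookup F j) → p i ≡ p j → i ≡ j
    starInj   : ∀ y a b → InStar Y y a → InStar Y y b → p a ≡ p b → a ≡ b
    starLift  : ∀ y G → G ∈ facets X → T (lookup G (p y)) →
                Σ (Subset (n Y)) λ F → F ∈ facets Y × T (lookup F y) × img p F ≡ G ×
                  (∀ F' → F' ∈ facets Y → T (lookup F' y) → img p F' ≡ G → F' ≡ F)

-- Fundamental group: edge-path presentation relative to a spanning tree

record SpanningTree (X : Complex) : Set where
  field
    edges  : List (Fin (n X) × Fin (n X))
    valid  : All (λ e → (proj₁ e Data.Fin.< proj₂ e) × T (isEdge X (proj₁ e) (proj₂ e))) edges
    uniq   : Unique edges
    count≡ : length edges ≡ n X ∸ 1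
    spans  : ∀ u v → Reach (λ a b → anyL (λ e → ((proj₁ e == a) ∧ (proj₂ e == b)) ∨ ((proj₁ e == b) ∧ (proj₂ e == a))) edges) u v
open SpanningTree public

π₁Pres : (X : Complex) → SpanningTree X → Presentation
π₁Pres X Tr = record { gens = n X *ₙ n X ; rels = relsX }
  where
  N = n X
  e : Fin N → Fin N → Letter (N *ₙ N)
  e u v = combine u v , false
  vs = allFin N
  relsX : List (Word (N *ₙ N))
  relsX =
       concatMap (λ u → concatMap (λ v → if isEdge X u v then [] else ((e u v ∷ []) ∷ [])) vs) vs
    ++ concatMap (λ u → map (λ v → e u v ∷ e v u ∷ []) vs) vs
    ++ map (λ uv → e (proj₁ uv) (proj₂ uv) ∷ []) (edges Tr)
    ++ concatMap (λ u → concatMap (λ v → concatMap (λ w →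
         if inY X (tabulate (λ i → (i == u) ∨ (i == v) ∨ (i == w)))
         then ((e u v ∷ e v w ∷ e w u ∷ []) ∷ []) else []) vs) vs) vs

-- Central 2-extensions  0 → ℤ/2 --ι--> Γ̃ --π--> Γ → 1
-- Γ̃ given by a finite presentation, ι(1) = z, π given on generators.

πWord : (P Q : Presentation) → (Fin (gens Q) → Word (gens P)) → Word (gens Q) → Word (gens P)
πWord P Q π = concatMap (λ l → if proj₂ l then invW (π (proj₁ l)) else π (proj₁ l))

record CentralExt (Γ Γ̃ : Presentation) : Set where
  field
    z   : Word (gens Γ̃)
    π   : Fin (gens Γ̃) → Word (gens Γ)
    πhom  : ∀ r → r ∈ rels Γ̃ → Trivial Γ (πWord Γ Γ̃ π r)
    ιhom  : Trivial Γ̃ (z ++ z)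
    ιinj  : ¬ Trivial Γ̃ z
    central : ∀ s → Γ̃ ⊢ ((s , false) ∷ z) ≈ (z ++ ((s , false) ∷ []))
    πsurj : ∀ s → ∃[ w ] (Γ ⊢ πWord Γ Γ̃ π w ≈ ((s , false) ∷ []))
    πι    : Trivial Γ (πWord Γ Γ̃ π z)
    kerπ  : ∀ w → Trivial Γ (πWord Γ Γ̃ π w) → Trivial Γ̃ w ⊎ (Γ̃ ⊢ w ≈ z)

{-# OPTIONS --safe #-}
-- Let w be nontrivial in Γ̃, let z generate the kernel of π, and let ω be the 2-cocycle of the extension on X with
-- respect to chosen lifts L of the edges. In a good almost action of Γ̃ the element z acts almost as a free
-- involution, so dividing by it gives an almost action of Γ together with signs α with δα ≈ ω. Stability replaces the
-- almost action by an action ψ; on a suitable orbit, i.e. on a finite connected cover Y of X, δα and the pullback of ω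
-- are still close, so large cosystoles force ω = δβ on Y. Then β extends ψ to an action of Γ̃ on the double Y × ℤ/2.
-- If w acts trivially there, twist ψ by α + β instead: this is an almost action of Γ, because δ(α + β) ≈ 0, and w
-- acts on it almost as the swap of ℤ/2; by stability some finite action of Γ moves w. In both cases w survives in an
-- explicit finite action, so no case distinction on whether π(w) is trivial (which is undecidable) is needed.
module Submission where

open import Defs
open import Algebra.Bundles using (Group)
import Algebra.Properties.Group as GroupProperties
open import Data.Bool using (Bool; true; false; not; _∧_; _∨_; _xor_; if_then_else_; T)
open import Data.Bool.Properties using (∧-identityʳ; ∧-zeroʳ; ∧-inverseʳ; ∨-zeroʳ; ∨-comm; ¬-not; not-¬; xor-assoc; xor-comm; xor-same; xor-identityʳ) renaming (_≟_ to _≟B_)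
open import Data.Empty using (⊥; ⊥-elim)
open import Data.Fin using (Fin; zero; suc; _↑ˡ_; _↑ʳ_; splitAt; combine; remQuot; inject≤; funToFin; finToFun; cast)
open import Data.Fin.Permutation using (Permutation′; permutation; _⟨$⟩ʳ_; _⟨$⟩ˡ_; inverseˡ; inverseʳ; _∘ₚ_; transpose)
import Data.Fin.Permutation as Perm
import Data.Fin.Permutation.Components as PC
open import Data.Fin.Properties using (any?; splitAt-↑ˡ; splitAt-↑ʳ; splitAt⁻¹-↑ˡ; splitAt⁻¹-↑ʳ; remQuot-combine; combine-remQuot; combine-injective; inject≤-injective; injective⇒≤; funToFin-finToFin; finToFun-funToFin; cast-trans; cast-is-id) renaming (_≟_ to _≟F_; _<?_ to _<F?_; <-cmp to <F-cmp; suc-injective to sucF-injective)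
import Data.Integer as ℤ
import Data.Integer.Properties as ℤ
open import Data.List using (List; []; _∷_; _++_; length; map; foldr; concatMap; allFin; cartesianProductWith)
import Data.List as List
open import Data.List.Membership.Propositional using (_∈_; find; lose)
open import Data.List.Membership.Propositional.Properties using (∈-allFin; ∈-lookup; ∈-++⁺ˡ; ∈-++⁺ʳ; ∈-++⁻; ∈-concatMap⁺; ∈-concatMap⁻; ∈-map⁺; ∈-map⁻; ∈-cartesianProductWith⁺; ∈-cartesianProductWith⁻)
open import Data.List.Properties using (++-assoc; ++-identityʳ; concatMap-++; unfold-reverse; length-++; length-map; length-tabulate)
open import Data.List.Relation.Unary.All as All using (All; []; _∷_)
open import Data.List.Relation.Unary.AllPairs using ([]; _∷_)
open import Data.List.Relation.Unary.Any as Any using (here; there)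
open import Data.List.Relation.Unary.Any.Properties using (lookup-index)
open import Data.List.Relation.Unary.Unique.Propositional using (Unique)
open import Data.List.Relation.Unary.Unique.Propositional.Properties using (allFin⁺; cartesianProductWith⁺; map⁺; ++⁺)
open import Data.Nat using (ℕ; zero; suc; _+_; _*_; _∸_; _^_; _≤_; _<_; z≤n; s≤s; _⊔_; _≡ᵇ_)
open import Data.Nat.Combinatorics using (_C_)
open import Data.Nat.Properties
open import Data.Product using (Σ; _×_; _,_; ∃; ∃-syntax; proj₁; proj₂; uncurry)
open import Data.Rational as ℚ using (ℚ; 0ℚ; 1ℚ; mkℚ)
import Data.Rational.Properties as ℚ
open import Data.Rational.Unnormalised as ℚᵘ using (mkℚᵘ; *≤*)
import Data.Rational.Unnormalised.Properties as ℚᵘ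
open import Data.Sum using (_⊎_; inj₁; inj₂; [_,_]′)
open import Data.Vec using ([]; _∷_; lookup; tabulate; _[_]≔_)
open import Data.Vec.Properties using (lookup∘tabulate; tabulate∘lookup; tabulate-cong; lookup∘update; lookup∘update′)
open import Function using (_∘_; id; case_of_)
open import Level using (0ℓ)
open import Relation.Binary.Definitions using (tri<; tri≈; tri>)
open import Relation.Binary.PropositionalEquality
import Relation.Binary.Reasoning.Setoid as SetoidReasoning
open import Relation.Nullary using (¬_; Dec; yes; no)
open import Relation.Nullary.Decidable using (⌊_⌋; map′; _→-dec_; ¬?; decidable-stable)

-- Three points shape the details. First, no quotient set by `z` is formed: the almost action of `Γ`
-- lives on the original points, and its discrepancy from the lifts `L` is recorded as the cochain
-- α, so that a relation between words of `Γ̃` becomes a relation between signs wherever `z` acts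
-- freely. Second, the precision needed depends only on the complex, κ, ρ and `w`. It is fixed
-- before a member of the sofic approximation is chosen, and one exceptional set carries the
-- conditions on the triangles and on `w` together, so that a single orbit is good for both. Third,
-- the β obtained from large cosystoles lives on the edges of `Y` and need not vanish on the lifts
-- of the spanning tree, whereas tree generators are trivial in the edge-path presentation. Adding
-- the coboundary of a function on the vertices, chosen sheet by sheet, repairs this without
-- changing δβ.

==-refl : ∀ {n} (i : Fin n) → (i == i) ≡ true
==-refl i with i ≟F i
... | yes _ = refl
... | no ¬p = ⊥-elim (¬p refl)

==⇒≡ : ∀ {n} {i j : Fin n} → (i == j) ≡ true → i ≡ j
==⇒≡ {i = i} {j} h with i ≟F j
... | yes p = p

≢⇒== : ∀ {n} {i j : Fin n} → i ≢ j → (i == j) ≡ false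
≢⇒== {i = i} {j} h with i ≟F j
... | yes p = ⊥-elim (h p)
... | no _  = refl

==false⇒≢ : ∀ {n} {i j : Fin n} → (i == j) ≡ false → i ≢ j
==false⇒≢ {i = i} h refl with trans (sym (==-refl i)) h
... | ()

∨-false : ∀ {a b} → a ∨ b ≡ false → a ≡ false × b ≡ false
∨-false {false} {false} _ = refl , refl

∧-true : ∀ {a b} → a ∧ b ≡ true → a ≡ true × b ≡ true
∧-true {true} {true} _ = refl , refl

not≡true : ∀ {a} → not a ≡ true → a ≡ false
not≡true {false} _ = refl

-- Counting on finite sets.

count-mono : ∀ {n} {f g : Fin n → Bool} → (∀ i → f i ≡ true → g i ≡ true) → count n f ≤ count n g
count-mono {zero} h = z≤n
count-mono {suc n} {f} {g} h with f zero | g zero | h zero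
... | false | false | _ = count-mono (h ∘ suc)
... | false | true  | _ = m≤n⇒m≤1+n (count-mono (h ∘ suc))
... | true  | true  | _ = s≤s (count-mono (h ∘ suc))
... | true  | false | k with k refl
...   | ()

count-cong : ∀ {n} {f g : Fin n → Bool} → (∀ i → f i ≡ g i) → count n f ≡ count n g
count-cong {f = f} {g} h = ≤-antisym (count-mono (λ i q → trans (sym (h i)) q)) (count-mono (λ i q → trans (h i) q))

count-∨ : ∀ {n} (f g : Fin n → Bool) → count n (λ i → f i ∨ g i) ≤ count n f + count n g
count-∨ {zero} f g = z≤n
count-∨ {suc n} f g with f zero | g zero
... | false | false = count-∨ (f ∘ suc) (g ∘ suc)
... | false | true  = ≤-trans (s≤s (count-∨ (f ∘ suc) (g ∘ suc))) (≤-reflexive (sym (+-suc _ _)))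
... | true  | false = s≤s (count-∨ (f ∘ suc) (g ∘ suc))
... | true  | true  = s≤s (≤-trans (count-∨ (f ∘ suc) (g ∘ suc)) (+-monoʳ-≤ (count n (f ∘ suc)) (n≤1+n _)))

count-not : ∀ {n} (f : Fin n → Bool) → count n f + count n (not ∘ f) ≡ n
count-not {zero} f = refl
count-not {suc n} f with f zero
... | true  = cong suc (count-not (f ∘ suc))
... | false = trans (+-suc _ _) (cong suc (count-not (f ∘ suc)))

count-split : ∀ {n} (f g : Fin n → Bool) → count n f ≡ count n (λ i → f i ∧ g i) + count n (λ i → f i ∧ not (g i))
count-split {zero} f g = refl
count-split {suc n} f g with f zero | g zero
... | true  | true  = cong suc (count-split (f ∘ suc) (g ∘ suc))
... | true  | false = trans (cong suc (count-split (f ∘ suc) (g ∘ suc))) (sym (+-suc _ _))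
... | false | true  = count-split (f ∘ suc) (g ∘ suc)
... | false | false = count-split (f ∘ suc) (g ∘ suc)

count-none : ∀ {n} {f : Fin n → Bool} → (∀ i → f i ≡ false) → count n f ≡ 0
count-none {zero} h = refl
count-none {suc n} {f} h with f zero | h zero
... | false | _ = count-none (h ∘ suc)

count-all : ∀ {n} {f : Fin n → Bool} → (∀ i → f i ≡ true) → count n f ≡ n
count-all {zero} h = refl
count-all {suc n} {f} h with f zero | h zero
... | true | _ = cong suc (count-all (h ∘ suc))

count-+ : ∀ m n (f : Fin (m + n) → Bool) → count (m + n) f ≡ count m (λ i → f (i ↑ˡ n)) + count n (λ i → f (m ↑ʳ i))
count-+ zero n f = refl
count-+ (suc m) n f = trans (cong ((if f zero then 1 else 0) +_) (count-+ m n (f ∘ suc))) (sym (+-assoc (if f zero then 1 else 0) _ _))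

count-point : ∀ {n} (f : Fin n → Bool) a → f a ≡ true → count n f ≡ suc (count n (λ i → f i ∧ not (i == a)))
count-point {suc n} f zero h with f zero | h
... | true | _ = cong suc (count-cong λ i → sym (∧-identityʳ (f (suc i))))
count-point {suc n} f (suc a) h =
  trans (cong₂ (λ p q → (if p then 1 else 0) + q) (sym (∧-identityʳ (f zero))) (count-point (f ∘ suc) a h))
        (trans (+-suc _ _) (cong suc (cong (_ +_) (count-cong λ i → cong (λ b → f (suc i) ∧ not b) (sym (suc== i a))))))
  where
  suc== : ∀ {n} (i j : Fin n) → (Fin.suc i == suc j) ≡ (i == j)
  suc== i j with i ≟F j
  ... | yes refl = refl
  ... | no _ = refl

count-witness : ∀ {n} (f : Fin n → Bool) → 0 < count n f → ∃[ i ] f i ≡ true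
count-witness {suc n} f h with f zero in eq
... | true  = zero , eq
... | false with count-witness (f ∘ suc) h
...   | i , q = suc i , q

count-inj : ∀ {m n} (r : Fin m → Fin n) → (∀ {i j} → r i ≡ r j → i ≡ j) → (f : Fin n → Bool) →
  count m (f ∘ r) ≤ count n f
count-inj {zero} r inj f = z≤n
count-inj {suc m} {n} r inj f with f (r zero) in eq
... | false = count-inj (r ∘ suc) (λ q → sucF-injective (inj q)) f
... | true = ≤-trans (s≤s (≤-trans (≤-reflexive (count-cong same)) (count-inj (r ∘ suc) (λ q → sucF-injective (inj q)) _)))
                     (≤-reflexive (sym (count-point f (r zero) eq)))
  where
  same : ∀ i → f (r (suc i)) ≡ f (r (suc i)) ∧ not (r (suc i) == r zero)
  same i rewrite ≢⇒== {i = r (suc i)} {r zero} (λ q → case inj q of λ ()) with f (r (suc i))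
  ... | true = refl
  ... | false = refl

-- Statements with few exceptions.

record Exc {N : ℕ} (c : ℕ) (P : Fin N → Set) : Set where
  constructor exc
  field
    -- A Boolean superset of the failures, so that exceptions can be counted although `P` need not
    -- be decidable.
    bad  : Fin N → Bool
    few  : count N bad ≤ c
    good : ∀ x → bad x ≡ false → P x
open Exc public

module _ {N : ℕ} where
  Exc-all : {P : Fin N → Set} → (∀ x → P x) → Exc 0 P
  Exc-all h = exc (λ _ → false) (≤-reflexive (count-none {N} (λ _ → refl))) (λ x _ → h x)

  Exc-map : ∀ {c} {P Q : Fin N → Set} → (∀ x → P x → Q x) → Exc c P → Exc c Q
  Exc-map h (exc b f g) = exc b f (λ x q → h x (g x q))

  Exc-× : ∀ {c d} {P Q : Fin N → Set} → Exc c P → Exc d Q → Exc (c + d) (λ x → P x × Q x)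
  Exc-× (exc b f g) (exc b' f' g') = exc (λ x → b x ∨ b' x) (≤-trans (count-∨ b b') (+-mono-≤ f f'))
    (λ x q → g x (proj₁ (∨-false q)) , g' x (proj₂ (∨-false {b x} q)))

  Exc-∃ : ∀ {c} {P : Fin N → Set} → c < N → Exc c P → ∃[ x ] P x
  Exc-∃ {c} lt (exc b f g) with count-witness (not ∘ b) (≰⇒> λ q → <⇒≱ lt (≤-trans (≤-reflexive (sym (count-not b)))
                                   (≤-trans (+-mono-≤ f q) (≤-reflexive (+-identityʳ _)))))
  ... | x , q = x , g x (not≡true q)

-- The preimage of the exceptional set under an injection is no larger, so composing with a
-- permutation costs nothing.
Exc-pull : ∀ {M N c} {P : Fin N → Set} (τ : Fin M → Fin N) → (∀ {i j} → τ i ≡ τ j → i ≡ j) →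
  Exc c P → Exc c (P ∘ τ)
Exc-pull τ inj (exc b f g) = exc (b ∘ τ) (≤-trans (count-inj τ inj b) f) (λ x → g (τ x))

-- Densities are bounded in the form `K * c ≤ m`, that is, c/m ≤ 1/K. Asking `2 * K` of each of two
-- exceptional sets leaves `K` for their union.
halve : ∀ K c c' m → 2 * K * c ≤ m → 2 * K * c' ≤ m → K * (c + c') ≤ m
halve K c c' m h h' = *-cancelˡ-≤ 2 (begin
  2 * (K * (c + c'))      ≡⟨ sym (*-assoc 2 K (c + c')) ⟩
  2 * K * (c + c')        ≡⟨ *-distribˡ-+ (2 * K) c c' ⟩
  2 * K * c + 2 * K * c'  ≤⟨ +-mono-≤ h h' ⟩
  m + m                   ≡⟨ cong (m +_) (sym (+-identityʳ m)) ⟩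
  2 * m                   ∎)
  where open ≤-Reasoning

Exc-count : ∀ {N c} {P : Fin N → Set} (b : Fin N → Bool) → (∀ x → P x → b x ≡ false) → Exc c P → count N b ≤ c
Exc-count b h (exc b' f g) = ≤-trans (count-mono λ x q → contra x q) f
  where
  contra : ∀ x → b x ≡ true → b' x ≡ true
  contra x q with b' x in eq
  ... | true  = refl
  ... | false = case trans (sym q) (h x (g x eq)) of λ ()

-- AA P: the exceptions to P n in Fin (suc (N n)) have density tending to 0.
module AlmostAll (N : ℕ → ℕ) where
  record AA (P : (n : ℕ) → Fin (suc (N n)) → Set) : Set where
    constructor aa
    field
      eventually : ∀ K → ∃[ n₀ ] (∀ n → n₀ ≤ n → ∃[ c ] (K * c ≤ suc (N n) × Exc c (P n)))
  open AA public

  AA-all : ∀ {P} → (∀ n x → P n x) → AA P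
  AA-all h = aa λ K → 0 , λ n _ → 0 , ≤-trans (≤-reflexive (*-zeroʳ K)) z≤n , Exc-all (h n)

  AA-map : ∀ {P Q} → (∀ n x → P n x → Q n x) → AA P → AA Q
  AA-map h p = aa λ K → let n₀ , q = eventually p K in
    n₀ , λ n le → let c , k , e = q n le in c , k , Exc-map (h n) e

  AA-× : ∀ {P Q} → AA P → AA Q → AA (λ n x → P n x × Q n x)
  AA-× p q = aa λ K → let n₀ , f = eventually p (2 * K) ; n₁ , g = eventually q (2 * K) in
    n₀ ⊔ n₁ , λ n le →
    let c , k , e   = f n (≤-trans (m≤m⊔n n₀ n₁) le)
        c' , k' , e' = g n (≤-trans (m≤n⊔m n₀ n₁) le)
    in c + c' , halve K c c' (suc (N n)) k k' , Exc-× e e'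

  AA-pull : ∀ {P} (τ : ∀ n → Fin (suc (N n)) → Fin (suc (N n))) → (∀ n {i j} → τ n i ≡ τ n j → i ≡ j) →
    AA P → AA (λ n x → P n (τ n x))
  AA-pull τ inj p = aa λ K → let n₀ , q = eventually p K in
    n₀ , λ n le → let c , k , e = q n le in c , k , Exc-pull (τ n) (inj n) e

  AA-∀ : ∀ {k} {P : Fin k → (n : ℕ) → Fin (suc (N n)) → Set} → (∀ i → AA (P i)) → AA (λ n x → ∀ i → P i n x)
  AA-∀ {zero}  h = AA-all (λ n x ())
  AA-∀ {suc k} h = AA-map (λ { n x (a , b) zero → a ; n x (a , b) (suc i) → b i }) (AA-× (h zero) (AA-∀ (λ i → h (suc i))))

-- Comparing fractions through natural numbers.

ratioᵘ : ∀ a b → ℚ.toℚᵘ (ratio a (suc b)) ℚᵘ.≃ mkℚᵘ (ℤ.+ a) b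
ratioᵘ a b = ℚ.toℚᵘ-fromℚᵘ (mkℚᵘ (ℤ.+ a) b)

ratio-≤⁺ : ∀ {a b c d} → a * suc d ≤ c * suc b → ratio a (suc b) ℚ.≤ ratio c (suc d)
ratio-≤⁺ {a} {b} {c} {d} h = ℚ.toℚᵘ-cancel-≤ (ℚᵘ.≤-respʳ-≃ (ℚᵘ.≃-sym (ratioᵘ c d)) (ℚᵘ.≤-respˡ-≃ (ℚᵘ.≃-sym (ratioᵘ a b))
  (*≤* (subst₂ ℤ._≤_ (ℤ.pos-* a (suc d)) (ℤ.pos-* c (suc b)) (ℤ.+≤+ h)))))

ratio-≤⁻ : ∀ {a b c d} → ratio a (suc b) ℚ.≤ ratio c (suc d) → a * suc d ≤ c * suc b
ratio-≤⁻ {a} {b} {c} {d} h with ℚᵘ.≤-respʳ-≃ (ratioᵘ c d) (ℚᵘ.≤-respˡ-≃ (ratioᵘ a b) (ℚ.toℚᵘ-mono-≤ h))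
... | *≤* q = ℤ.drop‿+≤+ (subst₂ ℤ._≤_ (sym (ℤ.pos-* a (suc d))) (sym (ℤ.pos-* c (suc b))) q)

ratio-<⁺ : ∀ {a b c d} → a * suc d < c * suc b → ratio a (suc b) ℚ.< ratio c (suc d)
ratio-<⁺ {a} {b} {c} {d} h = ℚ.≰⇒> λ q → <⇒≱ h (ratio-≤⁻ {c} {d} {a} {b} q)

ratio-+ : ∀ a c b → ratio (a + c) (suc b) ≡ ratio a (suc b) ℚ.+ ratio c (suc b)
ratio-+ a c b = ℚ.toℚᵘ-injective (ℚᵘ.≃-trans (ratioᵘ (a + c) b) (ℚᵘ.≃-sym (ℚᵘ.≃-trans
  (ℚ.toℚᵘ-homo-+ (ratio a (suc b)) (ratio c (suc b)))
  (ℚᵘ.≃-trans (ℚᵘ.+-cong (ratioᵘ a b) (ratioᵘ c b)) (ℚᵘ.*≡* eq)))))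
  where
  open ≡-Reasoning
  D = ℤ.+ suc b
  eq : (ℤ.+ a ℤ.* D ℤ.+ ℤ.+ c ℤ.* D) ℤ.* D ≡ ℤ.+ (a + c) ℤ.* ℤ.+ (suc b * suc b)
  eq = begin
    (ℤ.+ a ℤ.* D ℤ.+ ℤ.+ c ℤ.* D) ℤ.* D ≡⟨ cong (ℤ._* D) (sym (ℤ.*-distribʳ-+ D (ℤ.+ a) (ℤ.+ c))) ⟩
    (ℤ.+ a ℤ.+ ℤ.+ c) ℤ.* D ℤ.* D       ≡⟨ ℤ.*-assoc (ℤ.+ a ℤ.+ ℤ.+ c) D D ⟩
    (ℤ.+ a ℤ.+ ℤ.+ c) ℤ.* (D ℤ.* D)     ≡⟨ cong (ℤ._* (D ℤ.* D)) (sym (ℤ.pos-+ a c)) ⟩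
    ℤ.+ (a + c) ℤ.* (D ℤ.* D)         ≡⟨ cong (ℤ.+ (a + c) ℤ.*_) (sym (ℤ.pos-* (suc b) (suc b))) ⟩
    ℤ.+ (a + c) ℤ.* ℤ.+ (suc b * suc b) ∎

ratio-n/n : ∀ b → ratio (suc b) (suc b) ≡ 1ℚ
ratio-n/n b = ℚ.≤-antisym (ratio-≤⁺ {suc b} {b} {1} {0} (≤-reflexive (*-comm (suc b) 1)))
                          (ratio-≤⁺ {1} {0} {suc b} {b} (≤-reflexive (*-comm 1 (suc b))))

ratio-pos : ∀ k → 0ℚ ℚ.< ratio 1 (suc k)
ratio-pos k = ratio-<⁺ {0} {0} {1} {k} (s≤s z≤n)

ratio-≥0 : ∀ a b → 0ℚ ℚ.≤ ratio a (suc b)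
ratio-≥0 a b = ratio-≤⁺ {0} {0} {a} {b} z≤n

-- A positive fraction is at least the reciprocal of its own denominator.
archimedean : ∀ {ε} → 0ℚ ℚ.< ε → ∃[ k ] ratio 1 (suc k) ℚ.≤ ε
archimedean {mkℚ (ℤ.+ zero) d c} (ℚ.*<* h) = ⊥-elim (ℤ.<-irrefl refl h)
archimedean {mkℚ ℤ.-[1+ p ] d c} (ℚ.*<* ())
archimedean {ε@(mkℚ (ℤ.+ suc p) d c)} h = d , subst (ratio 1 (suc d) ℚ.≤_) (ℚ.↥p/↧p≡p ε)
  (ratio-≤⁺ {1} {d} {suc p} {d} (*-monoˡ-≤ (suc d) {1} {suc p} (s≤s z≤n)))

xor-interchange : ∀ a b c d → (a xor b) xor (c xor d) ≡ (a xor c) xor (b xor d)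
xor-interchange a b c d = trans (xor-assoc a b _) (trans (cong (a xor_) swap) (sym (xor-assoc a c _)))
  where
  swap : b xor (c xor d) ≡ c xor (b xor d)
  swap = trans (sym (xor-assoc b c d)) (trans (cong (_xor d) (xor-comm b c)) (xor-assoc c b d))

xor-cancelˡ : ∀ a {b c} → a xor b ≡ a xor c → b ≡ c
xor-cancelˡ false q = q
xor-cancelˡ true {true}  {true}  q = refl
xor-cancelˡ true {false} {false} q = refl

xor≡false : ∀ {a b} → a xor b ≡ false → a ≡ b
xor≡false {true}  {true}  q = refl
xor≡false {false} {false} q = refl

-- Words, presented groups and their actions.

invL : ∀ {g} → Letter g → Letter g
invL l = proj₁ l , not (proj₂ l)

invW-∷ : ∀ {g} (l : Letter g) w → invW (l ∷ w) ≡ invW w ++ (invL l ∷ [])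
invW-∷ l w = unfold-reverse (invL l) (map invL w)

module _ {g N : ℕ} (φ : Perms g N) where
  act-++ : ∀ u v x → act φ (u ++ v) x ≡ act φ u (act φ v x)
  act-++ []      v x = refl
  act-++ (l ∷ u) v x = cong (applyL φ l) (act-++ u v x)

  applyL-invˡ : ∀ l x → applyL φ (invL l) (applyL φ l x) ≡ x
  applyL-invˡ (s , false) x = inverseˡ (φ s)
  applyL-invˡ (s , true)  x = inverseʳ (φ s)

  applyL-invʳ : ∀ l x → applyL φ l (applyL φ (invL l) x) ≡ x
  applyL-invʳ (s , false) x = inverseʳ (φ s)
  applyL-invʳ (s , true)  x = inverseˡ (φ s)

  act-invˡ : ∀ w x → act φ (invW w) (act φ w x) ≡ x
  act-invˡ []      x = refl
  act-invˡ (l ∷ w) x = begin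
    act φ (invW (l ∷ w)) y                  ≡⟨ cong (λ u → act φ u y) (invW-∷ l w) ⟩
    act φ (invW w ++ (invL l ∷ [])) y       ≡⟨ act-++ (invW w) _ y ⟩
    act φ (invW w) (applyL φ (invL l) y)    ≡⟨ cong (act φ (invW w)) (applyL-invˡ l _) ⟩
    act φ (invW w) (act φ w x)              ≡⟨ act-invˡ w x ⟩
    x                                       ∎
    where
    open ≡-Reasoning
    y = applyL φ l (act φ w x)

  act-invʳ : ∀ w x → act φ w (act φ (invW w) x) ≡ x
  act-invʳ []      x = refl
  act-invʳ (l ∷ w) x = begin
    applyL φ l (act φ w (act φ (invW (l ∷ w)) x))                  ≡⟨ cong (λ u → applyL φ l (act φ w (act φ u x))) (invW-∷ l w) ⟩
    applyL φ l (act φ w (act φ (invW w ++ (invL l ∷ [])) x))       ≡⟨ cong (applyL φ l ∘ act φ w) (act-++ (invW w) _ x) ⟩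
    applyL φ l (act φ w (act φ (invW w) (applyL φ (invL l) x)))    ≡⟨ cong (applyL φ l) (act-invʳ w _) ⟩
    applyL φ l (applyL φ (invL l) x)                               ≡⟨ applyL-invʳ l x ⟩
    x                                                              ∎
    where open ≡-Reasoning

  act-inj : ∀ w {x y} → act φ w x ≡ act φ w y → x ≡ y
  act-inj w {x} {y} q = trans (sym (act-invˡ w x)) (trans (cong (act φ (invW w)) q) (act-invˡ w y))

  wordPerm : Word g → Permutation′ N
  wordPerm w = permutation (act φ w) (act φ (invW w)) (act-invʳ w) (act-invˡ w)

act-≈ : ∀ P {N} {φ : Perms (gens P) N} → IsAction P φ → ∀ {u v} → P ⊢ u ≈ v → ∀ x → act φ u x ≡ act φ v x
act-≈ P φa ≈refl x = refl
act-≈ P φa (≈sym q) x = sym (act-≈ P φa q x)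
act-≈ P φa (≈trans q r) x = trans (act-≈ P φa q x) (act-≈ P φa r x)
act-≈ P {φ = φ} φa (≈cong {u} {u'} {v} {v'} q r) x =
  trans (act-++ φ u v x) (trans (cong (act φ u) (act-≈ P φa r x)) (trans (act-≈ P φa q _) (sym (act-++ φ u' v' x))))
act-≈ P {φ = φ} φa (≈free s false) x = inverseʳ (φ s)
act-≈ P {φ = φ} φa (≈free s true) x = inverseˡ (φ s)
act-≈ P φa (≈rel r) x = φa _ r x

≡⇒≈ : ∀ {P u v} → u ≡ v → P ⊢ u ≈ v
≡⇒≈ refl = ≈refl

inv-rightW : ∀ P w → P ⊢ w ++ invW w ≈ []
inv-rightW P []      = ≈refl
inv-rightW P (l ∷ w) = ≈trans (≡⇒≈ eq) (≈trans (≈cong {u = l ∷ []} ≈refl (≈cong (inv-rightW P w) ≈refl)) (≈free (proj₁ l) (proj₂ l)))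
  where
  eq : (l ∷ w) ++ invW (l ∷ w) ≡ (l ∷ []) ++ ((w ++ invW w) ++ (invL l ∷ []))
  eq = cong (l ∷_) (trans (cong (w ++_) (invW-∷ l w)) (sym (++-assoc w (invW w) _)))

inv-leftW : ∀ P w → P ⊢ invW w ++ w ≈ []
inv-leftW P []      = ≈refl
inv-leftW P (l ∷ w) = ≈trans (≡⇒≈ eq) (≈trans (≈cong {u = invW w} ≈refl (≈cong {v = w} (free l) ≈refl)) (inv-leftW P w))
  where
  eq : invW (l ∷ w) ++ (l ∷ w) ≡ invW w ++ ((invL l ∷ l ∷ []) ++ w)
  eq = trans (cong (_++ (l ∷ w)) (invW-∷ l w)) (++-assoc (invW w) _ _)
  free : ∀ l → P ⊢ (invL l ∷ l ∷ []) ≈ []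
  free (s , false) = ≈free s true
  free (s , true)  = ≈free s false

inv-congW : ∀ P {u v} → P ⊢ u ≈ v → P ⊢ invW u ≈ invW v
inv-congW P {u} {v} q =
  ≈trans (≡⇒≈ (sym (++-identityʳ (invW u))))
  (≈trans (≈cong {u = invW u} ≈refl (≈sym (inv-rightW P v)))
  (≈trans (≡⇒≈ (sym (++-assoc (invW u) v (invW v))))
  (≈cong {v = invW v} (≈trans (≈cong {u = invW u} ≈refl (≈sym q)) (inv-leftW P u)) ≈refl)))

-- The presented group, with words as representatives and derivable equality as setoid equality;
-- general facts about inverses thereby apply to words.
wordGroup : Presentation → Group 0ℓ 0ℓ
wordGroup P = record
  { Carrier = Word (gens P) ; _≈_ = P ⊢_≈_ ; _∙_ = _++_ ; ε = [] ; _⁻¹ = invW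
  ; isGroup = record
    { isMonoid = record
      { isSemigroup = record
        { isMagma = record { isEquivalence = record { refl = ≈refl ; sym = ≈sym ; trans = ≈trans } ; ∙-cong = ≈cong }
        ; assoc = λ u v w → ≡⇒≈ (++-assoc u v w) }
      ; identity = (λ _ → ≈refl) , (λ u → ≡⇒≈ (++-identityʳ u)) }
    ; inverse = inv-leftW P , inv-rightW P
    ; ⁻¹-cong = inv-congW P } }

module _ (P Q : Presentation) (f : Fin (gens Q) → Word (gens P)) where
  private module G = GroupProperties (wordGroup P)

  ext : Word (gens Q) → Word (gens P)
  ext = πWord P Q f

  ext-++ : ∀ u v → ext (u ++ v) ≡ ext u ++ ext v
  ext-++ = concatMap-++ _

  ext-letter : ∀ l → P ⊢ ext (invL l ∷ []) ≈ invW (ext (l ∷ []))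
  ext-letter (s , false) = ≡⇒≈ (trans (++-identityʳ _) (cong invW (sym (++-identityʳ (f s)))))
  ext-letter (s , true)  = ≈trans (≡⇒≈ (++-identityʳ _))
    (≈trans (≈sym (G.⁻¹-involutive (f s))) (≡⇒≈ (cong invW (sym (++-identityʳ (invW (f s)))))))

  ext-inv : ∀ w → P ⊢ ext (invW w) ≈ invW (ext w)
  ext-inv []      = ≈refl
  ext-inv (l ∷ w) = ≈trans (≡⇒≈ (trans (cong ext (invW-∷ l w)) (ext-++ (invW w) _)))
    (≈trans (≈cong (ext-inv w) (ext-letter l))
    (≈trans (≈sym (G.⁻¹-anti-homo-∙ (ext (l ∷ [])) (ext w))) (≡⇒≈ (cong invW (sym (ext-++ (l ∷ []) w))))))

  -- Von Dyck's theorem: free cancellation survives because `ext` turns inverse letters into inverse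
  -- words, and the hypothesis takes care of the relators.
  ext-≈ : (∀ r → r ∈ rels Q → Trivial P (ext r)) → ∀ {u v} → Q ⊢ u ≈ v → P ⊢ ext u ≈ ext v
  ext-≈ h ≈refl = ≈refl
  ext-≈ h (≈sym q) = ≈sym (ext-≈ h q)
  ext-≈ h (≈trans q r) = ≈trans (ext-≈ h q) (ext-≈ h r)
  ext-≈ h (≈cong {u} {u'} {v} {v'} q r) =
    ≈trans (≡⇒≈ (ext-++ u v)) (≈trans (≈cong (ext-≈ h q) (ext-≈ h r)) (≡⇒≈ (sym (ext-++ u' v'))))
  ext-≈ h (≈free s b) = ≈trans (≡⇒≈ (ext-++ ((s , b) ∷ []) ((s , not b) ∷ [])))
    (≈trans (≈cong {u = ext ((s , b) ∷ [])} ≈refl (ext-letter (s , b))) (inv-rightW P (ext ((s , b) ∷ []))))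
  ext-≈ h (≈rel r) = h _ r

  pull : ∀ {N} → Perms (gens P) N → Perms (gens Q) N
  pull φ s = wordPerm φ (f s)

  act-pull : ∀ {N} (φ : Perms (gens P) N) w x → act (pull φ) w x ≡ act φ (ext w) x
  act-pull φ [] x = refl
  act-pull φ ((s , false) ∷ w) x = trans (cong (act φ (f s)) (act-pull φ w x)) (sym (act-++ φ (f s) _ x))
  act-pull φ ((s , true)  ∷ w) x = trans (cong (act φ (invW (f s))) (act-pull φ w x)) (sym (act-++ φ (invW (f s)) _ x))

  pull-action : (∀ r → r ∈ rels Q → Trivial P (ext r)) → ∀ {N} {φ : Perms (gens P) N} → IsAction P φ → IsAction Q (pull φ)
  pull-action h {φ = φ} φa r r∈ x = trans (act-pull φ r x) (act-≈ P φa (h r r∈) x)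

-- Central extensions

module Extension {Γ Γ̃ : Presentation} (E : CentralExt Γ Γ̃)
                 (L : Fin (gens Γ) → Word (gens Γ̃))
                 (πL : ∀ s → Γ ⊢ πWord Γ Γ̃ (CentralExt.π E) (L s) ≈ ((s , false) ∷ [])) where
  open CentralExt E public
  private
    module G = GroupProperties (wordGroup Γ̃)
    module GR = SetoidReasoning (Group.setoid (wordGroup Γ̃))

  π̂ : Word (gens Γ̃) → Word (gens Γ)
  π̂ = πWord Γ Γ̃ π

  L̂ : Word (gens Γ) → Word (gens Γ̃)
  L̂ = πWord Γ̃ Γ L

  zp : Bool → Word (gens Γ̃)
  zp b = if b then z else []

  -- Centrality is given for positive letters only; for an inverse letter it follows by conjugating
  -- with that letter.
  z-commutes : ∀ u → Γ̃ ⊢ u ++ z ≈ (z ++ u)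
  z-commutes [] = ≡⇒≈ (sym (++-identityʳ z))
  z-commutes (l ∷ u) = ≈trans (≈cong {u = l ∷ []} ≈refl (z-commutes u))
    (≈trans (≡⇒≈ (sym (++-assoc (l ∷ []) z u))) (≈trans (≈cong {v = u} (letter l) ≈refl) (≡⇒≈ (++-assoc z _ u))))
    where
    letter : ∀ l → Γ̃ ⊢ (l ∷ []) ++ z ≈ (z ++ (l ∷ []))
    letter (s , false) = central s
    letter (s , true) = begin
      S⁻ ++ z                 ≈⟨ ≡⇒≈ (sym (++-identityʳ _)) ⟩
      (S⁻ ++ z) ++ []         ≈⟨ ≈cong {u = S⁻ ++ z} ≈refl (≈sym (≈free s false)) ⟩
      (S⁻ ++ z) ++ (S ++ S⁻)  ≈⟨ ≡⇒≈ (cong ((s , true) ∷_) (sym (++-assoc z S S⁻))) ⟩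
      S⁻ ++ ((z ++ S) ++ S⁻)  ≈⟨ ≈cong {u = S⁻} ≈refl (≈cong {v = S⁻} (≈sym (central s)) ≈refl) ⟩
      (S⁻ ++ S) ++ (z ++ S⁻)  ≈⟨ ≈cong (≈free s true) ≈refl ⟩
      z ++ S⁻                 ∎
      where
      open GR
      S  = (s , false) ∷ []
      S⁻ = (s , true) ∷ []

  zp-central : ∀ b u → Γ̃ ⊢ u ++ zp b ≈ (zp b ++ u)
  zp-central true  u = z-commutes u
  zp-central false u = ≡⇒≈ (++-identityʳ u)

  zp-xor : ∀ a b → Γ̃ ⊢ zp a ++ zp b ≈ zp (a xor b)
  zp-xor false b     = ≈refl
  zp-xor true  true  = ιhom
  zp-xor true  false = ≡⇒≈ (++-identityʳ z)

  zp-inj : ∀ a b → Γ̃ ⊢ zp a ≈ zp b → a ≡ b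
  zp-inj true  true  q = refl
  zp-inj true  false q = ⊥-elim (ιinj q)
  zp-inj false true  q = ⊥-elim (ιinj (≈sym q))
  zp-inj false false q = refl

  up-to-zp : ∀ {u u' v v' a b} → Γ̃ ⊢ u ≈ (u' ++ zp a) → Γ̃ ⊢ v ≈ (v' ++ zp b) → Γ̃ ⊢ u ++ v ≈ ((u' ++ v') ++ zp (a xor b))
  up-to-zp {u} {u'} {v} {v'} {a} {b} q r = begin
    u ++ v                       ≈⟨ ≈cong q r ⟩
    (u' ++ zp a) ++ (v' ++ zp b) ≈⟨ ≡⇒≈ (++-assoc u' (zp a) _) ⟩
    u' ++ (zp a ++ (v' ++ zp b)) ≈⟨ ≈cong {u = u'} ≈refl (≡⇒≈ (sym (++-assoc (zp a) v' _))) ⟩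
    u' ++ ((zp a ++ v') ++ zp b) ≈⟨ ≈cong {u = u'} ≈refl (≈cong {v = zp b} (≈sym (zp-central a v')) ≈refl) ⟩
    u' ++ ((v' ++ zp a) ++ zp b) ≈⟨ ≈cong {u = u'} ≈refl (≡⇒≈ (++-assoc v' _ _)) ⟩
    u' ++ (v' ++ (zp a ++ zp b)) ≈⟨ ≈cong {u = u'} ≈refl (≈cong {u = v'} ≈refl (zp-xor a b)) ⟩
    u' ++ (v' ++ zp (a xor b))   ≈⟨ ≡⇒≈ (sym (++-assoc u' v' _)) ⟩
    (u' ++ v') ++ zp (a xor b)   ∎
    where open GR

  ker-zp : ∀ w → Trivial Γ (π̂ w) → ∃[ b ] Γ̃ ⊢ w ≈ zp b
  ker-zp w q = [ (λ r → false , r) , (λ r → true , r) ]′ (kerπ w q)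

  πL̂ : ∀ v → Γ ⊢ π̂ (L̂ v) ≈ v
  πL̂ [] = ≈refl
  πL̂ (l ∷ v) = ≈trans (≡⇒≈ (trans (cong π̂ (ext-++ Γ̃ Γ L (l ∷ []) v)) (ext-++ Γ Γ̃ π (L̂ (l ∷ [])) (L̂ v))))
    (≈cong (letter l) (πL̂ v))
    where
    letter : ∀ l → Γ ⊢ π̂ (L̂ (l ∷ [])) ≈ (l ∷ [])
    letter (s , false) = ≈trans (≡⇒≈ (cong π̂ (++-identityʳ (L s)))) (πL s)
    letter (s , true)  = ≈trans (≡⇒≈ (cong π̂ (++-identityʳ (invW (L s)))))
      (≈trans (ext-inv Γ Γ̃ π (L s)) (inv-congW Γ (πL s)))

  L̂-ker : ∀ v → Trivial Γ v → ∃[ b ] Γ̃ ⊢ L̂ v ≈ zp b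
  L̂-ker v q = ker-zp (L̂ v) (≈trans (πL̂ v) q)

  private
    -- The quotient of `w` by the lift of its image lies in the kernel of `π`, hence is a power of
    -- `z`.
    lift-defect : ∀ w → ∃[ b ] Γ̃ ⊢ w ≈ (L̂ (π̂ w) ++ zp b)
    lift-defect w with ker-zp (invW (L̂ (π̂ w)) ++ w)
      (≈trans (≡⇒≈ (ext-++ Γ Γ̃ π (invW (L̂ (π̂ w))) w))
      (≈trans (≈cong {v = π̂ w} (≈trans (ext-inv Γ Γ̃ π (L̂ (π̂ w))) (inv-congW Γ (πL̂ (π̂ w)))) ≈refl) (inv-leftW Γ (π̂ w))))
    ... | b , q = b , (begin
      w                                  ≈⟨ ≈cong {v = w} (≈sym (inv-rightW Γ̃ (L̂ (π̂ w)))) ≈refl ⟩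
      (L̂ (π̂ w) ++ invW (L̂ (π̂ w))) ++ w  ≈⟨ ≡⇒≈ (++-assoc (L̂ (π̂ w)) _ w) ⟩
      L̂ (π̂ w) ++ (invW (L̂ (π̂ w)) ++ w)  ≈⟨ ≈cong {u = L̂ (π̂ w)} ≈refl q ⟩
      L̂ (π̂ w) ++ zp b ∎)
      where open GR

  -- A function of words that need not respect `≈`: relators of `Γ̃` may have the value `true`,
  -- since `L̂` need not respect the relators of `Γ`.
  cw : Word (gens Γ̃) → Bool
  cw w = proj₁ (lift-defect w)

  cw-spec : ∀ w → Γ̃ ⊢ w ≈ (L̂ (π̂ w) ++ zp (cw w))
  cw-spec w = proj₂ (lift-defect w)

  L̂π̂-++ : ∀ u v → L̂ (π̂ (u ++ v)) ≡ L̂ (π̂ u) ++ L̂ (π̂ v)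
  L̂π̂-++ u v = trans (cong L̂ (ext-++ Γ Γ̃ π u v)) (ext-++ Γ̃ Γ L (π̂ u) (π̂ v))

  zp-cancel : ∀ u {a b} → Γ̃ ⊢ u ++ zp a ≈ (u ++ zp b) → a ≡ b
  zp-cancel u {a} {b} q = zp-inj a b (begin
    zp a                     ≈⟨ ≈cong {v = zp a} (≈sym (inv-leftW Γ̃ u)) ≈refl ⟩
    (invW u ++ u) ++ zp a    ≈⟨ ≡⇒≈ (++-assoc (invW u) u _) ⟩
    invW u ++ (u ++ zp a)    ≈⟨ ≈cong {u = invW u} ≈refl q ⟩
    invW u ++ (u ++ zp b)    ≈⟨ ≡⇒≈ (sym (++-assoc (invW u) u _)) ⟩
    (invW u ++ u) ++ zp b    ≈⟨ ≈cong {v = zp b} (inv-leftW Γ̃ u) ≈refl ⟩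
    zp b                     ∎)
    where open GR

  -- `L̂` and `π̂` are multiplicative on words and `z` is central, so the exponents add.
  cw-++ : ∀ u v → cw (u ++ v) ≡ cw u xor cw v
  cw-++ u v = zp-cancel (L̂ (π̂ (u ++ v))) (≈trans (≈sym (cw-spec (u ++ v)))
    (≈trans (up-to-zp {u' = L̂ (π̂ u)} {v' = L̂ (π̂ v)} {a = cw u} {b = cw v} (cw-spec u) (cw-spec v))
            (≡⇒≈ (cong (_++ zp (cw u xor cw v)) (sym (L̂π̂-++ u v))))))

  cw-[] : cw [] ≡ false
  cw-[] = sym (zp-inj false (cw []) (cw-spec []))

-- Twisted products with ℤ/2

module _ {g m : ℕ} (ψ : Perms g m) (α : Fin g → Fin m → Bool) where
  twL : Letter g → Fin m → Bool
  twL (s , false) x = α s x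
  twL (s , true)  x = α s (ψ s ⟨$⟩ˡ x)

  -- The holonomy of `α` along the path from `x` spelled by the word, read from its right end. The
  -- sign `α s x` belongs to the edge from `x` to its image under `s`, and an inverse letter runs
  -- that edge backwards.
  tw : Word g → Fin m → Bool
  tw []      x = false
  tw (l ∷ w) x = twL l (act ψ w x) xor tw w x

  tw-++ : ∀ u v x → tw (u ++ v) x ≡ tw u (act ψ v x) xor tw v x
  tw-++ []      v x = refl
  tw-++ (l ∷ u) v x = trans (cong₂ _xor_ (cong (twL l) (act-++ ψ u v x)) (tw-++ u v x)) (sym (xor-assoc (twL l _) _ _))

  twL-inv : ∀ l x → twL (invL l) x ≡ twL l (applyL ψ (invL l) x)
  twL-inv (s , false) x = refl
  twL-inv (s , true)  x = cong (α s) (sym (inverseˡ (ψ s)))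

  tw-inv : ∀ w x → tw (invW w) x ≡ tw w (act ψ (invW w) x)
  tw-inv []      x = refl
  tw-inv (l ∷ w) x = begin
    tw (invW (l ∷ w)) x                            ≡⟨ cong (λ u → tw u x) (invW-∷ l w) ⟩
    tw (invW w ++ (invL l ∷ [])) x                 ≡⟨ tw-++ (invW w) _ x ⟩
    tw (invW w) y xor (twL (invL l) x xor false)   ≡⟨ cong₂ _xor_ (tw-inv w y) (trans (xor-identityʳ _) (twL-inv l x)) ⟩
    tw w y' xor twL l y                            ≡⟨ xor-comm (tw w y') _ ⟩
    twL l y xor tw w y'                            ≡⟨ cong (λ q → twL l q xor tw w y') (sym (act-invʳ ψ w y)) ⟩
    tw (l ∷ w) y'                                  ≡⟨ cong (tw (l ∷ w)) (sym (act-++ ψ (invW w) (invL l ∷ []) x)) ⟩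
    tw (l ∷ w) (act ψ (invW w ++ (invL l ∷ [])) x) ≡⟨ cong (λ u → tw (l ∷ w) (act ψ u x)) (sym (invW-∷ l w)) ⟩
    tw (l ∷ w) (act ψ (invW (l ∷ w)) x)            ∎
    where
    open ≡-Reasoning
    y  = applyL ψ (invL l) x
    y' = act ψ (invW w) y

tw-xor : ∀ {g m} (ψ : Perms g m) (α β : Fin g → Fin m → Bool) w x →
  tw ψ (λ s y → α s y xor β s y) w x ≡ tw ψ α w x xor tw ψ β w x
tw-xor ψ α β [] x = refl
tw-xor ψ α β (l ∷ w) x = trans (cong₂ _xor_ (letter l _) (tw-xor ψ α β w x)) (xor-interchange (twL ψ α l _) (twL ψ β l _) (tw ψ α w x) (tw ψ β w x))
  where
  letter : ∀ l y → twL ψ (λ s y → α s y xor β s y) l y ≡ twL ψ α l y xor twL ψ β l y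
  letter (s , false) y = refl
  letter (s , true)  y = refl

pt : ∀ {m} → Fin m → Bool → Fin (m + m)
pt {m} x false = x ↑ˡ m
pt {m} x true  = m ↑ʳ x

unpt : ∀ {m} → Fin (m + m) → Fin m × Bool
unpt {m} p with splitAt m p
... | inj₁ x = x , false
... | inj₂ x = x , true

unpt-pt : ∀ {m} (x : Fin m) t → unpt (pt x t) ≡ (x , t)
unpt-pt {m} x false rewrite splitAt-↑ˡ m x m = refl
unpt-pt {m} x true  rewrite splitAt-↑ʳ m m x = refl

pt-unpt : ∀ {m} (p : Fin (m + m)) → pt (proj₁ (unpt {m} p)) (proj₂ (unpt {m} p)) ≡ p
pt-unpt {m} p with splitAt m p in eq
... | inj₁ x = splitAt⁻¹-↑ˡ eq
... | inj₂ x = splitAt⁻¹-↑ʳ eq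

pt-injˡ : ∀ {m} {x y : Fin m} {s t} → pt x s ≡ pt y t → x ≡ y
pt-injˡ {x = x} {y} {s} {t} q = cong proj₁ (trans (sym (unpt-pt x s)) (trans (cong unpt q) (unpt-pt y t)))

pt-injʳ : ∀ {m} {x y : Fin m} {s t} → pt x s ≡ pt y t → s ≡ t
pt-injʳ {x = x} {y} {s} {t} q = cong proj₂ (trans (sym (unpt-pt x s)) (trans (cong unpt q) (unpt-pt y t)))

pt-moved : ∀ {m} (x : Fin m) t → pt x (t xor true) ≢ pt x t
pt-moved x t q = not-fixed t (pt-injʳ {x = x} {x} {t xor true} {t} q)
  where
  not-fixed : ∀ t → t xor true ≢ t
  not-fixed true  ()
  not-fixed false ()

xor-cancelʳ² : ∀ t a → (t xor a) xor a ≡ t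
xor-cancelʳ² t a = trans (xor-assoc t a a) (trans (cong (t xor_) (xor-same a)) (xor-identityʳ t))

module _ {g m : ℕ} (ψ : Perms g m) (α : Fin g → Fin m → Bool) where
  private
    to from : Fin g → Fin (m + m) → Fin (m + m)
    to s p = pt (ψ s ⟨$⟩ʳ proj₁ (unpt p)) (proj₂ (unpt {m} p) xor α s (proj₁ (unpt p)))
    from s p = pt (ψ s ⟨$⟩ˡ proj₁ (unpt p)) (proj₂ (unpt {m} p) xor α s (ψ s ⟨$⟩ˡ proj₁ (unpt p)))

    to-pt : ∀ s x t → to s (pt x t) ≡ pt (ψ s ⟨$⟩ʳ x) (t xor α s x)
    to-pt s x t = cong (λ q → pt (ψ s ⟨$⟩ʳ proj₁ q) (proj₂ q xor α s (proj₁ q))) (unpt-pt x t)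

    from-pt : ∀ s x t → from s (pt x t) ≡ pt (ψ s ⟨$⟩ˡ x) (t xor α s (ψ s ⟨$⟩ˡ x))
    from-pt s x t = cong (λ q → pt (ψ s ⟨$⟩ˡ proj₁ q) (proj₂ q xor α s (ψ s ⟨$⟩ˡ proj₁ q))) (unpt-pt x t)

    to-from : ∀ s p → to s (from s p) ≡ p
    to-from s p = trans (to-pt s y' (t xor α s y'))
      (trans (cong₂ pt (inverseʳ (ψ s)) (xor-cancelʳ² t (α s y'))) (pt-unpt {m} p))
      where
      t = proj₂ (unpt {m} p)
      y' = ψ s ⟨$⟩ˡ proj₁ (unpt {m} p)

    from-to : ∀ s p → from s (to s p) ≡ p
    from-to s p = trans (from-pt s (ψ s ⟨$⟩ʳ y) (t xor α s y))
      (trans (cong₂ (λ x a → pt x ((t xor α s y) xor α s a)) (inverseˡ (ψ s)) (inverseˡ (ψ s)))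
      (trans (cong (pt y) (xor-cancelʳ² t (α s y))) (pt-unpt {m} p)))
      where
      y = proj₁ (unpt {m} p)
      t = proj₂ (unpt {m} p)

  twist : Perms g (m + m)
  twist s = permutation (to s) (from s) (to-from s) (from-to s)

  act-twist : ∀ w x t → act twist w (pt x t) ≡ pt (act ψ w x) (t xor tw ψ α w x)
  act-twist [] x t = cong (pt x) (sym (xor-identityʳ t))
  act-twist ((s , false) ∷ w) x t = trans (cong (to s) (act-twist w x t)) (trans (to-pt s y u)
    (cong (pt (ψ s ⟨$⟩ʳ y)) (trans (xor-assoc t (tw ψ α w x) a) (cong (t xor_) (xor-comm (tw ψ α w x) a)))))
    where
    y = act ψ w x
    u = t xor tw ψ α w x
    a = α s y
  act-twist ((s , true) ∷ w) x t = trans (cong (from s) (act-twist w x t)) (trans (from-pt s y u)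
    (cong (pt (ψ s ⟨$⟩ˡ y)) (trans (xor-assoc t (tw ψ α w x) a) (cong (t xor_) (xor-comm (tw ψ α w x) a)))))
    where
    y = act ψ w x
    u = t xor tw ψ α w x
    a = α s (ψ s ⟨$⟩ˡ y)


  act-twist-fixed : ∀ {w} → (∀ x → act ψ w x ≡ x) → (∀ x → tw ψ α w x ≡ false) → ∀ p → act twist w p ≡ p
  act-twist-fixed {w} h k p = begin
    act twist w p                              ≡⟨ cong (act twist w) (sym (pt-unpt {m} p)) ⟩
    act twist w (pt x t)                       ≡⟨ act-twist w x t ⟩
    pt (act ψ w x) (t xor tw ψ α w x)          ≡⟨ cong₂ pt (h x) (trans (cong (t xor_) (k x)) (xor-identityʳ t)) ⟩
    pt x t                                     ≡⟨ pt-unpt {m} p ⟩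
    p                                          ∎
    where
    open ≡-Reasoning
    x = proj₁ (unpt {m} p)
    t = proj₂ (unpt {m} p)

Exc-double : ∀ {m c} {P : Fin m → Set} → Exc c P → Exc (c + c) (λ p → P (proj₁ (unpt {m} p)))
Exc-double {m} (exc b f g) = exc (λ p → b (proj₁ (unpt {m} p)))
  (≤-trans (≤-reflexive (trans (count-+ m m _) (cong₂ _+_ (count-cong (λ i → cong (b ∘ proj₁) (unpt-pt i false)))
                                                         (count-cong (λ i → cong (b ∘ proj₁) (unpt-pt i true))))))
           (+-mono-≤ f f))
  (λ p q → g _ q)

-- Accumulated error along a word.

module _ {g N M : ℕ} (φ : Perms g N) (ψ : Perms g M) (j : Fin N → Fin M) {K B : ℕ}
         (close : ∀ s → ∃[ d ] (K * d ≤ B × Exc d (λ x → j (φ s ⟨$⟩ʳ x) ≡ ψ s ⟨$⟩ʳ j x))) where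
  private
    letter : ∀ l → ∃[ d ] (K * d ≤ B × Exc d (λ x → j (applyL φ l x) ≡ applyL ψ l (j x)))
    letter (s , false) = close s
    letter (s , true)  = let d , k , ex = close s in d , k ,
      Exc-map (λ x q → trans (sym (inverseˡ (ψ s))) (cong (ψ s ⟨$⟩ˡ_) (trans (sym q) (cong j (inverseʳ (φ s))))))
        (Exc-pull (φ s ⟨$⟩ˡ_) (λ {x} {y} → act-inj φ ((s , true) ∷ [])) ex)

  abstract
    -- A union bound over the letters: the exceptions of each letter are pulled back along the
    -- bijection given by the letters applied before it.
    act-close : ∀ w → ∃[ d ] (K * d ≤ length w * B × Exc d (λ x → j (act φ w x) ≡ act ψ w (j x)))
    act-close []      = 0 , ≤-reflexive (*-zeroʳ K) , Exc-all (λ _ → refl)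
    act-close (l ∷ w) = let d , k , ex = letter l ; d' , k' , ex' = act-close w in
      d + d' , ≤-trans (≤-reflexive (*-distribˡ-+ K d d')) (+-mono-≤ k k') ,
      Exc-map (λ x (a , b) → trans a (cong (applyL ψ l) b)) (Exc-× (Exc-pull (act φ w) (act-inj φ w) ex) ex')

-- Completing partial permutations and enumerating subsets.

perm-inj : ∀ {N} (σ : Permutation′ N) {x y} → σ ⟨$⟩ʳ x ≡ σ ⟨$⟩ʳ y → x ≡ y
perm-inj σ q = trans (sym (inverseˡ σ)) (trans (cong (σ ⟨$⟩ˡ_) q) (inverseˡ σ))

transpose-at : ∀ {N} (i j : Fin N) → PC.transpose i j i ≡ j
transpose-at i j with i ≟F i
... | yes _ = refl
... | no ¬p = ⊥-elim (¬p refl)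

transpose-away : ∀ {N} (i j k : Fin N) → k ≢ i → k ≢ j → PC.transpose i j k ≡ k
transpose-away i j k k≢i k≢j with k ≟F i
... | yes p = ⊥-elim (k≢i p)
... | no _ with k ≟F j
...   | yes p = ⊥-elim (k≢j p)
...   | no _ = refl

-- Points are treated one after the other; a transposition corrects the current value and
-- does not affect the values already prescribed, since those are different.
complete : ∀ {N} (f : Fin N → Fin N) (ok : Fin N → Bool) →
  (∀ x y → ok x ≡ true → ok y ≡ true → f x ≡ f y → x ≡ y) →
  Σ (Permutation′ N) λ σ → ∀ x → ok x ≡ true → σ ⟨$⟩ʳ x ≡ f x
complete {N} f ok inj = proj₁ (go (allFin N)) , λ x → proj₂ (go (allFin N)) x (∈-allFin x)
  where
  go : ∀ xs → Σ (Permutation′ N) λ σ → ∀ x → x ∈ xs → ok x ≡ true → σ ⟨$⟩ʳ x ≡ f x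
  go [] = Perm.id , λ x ()
  go (a ∷ xs) with go xs | ok a in oka
  ... | σ , h | false = σ , λ { x (here refl) q → case trans (sym oka) q of λ () ; x (there x∈) q → h x x∈ q }
  ... | σ , h | true = σ ∘ₚ transpose (σ ⟨$⟩ʳ a) (f a) , new
    where
    at-a : PC.transpose (σ ⟨$⟩ʳ a) (f a) (σ ⟨$⟩ʳ a) ≡ f a
    at-a = transpose-at (σ ⟨$⟩ʳ a) (f a)
    new : ∀ x → x ∈ (a ∷ xs) → ok x ≡ true → PC.transpose (σ ⟨$⟩ʳ a) (f a) (σ ⟨$⟩ʳ x) ≡ f x
    new x x∈ okx with x ≟F a
    ... | yes refl = at-a
    new x (here q) okx | no x≢a = ⊥-elim (x≢a q)
    new x (there x∈) okx | no x≢a =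
      trans (transpose-away (σ ⟨$⟩ʳ a) (f a) (σ ⟨$⟩ʳ x) (λ q → x≢a (perm-inj σ q))
               (λ q → x≢a (inj x a okx oka (trans (sym (h x x∈ okx)) q)))) (h x x∈ okx)

record Enumeration {M : ℕ} (f : Fin M → Bool) (m : ℕ) : Set where
  field
    r      : Fin m → Fin M
    r-inj  : ∀ {i j} → r i ≡ r j → i ≡ j
    r-true : ∀ i → f (r i) ≡ true
    r-onto : ∀ x → f x ≡ true → ∃[ i ] r i ≡ x
    r-count : ∀ b → count m (b ∘ r) ≡ count M (λ x → f x ∧ b x)

enumerate : ∀ {M} (f : Fin M → Bool) → Enumeration f (count M f)
enumerate {zero} f = record { r = λ () ; r-inj = λ {} ; r-true = λ () ; r-onto = λ () ; r-count = λ _ → refl }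
enumerate {suc M} f with f zero in eq | enumerate (f ∘ suc)
... | false | E = record
  { r = suc ∘ E.r ; r-inj = λ q → E.r-inj (sucF-injective q) ; r-true = E.r-true
  ; r-onto = λ { zero q → case trans (sym eq) q of λ () ; (suc x) q → let i , p = E.r-onto x q in i , cong suc p }
  ; r-count = λ b → trans (E.r-count (b ∘ suc)) (cong (λ t → (if t ∧ b zero then 1 else 0) + count M (λ i → f (suc i) ∧ b (suc i))) (sym eq)) }
  where
  module E = Enumeration E
... | true | E = record
  { r = r' ; r-inj = r'-inj
  ; r-true = λ { zero → eq ; (suc i) → E.r-true i }
  ; r-onto = λ { zero q → zero , refl ; (suc x) q → let i , p = E.r-onto x q in suc i , cong suc p }
  ; r-count = λ b → trans (cong ((if b zero then 1 else 0) +_) (E.r-count (b ∘ suc))) (cong (λ t → (if t ∧ b zero then 1 else 0) + count M (λ i → f (suc i) ∧ b (suc i))) (sym eq)) }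
  where
  module E = Enumeration E
  r' : Fin (suc (count M (f ∘ suc))) → Fin (suc M)
  r' zero    = zero
  r' (suc i) = suc (E.r i)
  r'-inj : ∀ {i j} → r' i ≡ r' j → i ≡ j
  r'-inj {zero}  {zero}  q = refl
  r'-inj {suc i} {suc j} q = cong suc (E.r-inj (sucF-injective q))

-- Orbits

module Orbits {g M : ℕ} (ψ : Perms g M) where
  Closed : (Fin M → Bool) → Set
  Closed S = ∀ l y → S y ≡ true → S (applyL ψ l y) ≡ true

  closed-act : ∀ {S} → Closed S → ∀ w y → S y ≡ true → S (act ψ w y) ≡ true
  closed-act c []      y q = q
  closed-act c (l ∷ w) y q = c l _ (closed-act c w y q)

  private
    Step : (Fin M → Bool) → Fin M → Fin g → Bool
    Step S y s = S y ∧ (not (S (ψ s ⟨$⟩ʳ y)) ∨ not (S (ψ s ⟨$⟩ˡ y)))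

    step? : ∀ S → Dec (∃[ y ] ∃[ s ] Step S y s ≡ true)
    step? S = any? λ y → any? λ s → Step S y s ≟B true

    step-letter : ∀ S y s → Step S y s ≡ true → S y ≡ true × ∃[ l ] S (applyL ψ l y) ≡ false
    step-letter S y s q with ∧-true {S y} q
    ... | Sy , q' with S (ψ s ⟨$⟩ʳ y) in eq₁ | S (ψ s ⟨$⟩ˡ y) in eq₂
    ... | false | _ = Sy , (s , false) , eq₁
    ... | true | false = Sy , (s , true) , eq₂

    no-step : ∀ S → ¬ (∃[ y ] ∃[ s ] Step S y s ≡ true) → Closed S
    no-step S h (s , b) y q with S (ψ s ⟨$⟩ʳ y) in eq₁ | S (ψ s ⟨$⟩ˡ y) in eq₂
    no-step S h (s , false) y q | true  | _     = eq₁
    no-step S h (s , true)  y q | _     | true  = eq₂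
    no-step S h (s , b)     y q | false | _     = ⊥-elim (h (y , s , st))
      where
      st : Step S y s ≡ true
      st rewrite q | eq₁ = refl
    no-step S h (s , b)     y q | true  | false = ⊥-elim (h (y , s , st))
      where
      st : Step S y s ≡ true
      st rewrite q | eq₁ | eq₂ = refl

    -- `k` bounds the number of points outside `S`; every step adds one of them, reached from `S` by
    -- a single letter.
    grow : ∀ x k S → count M (not ∘ S) ≤ k → S x ≡ true → (∀ y → S y ≡ true → ∃[ w ] act ψ w x ≡ y) →
      Σ (Fin M → Bool) λ O → O x ≡ true × Closed O × (∀ y → O y ≡ true → ∃[ w ] act ψ w x ≡ y)
    grow x k S le Sx reach with step? S
    ... | no h = S , Sx , no-step S h , reach
    ... | yes (y , s , q) with step-letter S y s q
    ...   | Sy , l , Sa with k | ≤-trans (≤-reflexive (sym (count-point (not ∘ S) (applyL ψ l y) (cong not Sa)))) le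
    ...     | suc k' | s≤s le' = grow x k' S' (≤-trans (count-mono sub) le') (cong (_∨ (x == a)) Sx) reach'
      where
      a = applyL ψ l y
      S' : Fin M → Bool
      S' i = S i ∨ (i == a)
      sub : ∀ i → not (S' i) ≡ true → not (S i) ∧ not (i == a) ≡ true
      sub i h with S i | i == a
      ... | false | false = refl
      reach' : ∀ i → S' i ≡ true → ∃[ w ] act ψ w x ≡ i
      reach' i h with S i in Si | i == a in ia
      ... | true  | _    = reach i Si
      ... | false | true = let w , p = reach y Sy in l ∷ w , trans (cong (applyL ψ l) p) (sym (==⇒≡ ia))

  orbit : ∀ x → Σ (Fin M → Bool) λ O → O x ≡ true × Closed O × (∀ y → O y ≡ true → ∃[ w ] act ψ w x ≡ y)
  orbit x = grow x _ (_== x) ≤-refl (==-refl x) (λ y q → [] , sym (==⇒≡ q))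

  module _ (b : Fin M → Bool) (K : ℕ) where
    GoodOrbit : Set
    GoodOrbit = Σ (Fin M → Bool) λ O → Closed O × (∀ y y' → O y ≡ true → O y' ≡ true → ∃[ w ] act ψ w y ≡ y') ×
                  K * count M (λ i → O i ∧ b i) < count M O

    private
      -- An averaging argument. If the orbit of the chosen point violates the inequality, then, both
      -- counts being additive over the orbit and its complement in `S`, the complement inherits the
      -- strict inequality and the search continues there.
      search : ∀ k S → count M S ≤ k → Closed S → K * count M (λ i → S i ∧ b i) < count M S → GoodOrbit
      search k S le cl lt with count-witness S (≤-trans (s≤s z≤n) lt)
      ... | x , Sx with orbit x
      ...   | O , Ox , clO , reach with K * count M (λ i → O i ∧ b i) <? count M O
      ...     | yes good = O , clO , trans-O , good
        where
        trans-O : ∀ y y' → O y ≡ true → O y' ≡ true → ∃[ w ] act ψ w y ≡ y'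
        trans-O y y' Oy Oy' with reach y Oy | reach y' Oy'
        ... | w , p | w' , p' = w' ++ invW w ,
          trans (act-++ ψ w' (invW w) y) (trans (cong (act ψ w') (trans (cong (act ψ (invW w)) (sym p)) (act-invˡ ψ w x))) p')
      ...     | no bad with k | ≤-trans (≤-reflexive (sym (count-point S x Sx))) le
      ...       | suc k' | s≤s le' = search k' S' (≤-trans (count-mono smaller) le') clS' lt'
        where
        S' : Fin M → Bool
        S' i = S i ∧ not (O i)
        O⊆S : ∀ i → O i ≡ true → S i ≡ true
        O⊆S i Oi with reach i Oi
        ... | w , p = subst (λ y → S y ≡ true) p (closed-act cl w x Sx)
        smaller : ∀ i → S' i ≡ true → S i ∧ not (i == x) ≡ true
        smaller i q with ∧-true {S i} q
        ... | Si , nOi rewrite Si = cong not (≢⇒== λ { refl → case trans (sym (not≡true nOi)) Ox of λ () })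
        clS' : Closed S'
        clS' l y q with ∧-true {S y} q
        ... | Sy , nOy with O (applyL ψ l y) in eq
        ...   | false rewrite cl l y Sy = refl
        ...   | true = case trans (sym (not≡true nOy)) (subst (λ t → O t ≡ true) (applyL-invˡ ψ l y) (clO (invL l) _ eq)) of λ ()
        c1 : count M S ≡ count M O + count M S'
        c1 = trans (count-split S O) (cong (_+ count M S') (count-cong same))
          where
          same : ∀ i → S i ∧ O i ≡ O i
          same i with O i in eq
          ... | true rewrite O⊆S i eq = refl
          ... | false with S i
          ...   | true  = refl
          ...   | false = refl
        c2 : count M (λ i → S i ∧ b i) ≡ count M (λ i → O i ∧ b i) + count M (λ i → S' i ∧ b i)
        c2 = trans (count-split (λ i → S i ∧ b i) O) (cong₂ _+_ (count-cong same) (count-cong same'))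
          where
          same : ∀ i → (S i ∧ b i) ∧ O i ≡ O i ∧ b i
          same i with O i in eq
          ... | true rewrite O⊆S i eq with b i
          ...   | true  = refl
          ...   | false = refl
          same i | false with S i ∧ b i
          ...   | true  = refl
          ...   | false = refl
          same' : ∀ i → (S i ∧ b i) ∧ not (O i) ≡ (S i ∧ not (O i)) ∧ b i
          same' i with S i | b i | O i
          ... | true  | true  | true  = refl
          ... | true  | true  | false = refl
          ... | true  | false | true  = refl
          ... | true  | false | false = refl
          ... | false | _     | _     = refl
        lt' : K * count M (λ i → S' i ∧ b i) < count M S'
        lt' = ≰⇒> λ h → <⇒≱ lt (≤-trans (≤-reflexive c1) (≤-trans (+-mono-≤ (≮⇒≥ bad) h)
               (≤-reflexive (trans (sym (*-distribˡ-+ K _ _)) (cong (K *_) (sym c2))))))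

    good-orbit : K * count M b < M → GoodOrbit
    good-orbit lt = search M (λ _ → true) (≤-reflexive all) (λ _ _ _ → refl) (≤-trans lt (≤-reflexive (sym all)))
      where
      all : count M (λ _ → true) ≡ M
      all = count-all {M} (λ _ → refl)

record Restriction {g M : ℕ} (ψ : Perms g M) (b : Fin M → Bool) (K : ℕ) : Set where
  field
    m     : ℕ
    ψO    : Perms g m
    r     : Fin m → Fin M
    r-inj : ∀ {i j} → r i ≡ r j → i ≡ j
    r-act : ∀ w i → r (act ψO w i) ≡ act ψ w (r i)
    trans-ψ : ∀ i j → ∃[ w ] act ψO w i ≡ j
    few-bad : K * count m (b ∘ r) < m

abstract
  restrict : ∀ {g M} (ψ : Perms g M) (b : Fin M → Bool) (K : ℕ) → K * count M b < M → Restriction ψ b K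
  restrict {g} {M} ψ b K lt with Orbits.good-orbit ψ b K lt
  ... | O , cl , tr , few' = record
    { m = count M O ; ψO = ψO ; r = E.r ; r-inj = E.r-inj ; r-act = r-act
    ; trans-ψ = λ i j → let w , p = tr (E.r i) (E.r j) (E.r-true i) (E.r-true j) in w , E.r-inj (trans (r-act w i) p)
    ; few-bad = ≤-trans (s≤s (≤-reflexive (cong (K *_) (E.r-count b)))) few' }
    where
    module E = Enumeration (enumerate O)
    move : Letter g → Fin (count M O) → Fin (count M O)
    move l i = proj₁ (E.r-onto (applyL ψ l (E.r i)) (cl l _ (E.r-true i)))
    r-move : ∀ l i → E.r (move l i) ≡ applyL ψ l (E.r i)
    r-move l i = proj₂ (E.r-onto (applyL ψ l (E.r i)) (cl l _ (E.r-true i)))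
    ψO : Perms g (count M O)
    ψO s = permutation (move (s , false)) (move (s , true))
      (λ y → E.r-inj (trans (r-move _ _) (trans (cong (ψ s ⟨$⟩ʳ_) (r-move _ _)) (inverseʳ (ψ s)))))
      (λ y → E.r-inj (trans (r-move _ _) (trans (cong (ψ s ⟨$⟩ˡ_) (r-move _ _)) (inverseˡ (ψ s)))))
    r-act : ∀ w i → E.r (act ψO w i) ≡ act ψ w (E.r i)
    r-act [] i = refl
    r-act ((s , false) ∷ w) i = trans (r-move _ _) (cong (ψ s ⟨$⟩ʳ_) (r-act w i))
    r-act ((s , true)  ∷ w) i = trans (r-move _ _) (cong (ψ s ⟨$⟩ˡ_) (r-act w i))

-- Boolean quantifiers and subsets.

T⇒≡ : ∀ {b} → T b → b ≡ true
T⇒≡ {true} _ = refl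

≡⇒T : ∀ {b} → b ≡ true → T b
≡⇒T refl = _

anyL-elim : ∀ {A : Set} (p : A → Bool) xs → anyL p xs ≡ true → ∃[ a ] (a ∈ xs × p a ≡ true)
anyL-elim p (x ∷ xs) q with p x in eq
... | true  = x , here refl , eq
... | false = let a , a∈ , pa = anyL-elim p xs q in a , there a∈ , pa

anyL-intro : ∀ {A : Set} (p : A → Bool) {xs a} → a ∈ xs → p a ≡ true → anyL p xs ≡ true
anyL-intro p (here refl) q rewrite q = refl
anyL-intro p {x ∷ xs} (there a∈) q rewrite anyL-intro p a∈ q = ∨-zeroʳ (p x)

anyL-cong : ∀ {A : Set} {p q : A → Bool} → (∀ a → p a ≡ q a) → ∀ xs → anyL p xs ≡ anyL q xs
anyL-cong h [] = refl
anyL-cong h (x ∷ xs) = cong₂ _∨_ (h x) (anyL-cong h xs)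

anyFin-elim : ∀ {m} {f : Fin m → Bool} → anyFin m f ≡ true → ∃[ i ] f i ≡ true
anyFin-elim {m} {f} q = let i , _ , fi = anyL-elim f (allFin m) q in i , fi

anyFin-intro : ∀ {m} {f : Fin m → Bool} i → f i ≡ true → anyFin m f ≡ true
anyFin-intro {f = f} i q = anyL-intro f (∈-allFin i) q

allFinB-elim : ∀ {m} {f : Fin m → Bool} → allFinB m f ≡ true → ∀ i → f i ≡ true
allFinB-elim {m} {f} q i = go (allFin m) q (∈-allFin i)
  where
  go : ∀ xs → foldr (λ i b → f i ∧ b) true xs ≡ true → i ∈ xs → f i ≡ true
  go (x ∷ xs) q (here refl) = proj₁ (∧-true q)
  go (x ∷ xs) q (there i∈)  = go xs (proj₂ (∧-true {f x} q)) i∈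

allFinB-intro : ∀ {m} {f : Fin m → Bool} → (∀ i → f i ≡ true) → allFinB m f ≡ true
allFinB-intro {m} {f} h = go (allFin m)
  where
  go : ∀ xs → foldr (λ i b → f i ∧ b) true xs ≡ true
  go [] = refl
  go (x ∷ xs) rewrite h x = go xs

subB-elim : ∀ {m} (σ τ : Subset m) → subB σ τ ≡ true → ∀ i → lookup σ i ≡ true → lookup τ i ≡ true
subB-elim σ τ q i h with lookup σ i | allFinB-elim q i | h
... | true | k | _ = k

subB-intro : ∀ {m} (σ τ : Subset m) → (∀ i → lookup σ i ≡ true → lookup τ i ≡ true) → subB σ τ ≡ true
subB-intro σ τ h = allFinB-intro λ i → imp (lookup σ i) (h i)
  where
  imp : ∀ a {b} → (a ≡ true → b ≡ true) → not a ∨ b ≡ true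
  imp true  h = h refl
  imp false h = refl

∨-elim : ∀ {a b} → a ∨ b ≡ true → a ≡ true ⊎ b ≡ true
∨-elim {true}  q = inj₁ refl
∨-elim {false} q = inj₂ q

<-flip : ∀ {m} {u v : Fin m} → u ≢ v → ⌊ v <F? u ⌋ ≡ not ⌊ u <F? v ⌋
<-flip {u = u} {v} u≢v with u <F? v | v <F? u | <F-cmp u v
... | yes _ | no _ | _ = refl
... | no _  | yes _ | _ = refl
... | yes p | yes q | _ = ⊥-elim (<-asym p q)
... | no p  | no q | tri< a _ _ = ⊥-elim (p a)
... | no p  | no q | tri≈ _ a _ = ⊥-elim (u≢v a)
... | no p  | no q | tri> _ _ a = ⊥-elim (q a)

-- The edge-path presentation

data Kind : Set where
  null pos neg : Kind

flipK : Kind → Kind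
flipK null = null
flipK pos  = neg
flipK neg  = pos

module EdgePath (X : Complex) (Tr : SpanningTree X) where
  V : Set
  V = Fin (n X)

  Γ : Presentation
  Γ = π₁Pres X Tr

  e : V → V → Letter (gens Γ)
  e u v = combine u v , false

  ⟪_,_,_⟫ : V → V → V → Subset (n X)
  ⟪ u , v , w ⟫ = tabulate (λ i → (i == u) ∨ (i == v) ∨ (i == w))

  -- Vertices may coincide, since the triangle relators of `π₁Pres` run over all triples, degenerate
  -- ones included.
  Face : V → V → V → Set
  Face u v w = ∃[ F ] (F ∈ facets X × lookup F u ≡ true × lookup F v ≡ true × lookup F w ≡ true)

  inY⇒Face : ∀ {u v w} → inY X ⟪ u , v , w ⟫ ≡ true → Face u v w
  inY⇒Face {u} {v} {w} q = let F , F∈ , s = anyL-elim (subB ⟪ u , v , w ⟫) (facets X) q in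
    F , F∈ , subB-elim ⟪ u , v , w ⟫ F s u (trans (lookup∘tabulate _ u) (cong (_∨ ((u == v) ∨ (u == w))) (==-refl u)))
           , subB-elim ⟪ u , v , w ⟫ F s v (trans (lookup∘tabulate _ v) (trans (cong (λ b → (v == u) ∨ b ∨ (v == w)) (==-refl v)) (∨-zeroʳ _)))
           , subB-elim ⟪ u , v , w ⟫ F s w (trans (lookup∘tabulate _ w)
               (trans (cong (λ b → (w == u) ∨ (w == v) ∨ b) (==-refl w)) (trans (cong ((w == u) ∨_) (∨-zeroʳ _)) (∨-zeroʳ _))))

  Face⇒inY : ∀ {u v w} → Face u v w → inY X ⟪ u , v , w ⟫ ≡ true
  Face⇒inY {u} {v} {w} (F , F∈ , hu , hv , hw) = anyL-intro (subB ⟪ u , v , w ⟫) F∈ (subB-intro ⟪ u , v , w ⟫ F λ i q →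
    [ (λ p → subst (λ i → lookup F i ≡ true) (sym (==⇒≡ p)) hu) ,
      (λ p → [ (λ p → subst (λ i → lookup F i ≡ true) (sym (==⇒≡ p)) hv) ,
               (λ p → subst (λ i → lookup F i ≡ true) (sym (==⇒≡ p)) hw) ]′ (∨-elim p)) ]′
    (∨-elim (trans (sym (lookup∘tabulate _ i)) q)))

  edge-facet : ∀ {u v} → isEdge X u v ≡ true → ∃[ F ] (F ∈ facets X × lookup F u ≡ true × lookup F v ≡ true)
  edge-facet {u} {v} q = let F , F∈ , s = anyL-elim (subB (pair u v)) (facets X) (proj₂ (∧-true {not (u == v)} q)) in
    F , F∈ , subB-elim (pair u v) F s u (trans (lookup∘tabulate _ u) (cong (_∨ (u == v)) (==-refl u)))
           , subB-elim (pair u v) F s v (trans (lookup∘tabulate _ v) (trans (cong ((v == u) ∨_) (==-refl v)) (∨-zeroʳ _)))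

  facet-edge : ∀ {F u v} → F ∈ facets X → lookup F u ≡ true → lookup F v ≡ true → u ≢ v → isEdge X u v ≡ true
  facet-edge {F} {u} {v} F∈ hu hv u≢v rewrite ≢⇒== u≢v = anyL-intro (subB (pair u v)) F∈ (subB-intro (pair u v) F λ i q →
    [ (λ p → subst (λ i → lookup F i ≡ true) (sym (==⇒≡ p)) hu) ,
      (λ p → subst (λ i → lookup F i ≡ true) (sym (==⇒≡ p)) hv) ]′ (∨-elim (trans (sym (lookup∘tabulate _ i)) q)))

  isEdge-sym : ∀ u v → isEdge X u v ≡ isEdge X v u
  isEdge-sym u v = cong₂ _∧_ (cong not (==-sym u v)) (cong (inY X) (tabulate-cong λ i → ∨-comm (i == u) (i == v)))
    where
    ==-sym : ∀ {m} (i j : Fin m) → (i == j) ≡ (j == i)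
    ==-sym i j with i ≟F j
    ... | yes refl = sym (==-refl i)
    ... | no ¬p = sym (≢⇒== (¬p ∘ sym))

  isEdge-irrefl : ∀ u → isEdge X u u ≡ false
  isEdge-irrefl u rewrite ==-refl u = refl

  data RelView : Word (gens Γ) → Set where
    nonedge  : ∀ u v → isEdge X u v ≡ false → RelView (e u v ∷ [])
    invert   : ∀ u v → RelView (e u v ∷ e v u ∷ [])
    tree     : ∀ {u v} → (u , v) ∈ edges Tr → RelView (e u v ∷ [])
    triangle : ∀ {u v w} → Face u v w → RelView (e u v ∷ e v w ∷ e w u ∷ [])

  private
    vs = allFin (n X)
    R₁ R₂ R₃ : List (Word (gens Γ))
    R₁ = concatMap (λ u → concatMap (λ v → if isEdge X u v then [] else ((e u v ∷ []) ∷ [])) vs) vs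
    R₂ = concatMap (λ u → map (λ v → e u v ∷ e v u ∷ []) vs) vs
    R₃ = map (λ uv → e (proj₁ uv) (proj₂ uv) ∷ []) (edges Tr)

  rel-view : ∀ {r} → r ∈ rels Γ → RelView r
  rel-view r∈ with ∈-++⁻ R₁ r∈
  ... | inj₁ q with find (∈-concatMap⁻ _ {xs = vs} q)
  ...   | u , _ , q' with find (∈-concatMap⁻ _ {xs = vs} q')
  ...     | v , _ , q'' with isEdge X u v in eq | q''
  ...       | false | here refl = nonedge u v eq
  rel-view r∈ | inj₂ p with ∈-++⁻ R₂ p
  ... | inj₁ q with find (∈-concatMap⁻ _ {xs = vs} q)
  ...   | u , _ , q' with ∈-map⁻ _ q'
  ...     | v , _ , refl = invert u v
  rel-view r∈ | inj₂ p | inj₂ p' with ∈-++⁻ R₃ p'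
  ... | inj₁ q with ∈-map⁻ _ q
  ...   | (u , v) , q' , refl = tree q'
  rel-view r∈ | inj₂ p | inj₂ p' | inj₂ q with find (∈-concatMap⁻ _ {xs = vs} q)
  ... | u , _ , q₁ with find (∈-concatMap⁻ _ {xs = vs} q₁)
  ...   | v , _ , q₂ with find (∈-concatMap⁻ _ {xs = vs} q₂)
  ...     | w , _ , q₃ with inY X ⟪ u , v , w ⟫ in eq | q₃
  ...       | true | here refl = triangle (inY⇒Face eq)

  private
    concat-intro : ∀ {A B : Set} (f : A → List B) {xs y a} → a ∈ xs → y ∈ f a → y ∈ concatMap f xs
    concat-intro f {y = y} a∈ q = ∈-concatMap⁺ f (lose {P = λ a → y ∈ f a} a∈ q)

  view-rel : ∀ {r} → RelView r → r ∈ rels Γ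
  view-rel (nonedge u v q) = ∈-++⁺ˡ (concat-intro _ (∈-allFin u) (concat-intro _ (∈-allFin v) here!))
    where
    here! : _∈_ {A = Word (gens Γ)} (e u v ∷ []) (if isEdge X u v then [] else ((e u v ∷ []) ∷ []))
    here! rewrite q = here refl
  view-rel (invert u v) = ∈-++⁺ʳ R₁ (∈-++⁺ˡ (concat-intro _ (∈-allFin u) (∈-map⁺ _ (∈-allFin v))))
  view-rel (tree q) = ∈-++⁺ʳ R₁ (∈-++⁺ʳ R₂ (∈-++⁺ˡ (∈-map⁺ (λ uv → e (proj₁ uv) (proj₂ uv) ∷ []) q)))
  view-rel (triangle {u} {v} {w} q) = ∈-++⁺ʳ R₁ (∈-++⁺ʳ R₂ (∈-++⁺ʳ R₃
    (concat-intro _ (∈-allFin u) (concat-intro _ (∈-allFin v) (concat-intro _ (∈-allFin w) here!)))))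
    where
    here! : _∈_ {A = Word (gens Γ)} (e u v ∷ e v w ∷ e w u ∷ []) (if inY X ⟪ u , v , w ⟫ then ((e u v ∷ e v w ∷ e w u ∷ []) ∷ []) else [])
    here! rewrite Face⇒inY q = here refl

  inTree : V → V → Bool
  inTree a b = anyL (λ e → ((proj₁ e == a) ∧ (proj₂ e == b)) ∨ ((proj₁ e == b) ∧ (proj₂ e == a))) (edges Tr)

  inTree-elim : ∀ {u v} → inTree u v ≡ true → (u , v) ∈ edges Tr ⊎ (v , u) ∈ edges Tr
  inTree-elim {u} {v} q with anyL-elim _ (edges Tr) q
  ... | (a , b) , m , k with ∨-elim k
  ...   | inj₁ h = let p , p' = ∧-true h in inj₁ (subst₂ (λ a b → (a , b) ∈ edges Tr) (==⇒≡ p) (==⇒≡ p') m)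
  ...   | inj₂ h = let p , p' = ∧-true h in inj₂ (subst₂ (λ a b → (a , b) ∈ edges Tr) (==⇒≡ p) (==⇒≡ p') m)

  inTree-intro : ∀ {u v} → (u , v) ∈ edges Tr → inTree u v ≡ true
  inTree-intro {u} {v} m = anyL-intro _ m (cong (_∨ ((u == v) ∧ (v == u))) (trans (cong (_∧ (v == v)) (==-refl u)) (==-refl v)))

  inTree-sym : ∀ u v → inTree u v ≡ inTree v u
  inTree-sym u v = anyL-cong (λ e → ∨-comm ((proj₁ e == u) ∧ (proj₂ e == v)) _) (edges Tr)

  private
    kindOf : Bool → Bool → Kind
    kindOf true  true  = pos
    kindOf true  false = neg
    kindOf false _     = null

    flip-kindOf : ∀ a b → kindOf a (not b) ≡ flipK (kindOf a b)
    flip-kindOf true  true  = refl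
    flip-kindOf true  false = refl
    flip-kindOf false _     = refl

  -- Non-edges and tree edges carry the trivial generator; every other edge is oriented increasingly.
  kind : V → V → Kind
  kind u v = kindOf (isEdge X u v ∧ not (inTree u v)) ⌊ u <F? v ⌋

  nonedge-null : ∀ {u v} → isEdge X u v ≡ false → kind u v ≡ null
  nonedge-null {u} {v} q = cong (λ b → kindOf (b ∧ not (inTree u v)) ⌊ u <F? v ⌋) q

  tree-null : ∀ {u v} → inTree u v ≡ true → kind u v ≡ null
  tree-null {u} {v} q = trans (cong (λ b → kindOf (isEdge X u v ∧ not b) ⌊ u <F? v ⌋) q) (no-kind (isEdge X u v))
    where
    no-kind : ∀ b → kindOf (b ∧ false) ⌊ u <F? v ⌋ ≡ null
    no-kind true  = refl
    no-kind false = refl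

  kind-flip : ∀ u v → kind v u ≡ flipK (kind u v)
  kind-flip u v = by-cases (u ≟F v)
    where
    by-cases : Dec (u ≡ v) → kind v u ≡ flipK (kind u v)
    by-cases (yes refl) = trans (nonedge-null (isEdge-irrefl u)) (cong flipK (sym (nonedge-null (isEdge-irrefl u))))
    by-cases (no u≢v) = trans (cong₂ (λ a b → kindOf (a ∧ not b) ⌊ v <F? u ⌋) (isEdge-sym v u) (inTree-sym v u))
      (trans (cong (kindOf (isEdge X u v ∧ not (inTree u v))) (<-flip u≢v)) (flip-kindOf _ _))

  kind-null : ∀ {u v} → kind u v ≡ null → isEdge X u v ≡ false ⊎ inTree u v ≡ true
  kind-null {u} {v} q with isEdge X u v | inTree u v | ⌊ u <F? v ⌋
  ... | false | _    | _ = inj₁ refl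
  ... | true  | true | _ = inj₂ refl
  kind-null () | true | false | true
  kind-null () | true | false | false

  refl-null : ∀ u → kind u u ≡ null
  refl-null u = nonedge-null (isEdge-irrefl u)

  private module GΓ = GroupProperties (wordGroup Γ)

  e-inv : ∀ u v → Γ ⊢ (e u v ∷ []) ≈ invW (e v u ∷ [])
  e-inv u v = GΓ.inverseˡ-unique (e u v ∷ []) (e v u ∷ []) (≈rel (view-rel (invert u v)))

  e-tree : ∀ {u v} → inTree u v ≡ true → Γ ⊢ (e u v ∷ []) ≈ []
  e-tree {u} {v} q with inTree-elim q
  ... | inj₁ h = ≈rel (view-rel (tree h))
  ... | inj₂ h = ≈trans (e-inv u v) (inv-congW Γ (≈rel (view-rel (tree h))))

  e-null : ∀ {u v} → kind u v ≡ null → Γ ⊢ (e u v ∷ []) ≈ []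
  e-null {u} {v} q = [ (λ p → ≈rel (view-rel (nonedge u v p))) , e-tree ]′ (kind-null q)

  curryΓ : {A : Set} → (V → V → A) → Fin (gens Γ) → A
  curryΓ f s = uncurry f (remQuot (n X) s)

  curryΓ-combine : {A : Set} (f : V → V → A) → ∀ u v → curryΓ f (combine u v) ≡ f u v
  curryΓ-combine f u v = cong (uncurry f) (remQuot-combine u v)

-- Lifts of the edges and the resulting 2-cocycle.

module Lifting (X : Complex) (Tr : SpanningTree X) {Γ̃ : Presentation} (E : CentralExt (π₁Pres X Tr) Γ̃) where
  open EdgePath X Tr public
  private
    module CE = CentralExt E
    module GR = SetoidReasoning (Group.setoid (wordGroup Γ̃))
    module G = GroupProperties (wordGroup Γ̃)

    lift : V → V → Word (gens Γ̃)
    lift u v = proj₁ (CE.πsurj (combine u v))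

  -- A lift is chosen for one orientation of an edge and inverted for the other. The relators for
  -- non-edges, tree edges and reversed edges then lift to the identity, so that only triangles
  -- contribute to the cocycle.
  Lk : Kind → V → V → Word (gens Γ̃)
  Lk null u v = []
  Lk pos  u v = lift u v
  Lk neg  u v = invW (lift v u)

  Lv : V → V → Word (gens Γ̃)
  Lv u v = Lk (kind u v) u v

  L : Fin (gens Γ) → Word (gens Γ̃)
  L = curryΓ Lv

  private
    πLv : ∀ u v → Γ ⊢ πWord Γ Γ̃ CE.π (Lv u v) ≈ (e u v ∷ [])
    πLv u v with kind u v in eq
    ... | null = ≈sym (e-null eq)
    ... | pos  = proj₂ (CE.πsurj (combine u v))
    ... | neg  = ≈trans (ext-inv Γ Γ̃ CE.π (lift v u))
                   (≈trans (inv-congW Γ (proj₂ (CE.πsurj (combine v u)))) (≈sym (e-inv u v)))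

    πL : ∀ s → Γ ⊢ πWord Γ Γ̃ CE.π (L s) ≈ ((s , false) ∷ [])
    πL s = subst (λ t → Γ ⊢ πWord Γ Γ̃ CE.π (L s) ≈ ((t , false) ∷ [])) (combine-remQuot {n X} (n X) s)
      (πLv (proj₁ (remQuot {n X} (n X) s)) (proj₂ (remQuot {n X} (n X) s)))

  open Extension E L πL public

  Lv-null : ∀ {u v} → kind u v ≡ null → Lv u v ≡ []
  Lv-null q rewrite q = refl

  Lv-flip : ∀ u v → Γ̃ ⊢ Lv u v ++ Lv v u ≈ []
  Lv-flip u v = subst (λ k → Γ̃ ⊢ Lv u v ++ Lk k v u ≈ []) (sym (kind-flip u v)) (by-kind (kind u v))
    where
    by-kind : ∀ k → Γ̃ ⊢ Lk k u v ++ Lk (flipK k) v u ≈ []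
    by-kind null = ≈refl
    by-kind pos  = inv-rightW Γ̃ (lift u v)
    by-kind neg  = inv-leftW Γ̃ (lift v u)

  Lv-inv : ∀ u v → Γ̃ ⊢ Lv v u ≈ invW (Lv u v)
  Lv-inv u v = G.inverseʳ-unique (Lv u v) (Lv v u) (Lv-flip u v)

  tri : V → V → V → Word (gens Γ)
  tri u v w = e u v ∷ e v w ∷ e w u ∷ []

  L̂-e : ∀ u v w → L̂ (e u v ∷ w) ≡ Lv u v ++ L̂ w
  L̂-e u v w = cong (_++ L̂ w) (curryΓ-combine Lv u v)

  private
    ω-by : ∀ u v w → Dec (inY X ⟪ u , v , w ⟫ ≡ true) → Bool
    ω-by u v w (yes q) = proj₁ (L̂-ker (tri u v w) (≈rel (view-rel (triangle (inY⇒Face q)))))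
    ω-by u v w (no _)  = false

  -- The 2-cocycle of the extension with respect to the lifts L.
  ω : V → V → V → Bool
  ω u v w = ω-by u v w (inY X ⟪ u , v , w ⟫ ≟B true)

  ω-tri : ∀ {u v w} → Face u v w → Γ̃ ⊢ L̂ (tri u v w) ≈ zp (ω u v w)
  ω-tri {u} {v} {w} F = by-cases (inY X ⟪ u , v , w ⟫ ≟B true)
    where
    by-cases : (d : Dec (inY X ⟪ u , v , w ⟫ ≡ true)) → Γ̃ ⊢ L̂ (tri u v w) ≈ zp (ω-by u v w d)
    by-cases (yes q) = proj₂ (L̂-ker (tri u v w) (≈rel (view-rel (triangle (inY⇒Face q)))))
    by-cases (no q)  = ⊥-elim (q (Face⇒inY F))

  ω-spec : ∀ {u v w} → Face u v w → Γ̃ ⊢ Lv u v ++ Lv v w ≈ (Lv u w ++ zp (ω u v w))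
  ω-spec {u} {v} {w} F = begin
    Lv u v ++ Lv v w                             ≈⟨ ≡⇒≈ (sym (++-identityʳ _)) ⟩
    (Lv u v ++ Lv v w) ++ []                     ≈⟨ ≈cong {u = Lv u v ++ Lv v w} ≈refl (≈sym (Lv-flip w u)) ⟩
    (Lv u v ++ Lv v w) ++ (Lv w u ++ Lv u w)     ≈⟨ ≡⇒≈ (sym (++-assoc (Lv u v ++ Lv v w) (Lv w u) (Lv u w))) ⟩
    ((Lv u v ++ Lv v w) ++ Lv w u) ++ Lv u w     ≈⟨ ≈cong {v = Lv u w} (≈trans (≡⇒≈ eq) (ω-tri F)) ≈refl ⟩
    zp (ω u v w) ++ Lv u w                       ≈⟨ ≈sym (zp-central (ω u v w) (Lv u w)) ⟩
    Lv u w ++ zp (ω u v w)                       ∎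
    where
    open GR
    eq : (Lv u v ++ Lv v w) ++ Lv w u ≡ L̂ (tri u v w)
    eq = trans (++-assoc (Lv u v) _ _) (sym (trans (L̂-e u v (e v w ∷ e w u ∷ [])) (cong (Lv u v ++_) (trans (L̂-e v w (e w u ∷ []))
           (cong (Lv v w ++_) (trans (L̂-e w u []) (++-identityʳ _)))))))

  ω-unique : ∀ {u v w b} → Face u v w → Γ̃ ⊢ Lv u v ++ Lv v w ≈ (Lv u w ++ zp b) → ω u v w ≡ b
  ω-unique {u} {v} {w} F q = zp-cancel (Lv u w) (≈trans (≈sym (ω-spec F)) q)

  -- Rotating the triangle conjugates its lift, which is central.
  ω-cyc : ∀ {u v w} → Face u v w → ω v w u ≡ ω u v w
  ω-cyc {u} {v} {w} F@(G , G∈ , a , b , c) = ω-unique (G , G∈ , b , c , a) (begin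
    Lv v w ++ Lv w u                          ≈⟨ ≈cong {v = Lv v w ++ Lv w u} (≈sym (Lv-flip v u)) ≈refl ⟩
    (Lv v u ++ Lv u v) ++ (Lv v w ++ Lv w u)  ≈⟨ ≡⇒≈ (++-assoc (Lv v u) _ _) ⟩
    Lv v u ++ (Lv u v ++ (Lv v w ++ Lv w u))  ≈⟨ ≈cong {u = Lv v u} ≈refl (≡⇒≈ (sym (++-assoc (Lv u v) _ _))) ⟩
    Lv v u ++ ((Lv u v ++ Lv v w) ++ Lv w u)  ≈⟨ ≈cong {u = Lv v u} ≈refl (≈cong {v = Lv w u} (≈trans (ω-spec F) (zp-central (ω u v w) (Lv u w))) ≈refl) ⟩
    Lv v u ++ ((zp (ω u v w) ++ Lv u w) ++ Lv w u) ≈⟨ ≈cong {u = Lv v u} ≈refl (≡⇒≈ (++-assoc (zp (ω u v w)) _ _)) ⟩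
    Lv v u ++ (zp (ω u v w) ++ (Lv u w ++ Lv w u)) ≈⟨ ≈cong {u = Lv v u} ≈refl (≈cong {u = zp (ω u v w)} ≈refl (Lv-flip u w)) ⟩
    Lv v u ++ (zp (ω u v w) ++ [])             ≈⟨ ≈cong {u = Lv v u} ≈refl (≡⇒≈ (++-identityʳ _)) ⟩
    Lv v u ++ zp (ω u v w)                     ∎)
    where open GR

  zp-inv : ∀ b → Γ̃ ⊢ invW (zp b) ≈ zp b
  zp-inv true  = ≈sym (G.inverseˡ-unique z z ιhom)
  zp-inv false = ≈refl

  -- Inverting the defining relation reverses the path, and `z` is its own inverse. Together with
  -- `ω-cyc` this makes `ω` invariant under all permutations of the vertices, so that it descends to
  -- unordered triangles.
  ω-rev : ∀ {u v w} → Face u v w → ω w v u ≡ ω u v w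
  ω-rev {u} {v} {w} F@(G , G∈ , a , b , c) = ω-unique (G , G∈ , c , b , a) (begin
    Lv w v ++ Lv v u                  ≈⟨ ≈cong (Lv-inv v w) (Lv-inv u v) ⟩
    invW (Lv v w) ++ invW (Lv u v)    ≈⟨ ≈sym (G.⁻¹-anti-homo-∙ (Lv u v) (Lv v w)) ⟩
    invW (Lv u v ++ Lv v w)           ≈⟨ inv-congW Γ̃ (≈trans (ω-spec F) (zp-central (ω u v w) (Lv u w))) ⟩
    invW (zp (ω u v w) ++ Lv u w)     ≈⟨ G.⁻¹-anti-homo-∙ (zp (ω u v w)) (Lv u w) ⟩
    invW (Lv u w) ++ invW (zp (ω u v w)) ≈⟨ ≈cong (≈sym (Lv-inv u w)) (zp-inv (ω u v w)) ⟩
    Lv w u ++ zp (ω u v w)            ∎)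
    where open GR

  ω-degenerate₁ : ∀ {u w} → Face u u w → ω u u w ≡ false
  ω-degenerate₁ {u} {w} F = ω-unique F (≡⇒≈ (trans (cong (_++ Lv u w) (Lv-null (refl-null u))) (sym (++-identityʳ _))))

  -- Associativity: the two bracketings of the product of `Lv a b`, `Lv b c` and `Lv c d` collect
  -- the exponents of `z` over complementary pairs of faces.
  ω-cocycle : ∀ {a b c d F} → F ∈ facets X → lookup F a ≡ true → lookup F b ≡ true → lookup F c ≡ true → lookup F d ≡ true →
    ω a b c xor ω a c d ≡ ω b c d xor ω a b d
  ω-cocycle {a} {b} {c} {d} {F} F∈ ha hb hc hd = zp-cancel (Lv a d) (begin
    Lv a d ++ zp (ω a b c xor ω a c d)          ≈⟨ ≡⇒≈ (cong (λ t → Lv a d ++ zp t) (xor-comm (ω a b c) _)) ⟩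
    Lv a d ++ zp (ω a c d xor ω a b c)          ≈⟨ assoc-zp (Lv a d) (ω a c d) (ω a b c) ⟩
    (Lv a d ++ zp (ω a c d)) ++ zp (ω a b c)    ≈⟨ ≈cong {v = zp (ω a b c)} (≈sym (ω-spec (F , F∈ , ha , hc , hd))) ≈refl ⟩
    (Lv a c ++ Lv c d) ++ zp (ω a b c)          ≈⟨ ≈sym right ⟩
    (Lv a b ++ Lv b c) ++ Lv c d                ≈⟨ ≡⇒≈ (++-assoc (Lv a b) _ _) ⟩
    Lv a b ++ (Lv b c ++ Lv c d)                ≈⟨ ≈cong {u = Lv a b} ≈refl (ω-spec (F , F∈ , hb , hc , hd)) ⟩
    Lv a b ++ (Lv b d ++ zp (ω b c d))          ≈⟨ ≡⇒≈ (sym (++-assoc (Lv a b) _ _)) ⟩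
    (Lv a b ++ Lv b d) ++ zp (ω b c d)          ≈⟨ ≈cong {v = zp (ω b c d)} (ω-spec (F , F∈ , ha , hb , hd)) ≈refl ⟩
    (Lv a d ++ zp (ω a b d)) ++ zp (ω b c d)    ≈⟨ ≈sym (assoc-zp (Lv a d) (ω a b d) (ω b c d)) ⟩
    Lv a d ++ zp (ω a b d xor ω b c d)          ≈⟨ ≡⇒≈ (cong (λ t → Lv a d ++ zp t) (xor-comm (ω a b d) _)) ⟩
    Lv a d ++ zp (ω b c d xor ω a b d)          ∎)
    where
    open GR
    assoc-zp : ∀ u s t → Γ̃ ⊢ u ++ zp (s xor t) ≈ ((u ++ zp s) ++ zp t)
    assoc-zp u s t = ≈trans (≈cong {u = u} ≈refl (≈sym (zp-xor s t))) (≡⇒≈ (sym (++-assoc u (zp s) (zp t))))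
    right : Γ̃ ⊢ (Lv a b ++ Lv b c) ++ Lv c d ≈ ((Lv a c ++ Lv c d) ++ zp (ω a b c))
    right = ≈trans (up-to-zp {u' = Lv a c} {v' = Lv c d} {b = false} (ω-spec (F , F∈ , ha , hb , hc)) (≡⇒≈ (sym (++-identityʳ (Lv c d)))))
      (≡⇒≈ (cong (λ t → (Lv a c ++ Lv c d) ++ zp t) (xor-identityʳ (ω a b c))))

-- Hamming distance with errors.

complement-ratio : ∀ {a c b k} → a + c ≡ suc b → 1ℚ ℚ.- ratio 1 (suc k) ℚ.≤ ratio a (suc b) →
  ratio c (suc b) ℚ.≤ ratio 1 (suc k)
complement-ratio {a} {c} {b} {k} eq le = ℚ.≤-trans (ℚ.≤-reflexive (sym (cancel ra rc))) (ℚ.≤-trans (ℚ.+-monoʳ-≤ (ℚ.- ra) step₂) (ℚ.≤-reflexive (cancel ra δ')))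
  where
  ra = ratio a (suc b)
  rc = ratio c (suc b)
  δ' = ratio 1 (suc k)
  cancel : ∀ p q → ℚ.- p ℚ.+ (p ℚ.+ q) ≡ q
  cancel p q = trans (sym (ℚ.+-assoc (ℚ.- p) p q)) (trans (cong (ℚ._+ q) (ℚ.+-inverseˡ p)) (ℚ.+-identityˡ q))
  sum₁ : ra ℚ.+ rc ≡ 1ℚ
  sum₁ = trans (sym (ratio-+ a c b)) (trans (cong (λ t → ratio t (suc b)) eq) (ratio-n/n b))
  step₁ : (1ℚ ℚ.- δ') ℚ.+ δ' ≡ 1ℚ
  step₁ = trans (ℚ.+-assoc 1ℚ (ℚ.- δ') δ') (trans (cong (1ℚ ℚ.+_) (ℚ.+-inverseˡ δ')) (ℚ.+-identityʳ 1ℚ))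
  step₂ : ra ℚ.+ rc ℚ.≤ ra ℚ.+ δ'
  step₂ = ℚ.≤-trans (ℚ.≤-reflexive (trans sum₁ (sym step₁))) (ℚ.+-monoˡ-≤ δ' le)

module _ {N M : ℕ} (le : N ≤ M) where
  j-inj : ∀ {x y} → inject≤ x le ≡ inject≤ y le → x ≡ y
  j-inj {x} {y} q = inject≤-injective le le x y q

  module _ (σ : Permutation′ N) (σ' : Permutation′ M) where
    private
      none differ : Fin M → Bool
      none y = allFinB N (λ x → not (inject≤ x le == y))
      differ y = anyFin N (λ x → (inject≤ x le == y) ∧ not (inject≤ (σ ⟨$⟩ʳ x) le == (σ' ⟨$⟩ʳ y)))

    Agree : Fin M → Set
    Agree y = ∃[ x ] (y ≡ inject≤ x le × inject≤ (σ ⟨$⟩ʳ x) le ≡ σ' ⟨$⟩ʳ y)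

    disagree : Fin M → Bool
    disagree y = none y ∨ differ y

    agree : ∀ y → disagree y ≡ false → Agree y
    agree y q = by-hit (any? (λ x → inject≤ x le ≟F y))
      where
      by-value : ∀ x → inject≤ x le ≡ y → Dec (inject≤ (σ ⟨$⟩ʳ x) le ≡ σ' ⟨$⟩ʳ y) → Agree y
      by-value x p (yes r) = x , sym p , r
      by-value x p (no ¬r) = case trans (sym (proj₂ (∨-false {none y} q)))
        (anyFin-intro x (cong₂ (λ a b → a ∧ not b) (trans (cong (_== y) p) (==-refl y)) (≢⇒== ¬r))) of λ ()
      by-hit : Dec (∃[ x ] inject≤ x le ≡ y) → Agree y
      by-hit (no ¬p) = case trans (sym (proj₁ (∨-false {none y} q)))
        (allFinB-intro (λ x → cong not (≢⇒== (λ r → ¬p (x , r))))) of λ ()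
      by-hit (yes (x , p)) = by-value x p (inject≤ (σ ⟨$⟩ʳ x) le ≟F (σ' ⟨$⟩ʳ y))

module _ {N M : ℕ} (le : suc N ≤ suc M) where
  private
    j : Fin (suc N) → Fin (suc M)
    j x = inject≤ x le

  dH-exc : ∀ (σ : Permutation′ (suc N)) (σ' : Permutation′ (suc M)) K → dHperm le σ σ' ℚ.≤ ratio 1 (suc K) →
    ∃[ d ] (suc K * d ≤ suc M × Exc d (Agree le σ σ'))
  dH-exc σ σ' K h = count (suc M) (disagree le σ σ') ,
    ≤-trans (≤-reflexive (*-comm (suc K) _)) (≤-trans (ratio-≤⁻ {count (suc M) (disagree le σ σ')} {M} {1} {K} h) (≤-reflexive (+-identityʳ (suc M)))) ,
    exc (disagree le σ σ') ≤-refl (agree le σ σ')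

  -- Points outside the image of `j` are disagreements by convention, so a small distance also
  -- bounds how many points a correction adds: the remaining points inject into the smaller set.
  image-bound : ∀ {d} → Exc d (λ y → ∃[ x ] y ≡ j x) → suc M ≤ suc N + d
  image-bound (exc b f g) = ≤-trans (≤-reflexive (trans (sym (count-not b)) (+-comm (count (suc M) b) _)))
    (+-mono-≤ (injective⇒≤ {f = pre} pre-inj) f)
    where
    module E = Enumeration (enumerate (not ∘ b))
    pre : Fin (count (suc M) (not ∘ b)) → Fin (suc N)
    pre i = proj₁ (g (E.r i) (not≡true (E.r-true i)))
    pre-inj : ∀ {i k} → pre i ≡ pre k → i ≡ k
    pre-inj {i} {k} q = E.r-inj (trans (proj₂ (g (E.r i) (not≡true (E.r-true i))))
      (trans (cong j q) (sym (proj₂ (g (E.r k) (not≡true (E.r-true k)))))))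

  -- Seen in the larger set, the exceptions are the old ones together with the at most `d` added
  -- points.
  Exc-image : ∀ {c d} {P : Fin (suc N) → Set} → suc M ≤ suc N + d → Exc c P → Exc (c + d) (λ y → ∃[ x ] (j x ≡ y × P x))
  Exc-image {c} {d} {P} bound (exc b f g) = exc (not ∘ hit) few' good'
    where
    hit : Fin (suc M) → Bool
    hit y = anyFin (suc N) (λ x → (j x == y) ∧ not (b x))
    few' : count (suc M) (not ∘ hit) ≤ c + d
    few' = +-cancelˡ-≤ (count (suc M) hit) _ _ (begin
      count (suc M) hit + count (suc M) (not ∘ hit)  ≡⟨ count-not hit ⟩
      suc M                                          ≤⟨ bound ⟩
      suc N + d                                      ≡⟨ cong (_+ d) (sym (count-not b)) ⟩
      (count (suc N) b + count (suc N) (not ∘ b)) + d ≤⟨ +-monoˡ-≤ d (+-mono-≤ f (≤-trans (count-mono in-hit) (count-inj j (j-inj le) hit))) ⟩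
      (c + count (suc M) hit) + d                    ≡⟨ cong (_+ d) (+-comm c _) ⟩
      (count (suc M) hit + c) + d                    ≡⟨ +-assoc (count (suc M) hit) c d ⟩
      count (suc M) hit + (c + d)                    ∎)
      where
      open ≤-Reasoning
      in-hit : ∀ x → not (b x) ≡ true → hit (j x) ≡ true
      in-hit x q = anyFin-intro x (trans (cong (_∧ not (b x)) (==-refl (j x))) q)
    good' : ∀ y → not (hit y) ≡ false → ∃[ x ] (j x ≡ y × P x)
    good' y q with hit y in eq
    ... | true = let x , p = anyFin-elim eq ; p₁ , p₂ = ∧-true p in x , ==⇒≡ p₁ , g x (not≡true p₂)

-- Group equations hold almost everywhere.

module SoficWords {P : Presentation} (N : ℕ → ℕ) (φ : ∀ n → Perms (gens P) (suc (N n))) (ε : ℕ → ℚ)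
                  (def : ∀ n → DefectAtMost P (φ n) (ε n)) (ε→0 : Tends0 ε) where
  open AlmostAll N public

  -- A derivation invokes only finitely many relators, each failing on a set of vanishing density,
  -- and words permute the points, so only finitely many small sets are united.
  AA-≈ : ∀ {u v} → P ⊢ u ≈ v → AA (λ n x → act (φ n) u x ≡ act (φ n) v x)
  AA-≈ ≈refl = AA-all (λ n x → refl)
  AA-≈ (≈sym q) = AA-map (λ n x → sym) (AA-≈ q)
  AA-≈ (≈trans q r) = AA-map (λ n x (a , b) → trans a b) (AA-× (AA-≈ q) (AA-≈ r))
  AA-≈ (≈cong {u} {u'} {v} {v'} q r) =
    AA-map (λ n x (a , b) → trans (act-++ (φ n) u v x) (trans a (trans (cong (act (φ n) u') b) (sym (act-++ (φ n) u' v' x)))))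
      (AA-× (AA-pull (λ n → act (φ n) v) (λ n → act-inj (φ n) v) (AA-≈ q)) (AA-≈ r))
  AA-≈ (≈free s b) = AA-all (λ n x → applyL-invʳ (φ n) (s , b) x)
  AA-≈ (≈rel {r} r∈) = aa λ K → let n₀ , h = ε→0 (ratio 1 (suc K)) (ratio-pos K) in
    n₀ , λ n le → cnt n , bound K n (ℚ.≤-trans (def n r r∈) (proj₁ (h n le))) ,
      exc (λ x → not (act (φ n) r x == x)) ≤-refl (λ x q → ==⇒≡ (not≡false q))
    where
    cnt : ℕ → ℕ
    cnt n = count (suc (N n)) (λ x → not (act (φ n) r x == x))
    bound : ∀ K n → ratio (cnt n) (suc (N n)) ℚ.≤ ratio 1 (suc K) → K * cnt n ≤ suc (N n)
    bound K n h = ≤-trans (*-monoˡ-≤ (cnt n) (n≤1+n K)) (≤-trans (≤-reflexive (*-comm (suc K) (cnt n)))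
      (≤-trans (ratio-≤⁻ {cnt n} {N n} {1} {K} h) (≤-reflexive (+-identityʳ _))))
    not≡false : ∀ {b} → not b ≡ false → b ≡ true
    not≡false {true} _ = refl

  AA-moved : ∀ w → Tends1 (λ n → moved (φ n) w) → AA (λ n x → act (φ n) w x ≢ x)
  AA-moved w t = aa λ K → let n₀ , h = t (ratio 1 (suc K)) (ratio-pos K) in
    n₀ , λ n le → cnt n , bound K n (proj₁ (h n le)) , exc (λ x → act (φ n) w x == x) ≤-refl (λ x → ==false⇒≢)
    where
    cnt : ℕ → ℕ
    cnt n = count (suc (N n)) (λ x → act (φ n) w x == x)
    mvd : ℕ → ℕ
    mvd n = count (suc (N n)) (λ x → not (act (φ n) w x == x))
    bound : ∀ K n → 1ℚ ℚ.- ratio 1 (suc K) ℚ.≤ ratio (mvd n) (suc (N n)) → K * cnt n ≤ suc (N n)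
    bound K n h = ≤-trans (*-monoˡ-≤ (cnt n) (n≤1+n K)) (≤-trans (≤-reflexive (*-comm (suc K) (cnt n)))
      (≤-trans (ratio-≤⁻ {cnt n} {N n} {1} {K} (complement-ratio {mvd n} {cnt n} {N n} {K}
         (trans (+-comm (mvd n) _) (count-not (λ x → act (φ n) w x == x))) h)) (≤-reflexive (+-identityʳ _))))

-- The almost action of `Γ` obtained from that of `Γ̃`.

module Approximation (X : Complex) (Tr : SpanningTree X) {Γ̃ : Presentation} (E : CentralExt (π₁Pres X Tr) Γ̃)
    (N : ℕ → ℕ) (φ : ∀ n → Perms (gens Γ̃) (suc (N n))) (ε : ℕ → ℚ)
    (def : ∀ n → DefectAtMost Γ̃ (φ n) (ε n)) (ε→0 : Tends0 ε)
    (z-moves : Tends1 (λ n → moved (φ n) (CentralExt.z E))) where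
  open Lifting X Tr E public
  open SoficWords {Γ̃} N φ ε def ε→0 public

  Pt : ℕ → Set
  Pt n = Fin (suc (N n))

  A : ∀ n → Word (gens Γ̃) → Pt n → Pt n
  A n = act (φ n)

  Z : ∀ n → Pt n → Pt n
  Z n = A n z

  ZZ : AA (λ n x → Z n (Z n x) ≡ x)
  ZZ = AA-map (λ n x q → trans (sym (act-++ (φ n) z z x)) q) (AA-≈ ιhom)

  Z≢ : AA (λ n x → Z n x ≢ x)
  Z≢ = AA-moved z z-moves

  Z-comm : ∀ u → AA (λ n x → A n u (Z n x) ≡ Z n (A n u x))
  Z-comm u = AA-map (λ n x q → trans (sym (act-++ (φ n) u z x)) (trans q (act-++ (φ n) z u x))) (AA-≈ (z-commutes u))

  pullA : ∀ u {P} → AA P → AA (λ n x → P n (A n u x))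
  pullA u = AA-pull (λ n → A n u) (λ n → act-inj (φ n) u)

  zp-zp : ∀ n a b x → Z n (Z n x) ≡ x → A n (zp a) (A n (zp b) x) ≡ A n (zp (a xor b)) x
  zp-zp n true  true  x q = q
  zp-zp n true  false x q = refl
  zp-zp n false b     x q = refl

  zp-comm : ∀ n u b x → A n u (Z n x) ≡ Z n (A n u x) → A n u (A n (zp b) x) ≡ A n (zp b) (A n u x)
  zp-comm n u true  x q = q
  zp-comm n u false x q = refl

  Ll : Letter (gens Γ) → Word (gens Γ̃)
  Ll (s , b) = if b then invW (L s) else L s

  -- Needed twice: with `j` the identity for the almost action `φ̄`, and with `j` the inclusion of
  -- its points into those of the corrected action.
  module Comparison (M : ℕ → ℕ) (j : ∀ n → Pt n → Fin (M n)) (j-inj : ∀ n {x y} → j n x ≡ j n y → x ≡ y) where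
    Lifts : (τ : ∀ n → Fin (M n) → Fin (M n)) (a : ∀ n → Fin (M n) → Bool) (u : Word (gens Γ̃)) → Set
    Lifts τ a u = AA (λ n x → τ n (j n x) ≡ j n (A n (zp (a n (j n x))) (A n u x)))

    -- The preimage of `j n x` comes from `x₀` or from `Z n x₀`, depending on the signs at both
    -- points; hence the hypothesis is also pulled back along `z`.
    Lifts-inverse : (τ : ∀ n → Permutation′ (M n)) (a : ∀ n → Fin (M n) → Bool) (u : Word (gens Γ̃)) →
      Lifts (λ n → τ n ⟨$⟩ʳ_) a u → Lifts (λ n → τ n ⟨$⟩ˡ_) (λ n y → a n (τ n ⟨$⟩ˡ y)) (invW u)
    Lifts-inverse τ a u h = AA-map conclude
      (AA-× (pullA (invW u) h) (AA-× (pullA (invW u) (pullA z h)) (AA-× (pullA (invW u) (Z-comm u)) (AA-× (pullA (invW u) Z≢) ZZ))))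
      where
      module _ (n : ℕ) (x : Pt n) where
        x₀ = A n (invW u) x
        ux₀ : A n u x₀ ≡ x
        ux₀ = act-invʳ (φ n) u x
        back : ∀ {y y'} → τ n ⟨$⟩ʳ y ≡ y' → τ n ⟨$⟩ˡ y' ≡ y
        back q = trans (cong (τ n ⟨$⟩ˡ_) (sym q)) (inverseˡ (τ n))
        finish : ∀ t x₁ → a n (j n x₁) ≡ t → A n (zp t) x₀ ≡ x₁ → τ n ⟨$⟩ʳ (j n x₁) ≡ j n x →
          τ n ⟨$⟩ˡ j n x ≡ j n (A n (zp (a n (τ n ⟨$⟩ˡ j n x))) x₀)
        finish t x₁ at q p = trans (back p) (cong (j n) (sym (trans (cong (λ b → A n (zp b) x₀) (trans (cong (a n) (back p)) at)) q)))
        go : ∀ t t' → a n (j n x₀) ≡ t → a n (j n (Z n x₀)) ≡ t' →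
          τ n ⟨$⟩ʳ (j n x₀) ≡ j n (A n (zp t) (A n u x₀)) →
          τ n ⟨$⟩ʳ (j n (Z n x₀)) ≡ j n (A n (zp t') (A n u (Z n x₀))) →
          A n u (Z n x₀) ≡ Z n (A n u x₀) → Z n x₀ ≢ x₀ → Z n (Z n x) ≡ x →
          τ n ⟨$⟩ˡ j n x ≡ j n (A n (zp (a n (τ n ⟨$⟩ˡ j n x))) x₀)
        go false t' at at' p p' cm z≢ zz = finish false x₀ at refl (trans p (cong (j n) ux₀))
        go true true at at' p p' cm z≢ zz = finish true (Z n x₀) at' refl
          (trans p' (cong (j n) (trans (cong (Z n) (trans cm (cong (Z n) ux₀))) zz)))
        -- With these signs `τ n` would send the images of `x₀` and `Z n x₀` to the same point.
        go true false at at' p p' cm z≢ zz =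
          ⊥-elim (z≢ (j-inj n (perm-inj (τ n) (trans p' (trans (cong (j n) cm) (sym p))))))
      conclude : ∀ n x → _ → _
      conclude n x (p , p' , cm , z≢ , zz) = go n x _ _ refl refl p p' cm z≢ zz

    module _ (ψ : ∀ n → Perms (gens Γ) (M n)) (α : ∀ n → Fin (gens Γ) → Fin (M n) → Bool)
             (gen : ∀ s → Lifts (λ n → ψ n s ⟨$⟩ʳ_) (λ n → α n s) (L s)) where

      Lifts-letter : ∀ l → Lifts (λ n → applyL (ψ n) l) (λ n → twL (ψ n) (α n) l) (Ll l)
      Lifts-letter (s , false) = gen s
      Lifts-letter (s , true)  = Lifts-inverse (λ n → ψ n s) (λ n → α n s) (L s) (gen s)

      -- The shorter word leads to `A n (L̂ w) x` or to its translate by `z`, so each letter is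
      -- controlled at both points. The powers of `z`, once commuted to the left, add up to the
      -- holonomy.
      Lifts-word : ∀ w → Lifts (λ n → act (ψ n) w) (λ n → tw (ψ n) (α n) w) (L̂ w)
      Lifts-word [] = AA-all (λ n x → refl)
      Lifts-word (l ∷ w) = AA-map conclude
        (AA-× (Lifts-word w) (AA-× (pullA (L̂ w) (Lifts-letter l)) (AA-× (pullA (L̂ w) (pullA z (Lifts-letter l)))
          (AA-× (pullA (L̂ w) (Z-comm (Ll l))) (pullA (L̂ (l ∷ w)) ZZ)))))
        where
        LetterAt : ∀ n → Pt n → Set
        LetterAt n x = applyL (ψ n) l (j n x) ≡ j n (A n (zp (twL (ψ n) (α n) l (j n x))) (A n (Ll l) x))
        at-sign : ∀ n y t → LetterAt n y → LetterAt n (Z n y) → LetterAt n (A n (zp t) y)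
        at-sign n y true  p p' = p'
        at-sign n y false p p' = p
        conclude : ∀ n x → _ → act (ψ n) (l ∷ w) (j n x) ≡ j n (A n (zp (tw (ψ n) (α n) (l ∷ w) (j n x))) (A n (L̂ (l ∷ w)) x))
        conclude n x (ih , p , p' , cm , zz) = begin
          applyL (ψ n) l (act (ψ n) w (j n x))     ≡⟨ cong (applyL (ψ n) l) ih ⟩
          applyL (ψ n) l (j n xw)                  ≡⟨ at-sign n y t p p' ⟩
          j n (A n (zp (twL (ψ n) (α n) l (j n xw))) (A n (Ll l) xw)) ≡⟨ cong (λ q → j n (A n (zp (twL (ψ n) (α n) l q)) (A n (Ll l) xw))) (sym ih) ⟩
          j n (A n (zp b) (A n (Ll l) xw))         ≡⟨ cong (j n ∘ A n (zp b)) (zp-comm n (Ll l) t y cm) ⟩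
          j n (A n (zp b) (A n (zp t) (A n (Ll l) y))) ≡⟨ cong (j n ∘ A n (zp b) ∘ A n (zp t)) (sym (act-++ (φ n) (Ll l) (L̂ w) x)) ⟩
          j n (A n (zp b) (A n (zp t) (A n (L̂ (l ∷ w)) x))) ≡⟨ cong (j n) (zp-zp n b t _ zz) ⟩
          j n (A n (zp (b xor t)) (A n (L̂ (l ∷ w)) x)) ∎
          where
          open ≡-Reasoning
          t = tw (ψ n) (α n) w (j n x)
          y = A n (L̂ w) x
          xw = A n (zp t) y
          b = twL (ψ n) (α n) l (act (ψ n) w (j n x))

  -- sgn separates the two points of a z-orbit; φ̄ below moves a point by L s, followed by z if needed to keep
  -- the sign, so it consists of two copies of the almost action of Γ on the quotient by z.
  sgn : ∀ n → Pt n → Bool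
  sgn n x = ⌊ x <F? Z n x ⌋

  sgn-Z : AA (λ n x → sgn n (Z n x) ≡ not (sgn n x))
  sgn-Z = AA-map (λ n x (p , q) → trans (cong (λ y → ⌊ Z n x <F? y ⌋) p) (<-flip (q ∘ sym))) (AA-× ZZ Z≢)

  sg : Fin (gens Γ) → ∀ n → Pt n → Bool
  sg s n x = sgn n (A n (L s) x) xor sgn n x

  f : Fin (gens Γ) → ∀ n → Pt n → Pt n
  f s n x = A n (zp (sg s n x)) (A n (L s) x)

  -- The conditions that make `f` injective; being decidable, they give `complete` a Boolean domain.
  record OK (s : Fin (gens Γ)) (n : ℕ) (x : Pt n) : Set where
    constructor ok
    field
      comm  : A n (L s) (Z n x) ≡ Z n (A n (L s) x)
      flip₁ : sgn n (Z n x) ≡ not (sgn n x)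
      flip₂ : sgn n (Z n (A n (L s) x)) ≡ not (sgn n (A n (L s) x))

  OK? : ∀ s n x → Dec (OK s n x)
  OK? s n x with A n (L s) (Z n x) ≟F Z n (A n (L s) x) | sgn n (Z n x) ≟B not (sgn n x) | sgn n (Z n (A n (L s) x)) ≟B not (sgn n (A n (L s) x))
  ... | yes a | yes b | yes c = yes (ok a b c)
  ... | no ¬a | _     | _     = no (¬a ∘ OK.comm)
  ... | _     | no ¬b | _     = no (¬b ∘ OK.flip₁)
  ... | _     | _     | no ¬c = no (¬c ∘ OK.flip₂)

  okB : ∀ s n → Pt n → Bool
  okB s n x = ⌊ OK? s n x ⌋

  okB⇒OK : ∀ {s n x} → okB s n x ≡ true → OK s n x
  okB⇒OK {s} {n} {x} q with OK? s n x
  ... | yes p = p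

  OK⇒okB : ∀ {s n x} → OK s n x → okB s n x ≡ true
  OK⇒okB {s} {n} {x} p with OK? s n x
  ... | yes _ = refl
  ... | no ¬p = ⊥-elim (¬p p)

  AA-OK : ∀ s → AA (OK s)
  AA-OK s = AA-map (λ n x (a , b , c) → ok a b c) (AA-× (Z-comm (L s)) (AA-× sgn-Z (pullA (L s) sgn-Z)))

  f-sgn : ∀ {s n x} → OK s n x → sgn n (f s n x) ≡ sgn n x
  f-sgn {s} {n} {x} (ok _ _ c) = go (sgn n (A n (L s) x)) (sgn n x) refl refl
    where
    go : ∀ a b → sgn n (A n (L s) x) ≡ a → sgn n x ≡ b → sgn n (A n (zp (a xor b)) (A n (L s) x)) ≡ b
    go true  true  p q = p
    go false false p q = p
    go true  false p q = trans c (cong not p)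
    go false true  p q = trans c (cong not p)

  -- `f` preserves the sign. Points colliding through different powers of `z` would be translates of
  -- each other by `z`, hence of opposite sign.
  f-inj : ∀ s n x y → okB s n x ≡ true → okB s n y ≡ true → f s n x ≡ f s n y → x ≡ y
  f-inj s n x y px py q = go (sg s n x) (sg s n y) q
    where
    okx = okB⇒OK px
    oky = okB⇒OK py
    same : sgn n x ≡ sgn n y
    same = trans (sym (f-sgn okx)) (trans (cong (sgn n) q) (f-sgn oky))
    cross : ∀ {x y} → OK s n y → sgn n x ≡ sgn n y → A n (L s) x ≡ Z n (A n (L s) y) → ⊥
    cross {x} {y} oy e p = not-¬ e (trans (cong (sgn n) (act-inj (φ n) (L s) (trans p (sym (OK.comm oy))))) (OK.flip₁ oy))
    go : ∀ a b → A n (zp a) (A n (L s) x) ≡ A n (zp b) (A n (L s) y) → x ≡ y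
    go true  true  p = act-inj (φ n) (L s) (act-inj (φ n) z p)
    go false false p = act-inj (φ n) (L s) p
    go false true  p = ⊥-elim (cross oky same p)
    go true  false p = ⊥-elim (cross okx (sym same) (sym p))

  abstract
    φ̄ : ∀ n → Perms (gens Γ) (suc (N n))
    φ̄ n s = proj₁ (complete (f s n) (okB s n) (f-inj s n))

    φ̄-f : ∀ s → AA (λ n x → φ̄ n s ⟨$⟩ʳ x ≡ f s n x)
    φ̄-f s = AA-map (λ n x p → proj₂ (complete (f s n) (okB s n) (f-inj s n)) x (OK⇒okB p)) (AA-OK s)

  φ̄-sgn : ∀ w → AA (λ n x → sgn n (act (φ̄ n) w x) ≡ sgn n x)
  φ̄-sgn [] = AA-all (λ n x → refl)
  φ̄-sgn (l ∷ w) = AA-map (λ n x (a , b) → trans a b)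
    (AA-× (AA-pull (λ n → act (φ̄ n) w) (λ n → act-inj (φ̄ n) w) (letter l)) (φ̄-sgn w))
    where
    gen : ∀ s → AA (λ n x → sgn n (φ̄ n s ⟨$⟩ʳ x) ≡ sgn n x)
    gen s = AA-map (λ n x (a , b) → trans (cong (sgn n) a) (f-sgn b)) (AA-× (φ̄-f s) (AA-OK s))
    letter : ∀ l → AA (λ n x → sgn n (applyL (φ̄ n) l x) ≡ sgn n x)
    letter (s , false) = gen s
    letter (s , true)  = AA-map (λ n x q → trans (sym q) (cong (sgn n) (inverseʳ (φ̄ n s))))
      (AA-pull (λ n → φ̄ n s ⟨$⟩ˡ_) (λ n {x} {y} → act-inj (φ̄ n) ((s , true) ∷ [])) (gen s))

  -- Relators preserve the sign and act as 1 or z, and z reverses the sign.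
  φ̄-relator : ∀ r → r ∈ rels Γ → AA (λ n x → act (φ̄ n) r x ≡ x)
  φ̄-relator r r∈ = AA-map conclude (AA-× (C.Lifts-word φ̄ (λ n s → sg s n) φ̄-f r)
      (AA-× (AA-≈ (proj₂ (L̂-ker r (≈rel r∈)))) (AA-× ZZ (AA-× (φ̄-sgn r) sgn-Z))))
    where
    module C = Comparison (λ n → suc (N n)) (λ n x → x) (λ n q → q)
    c = proj₁ (L̂-ker r (≈rel r∈))
    go : ∀ n x t y → y ≡ A n (zp t) x → sgn n y ≡ sgn n x → sgn n (Z n x) ≡ not (sgn n x) → y ≡ x
    go n x false y p s fl = p
    go n x true  y p s fl = ⊥-elim (not-¬ refl (trans (sym s) (trans (cong (sgn n) p) fl)))
    conclude : ∀ n x → _ → act (φ̄ n) r x ≡ x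
    conclude n x (p , q , zz , s , fl) = go n x (t xor c) _ (trans p (trans (cong (A n (zp t)) q) (zp-zp n t c x zz))) s fl
      where t = tw (φ̄ n) (λ s → sg s n) r x

-- Quantitative use of stability.

module _ {N M : ℕ} (j : Fin N → Fin M) (g : Fin N → Bool) where
  push : Fin M → Bool
  push y = anyFin N (λ x → (j x == y) ∧ g x)

  push-j : (∀ {x y} → j x ≡ j y → x ≡ y) → ∀ x → push (j x) ≡ g x
  push-j inj x = by-value (g x) (push (j x)) refl refl
    where
    by-value : ∀ a b → g x ≡ a → push (j x) ≡ b → b ≡ a
    by-value true  true  q p = refl
    by-value false false q p = refl
    by-value true  false q p = trans (sym p) (anyFin-intro {f = λ x' → (j x' == j x) ∧ g x'} x (trans (cong (_∧ g x) (==-refl (j x))) q))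
    by-value false true  q p = let x' , r = anyFin-elim {f = λ x' → (j x' == j x) ∧ g x'} p ; r₁ , r₂ = ∧-true r in
      trans (sym r₂) (trans (cong g (inj (==⇒≡ r₁))) q)

some-vertex : (X : Complex) → Fin (n X)
some-vertex X = by-facets (facets X) (facetSize X) (nonempty X)
  where
  by-facets : ∀ Fs → All (λ F → size F ≡ 4) Fs → 1 ≤ length Fs → Fin (n X)
  by-facets (F ∷ Fs) (q ∷ _) _ = proj₁ (count-witness (lookup F) (≤-trans (s≤s z≤n) (≤-reflexive (sym q))))

eventually-all : ∀ {A : Set} (P : A → ℕ → Set) (xs : List A) → (∀ a → a ∈ xs → ∃[ n₀ ] (∀ n → n₀ ≤ n → P a n)) →
  ∃[ n₀ ] (∀ n → n₀ ≤ n → ∀ a → a ∈ xs → P a n)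
eventually-all P [] h = 0 , λ n _ a ()
eventually-all P (x ∷ xs) h with h x (here refl) | eventually-all P xs (λ a a∈ → h a (there a∈))
... | n₀ , f | n₁ , g = n₀ ⊔ n₁ , λ { n le a (here refl) → f n (≤-trans (m≤m⊔n n₀ n₁) le)
                                    ; n le a (there a∈) → g n (≤-trans (m≤n⊔m n₀ n₁) le) a a∈ }

module Stability {P : Presentation} {ρ : ℚ → ℚ} (rate : RateFunction ρ) (stab : Stable P ρ) where

  movedCount : ∀ {N} → Perms (gens P) N → Word (gens P) → ℕ
  movedCount {N} φ r = count N (λ x → not (act φ r x == x))

  defect : ∀ {N} → Perms (gens P) N → ℕ
  defect φ = foldr (λ r d → movedCount φ r ⊔ d) 0 (rels P)

  private
    max-≤ : ∀ {A : Set} (h : A → ℕ) xs c → (∀ a → a ∈ xs → h a ≤ c) → foldr (λ a d → h a ⊔ d) 0 xs ≤ c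
    max-≤ h [] c k = z≤n
    max-≤ h (x ∷ xs) c k = ⊔-lub (k x (here refl)) (max-≤ h xs c (λ a a∈ → k a (there a∈)))

    ≤-max : ∀ {A : Set} (h : A → ℕ) {xs a} → a ∈ xs → h a ≤ foldr (λ a d → h a ⊔ d) 0 xs
    ≤-max h {x ∷ xs} (here refl) = m≤m⊔n (h x) _
    ≤-max h {x ∷ xs} (there a∈) = ≤-trans (≤-max h a∈) (m≤n⊔m (h x) _)

    count≤ : ∀ {N} (g : Fin N → Bool) → count N g ≤ N
    count≤ g = ≤-trans (m≤m+n _ _) (≤-reflexive (count-not g))

  defect-≤ : ∀ {N} (φ : Perms (gens P) N) c → (∀ r → r ∈ rels P → movedCount φ r ≤ c) → defect φ ≤ c
  defect-≤ φ c = max-≤ (movedCount φ) (rels P) c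

  movedCount-≤ : ∀ {N c} (φ : Perms (gens P) N) r → Exc c (λ x → act φ r x ≡ x) → movedCount φ r ≤ c
  movedCount-≤ φ r = Exc-count (λ x → not (act φ r x == x)) (λ x p → cong not (trans (cong (_== x) p) (==-refl x)))

  scaled-defect-≤ : ∀ {N} (φ : Perms (gens P) N) k c → (∀ r → r ∈ rels P → k * movedCount φ r ≤ c) → k * defect φ ≤ c
  scaled-defect-≤ φ k c = go (rels P)
    where
    go : ∀ rs → (∀ r → r ∈ rs → k * movedCount φ r ≤ c) → k * foldr (λ r d → movedCount φ r ⊔ d) 0 rs ≤ c
    go [] h = ≤-trans (≤-reflexive (*-zeroʳ k)) z≤n
    go (r ∷ rs) h = ≤-trans (≤-reflexive (*-distribˡ-⊔ k (movedCount φ r) _)) (⊔-lub (h r (here refl)) (go rs (λ a a∈ → h a (there a∈))))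

  module _ {N : ℕ} (φ : Perms (gens P) (suc N)) where
    -- Stability is applied at the exact defect, so the corrected action depends on `φ` alone and
    -- one choice serves every precision `K`.
    ε̄ : ℚ
    ε̄ = ratio (defect φ) (suc N)

    abstract
      corrected : ∃[ M ] Σ (suc N ≤ suc M) λ le → Σ (Perms (gens P) (suc M)) λ ψ → IsAction P ψ × DistAtMost le φ ψ (ρ ε̄)
      corrected = stab ε̄ (ratio-≥0 (defect φ) N)
        (ℚ.≤-trans (ratio-≤⁺ {defect φ} {N} {suc N} {N} (*-monoˡ-≤ (suc N) (defect-≤ φ (suc N) (λ r _ → count≤ (λ x → not (act φ r x == x)))))) (ℚ.≤-reflexive (ratio-n/n N)))
        N φ (λ r r∈ → ratio-≤⁺ {movedCount φ r} {N} {defect φ} {N} (*-monoˡ-≤ (suc N) (≤-max (movedCount φ) r∈)))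

    M : ℕ
    M = proj₁ corrected

    le : suc N ≤ suc M
    le = proj₁ (proj₂ corrected)

    ψ : Perms (gens P) (suc M)
    ψ = proj₁ (proj₂ (proj₂ corrected))

    ψ-action : IsAction P ψ
    ψ-action = proj₁ (proj₂ (proj₂ (proj₂ corrected)))

    ψ-close : ∀ s → dHperm le (φ s) (ψ s) ℚ.≤ ρ ε̄
    ψ-close = proj₂ (proj₂ (proj₂ (proj₂ corrected)))

    j : Fin (suc N) → Fin (suc M)
    j x = inject≤ x le

    CorrectAt : ℕ → Fin (gens P) → Set
    CorrectAt K s = ∃[ d ] (K * d ≤ suc N × suc M ≤ suc N + d × Exc d (λ x → j (φ s ⟨$⟩ʳ x) ≡ ψ s ⟨$⟩ʳ j x))

    correct-at : ∀ K s → ∃[ d ] (suc K * d ≤ suc M × Exc d (Agree le (φ s) (ψ s))) → CorrectAt K s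
    -- From `suc K * d ≤ suc M` and `suc M ≤ suc N + d` one summand `d` is cancelled; this turns a
    -- bound relative to the larger set into one relative to the smaller.
    correct-at K s (d , k , ex) = d , +-cancelˡ-≤ d (K * d) (suc N) (≤-trans k (≤-trans bound (≤-reflexive (+-comm (suc N) d)))) , bound ,
      Exc-map (λ x (x' , p , q) → subst (λ t → j (φ s ⟨$⟩ʳ t) ≡ ψ s ⟨$⟩ʳ j x) (sym (j-inj le p)) q)
        (Exc-pull j (j-inj le) ex)
      where
      bound : suc M ≤ suc N + d
      bound = image-bound le (Exc-map (λ y (x , p , _) → x , p) ex)

  Correct : ∀ {N} → Perms (gens P) (suc N) → ℕ → Set
  Correct φ K = ∀ s → CorrectAt φ K s

  private
    rate-small : ∀ K → ∃[ K' ] (∀ D N → suc K' * D ≤ suc N → ρ (ratio D (suc N)) ℚ.≤ ratio 1 (suc K))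
    rate-small K = let η , 0<η , h = proj₂ rate (ratio 1 (suc K)) (ratio-pos K)
                       K' , K'≤ = archimedean 0<η
      in K' , λ D N small → h (ratio D (suc N)) (ratio-≥0 D N)
              (ℚ.≤-trans (ratio-≤⁺ {D} {N} {1} {K'} (≤-trans (≤-reflexive (*-comm D (suc K'))) (≤-trans small (≤-reflexive (sym (+-identityʳ (suc N))))))) K'≤)

  abstract
    -- `K'` depends on `ρ` and `K` only, not on `φ` or its number of points, so it can be fixed
    -- before any almost action is chosen.
    close : ∀ K → ∃[ K' ] (∀ {N} (φ : Perms (gens P) (suc N)) → suc K' * defect φ ≤ suc N → Correct φ K)
    close K = proj₁ (rate-small K) , λ {N} φ small s →
      correct-at φ K s (dH-exc (le φ) (φ s) (ψ φ s) K (ℚ.≤-trans (ψ-close φ s) (proj₂ (rate-small K) (defect φ) N small)))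

-- Transitive actions with an approximate trivialisation of the cocycle.

module Configurations (X : Complex) (Tr : SpanningTree X) {Γ̃ : Presentation} (E : CentralExt (π₁Pres X Tr) Γ̃)
                      (w : Word (gens Γ̃)) where
  open Lifting X Tr E public

  -- In the second clause the exclusive or is the sign with which `w` acts on the fibre over `y` of
  -- the double cover twisted by `α`; if the image of `w` moves `y`, nothing is required.
  Generic : ∀ {m} → Perms (gens Γ) m → (V → V → Fin m → Bool) → Fin m → Set
  Generic ψ α y = (∀ u v t → Face u v t → tw ψ (curryΓ α) (tri u v t) y ≡ ω u v t) ×
                  (act ψ (π̂ w) y ≡ y → tw ψ (curryΓ α) (π̂ w) y xor cw w ≡ true)

  -- A transitive finite action ψ of Γ with a cochain α which, outside a set of density < 1/K, trivialises
  -- the cocycle of the extension and for which the resulting action of w on the double cover moves every point.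
  record Config (K : ℕ) : Set where
    field
      m          : ℕ
      ψ          : Perms (gens Γ) m
      action     : IsAction Γ ψ
      transitive : ∀ i j → ∃[ u ] act ψ u i ≡ j
      α          : V → V → Fin m → Bool
      α-null     : ∀ {u v} → kind u v ≡ null → ∀ y → α u v y ≡ false
      α-flip     : ∀ u v y → α u v (ψ (combine v u) ⟨$⟩ʳ y) ≡ α v u y
      c          : ℕ
      c-small    : K * c < m
      generic    : Exc c (Generic ψ α)

  module _ {M K c : ℕ} (ψ : Perms (gens Γ) M) (ψ-action : IsAction Γ ψ) (α : V → V → Fin M → Bool)
           (α-null : ∀ {u v} → kind u v ≡ null → ∀ y → α u v y ≡ false)
           (α-flip : ∀ u v y → α u v (ψ (combine v u) ⟨$⟩ʳ y) ≡ α v u y)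
           (ex : Exc c (Generic ψ α)) (small : K * c < M) where
    private
      module R = Restriction (restrict ψ (bad ex) K (≤-trans (s≤s (*-monoʳ-≤ K (few ex))) small))
      αR : V → V → Fin R.m → Bool
      αR u v i = α u v (R.r i)
      tw-r : ∀ u i → tw R.ψO (curryΓ αR) u i ≡ tw ψ (curryΓ α) u (R.r i)
      tw-r [] i = refl
      tw-r ((s , false) ∷ u) i = cong₂ _xor_ (cong (curryΓ α s) (R.r-act u i)) (tw-r u i)
      tw-r ((s , true)  ∷ u) i = cong₂ _xor_ (cong (curryΓ α s) (R.r-act ((s , true) ∷ u) i)) (tw-r u i)
      generic-r : ∀ i → Generic ψ α (R.r i) → Generic R.ψO αR i
      generic-r i (a , b) = (λ u v t F → trans (tw-r (tri u v t) i) (a u v t F)) ,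
        (λ p → trans (cong (_xor cw w) (tw-r (π̂ w) i)) (b (trans (sym (R.r-act (π̂ w) i)) (cong R.r p))))

    -- The exceptional set of `ex` combines all conditions, so an orbit on which it is sparse is
    -- good for all of them at once.
    restrict-config : Config K
    restrict-config = record
      { m = R.m ; ψ = R.ψO ; transitive = R.trans-ψ
      ; action = λ r r∈ i → R.r-inj (trans (R.r-act r i) (ψ-action r r∈ (R.r i)))
      ; α = αR
      ; α-null = λ q i → α-null q (R.r i)
      ; α-flip = λ u v i → trans (cong (α u v) (R.r-act (e v u ∷ []) i)) (α-flip u v (R.r i))
      ; c = count R.m (bad ex ∘ R.r)
      ; c-small = R.few-bad
      ; generic = exc (bad ex ∘ R.r) ≤-refl (λ i q → generic-r i (good ex (R.r i) q)) }

-- From a sofic approximation to a configuration.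

module Stage1 (X : Complex) (Tr : SpanningTree X) {Γ̃ : Presentation} (E : CentralExt (π₁Pres X Tr) Γ̃)
    (N : ℕ → ℕ) (φ : ∀ n → Perms (gens Γ̃) (suc (N n))) (ε : ℕ → ℚ)
    (def : ∀ n → DefectAtMost Γ̃ (φ n) (ε n)) (ε→0 : Tends0 ε)
    (z-moves : Tends1 (λ n → moved (φ n) (CentralExt.z E)))
    {ρ : ℚ → ℚ} (rate : RateFunction ρ) (stab : Stable (π₁Pres X Tr) ρ)
    (w : Word (gens Γ̃)) (w-moves : Tends1 (λ n → moved (φ n) w)) where
  open Approximation X Tr E N φ ε def ε→0 z-moves
  open Configurations X Tr E w using (Config; Generic; restrict-config)
  private
    module St = Stability {π₁Pres X Tr} {ρ} rate stab

  M : ℕ → ℕ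
  M n = St.M (φ̄ n)

  ψ : ∀ n → Perms (gens Γ) (suc (M n))
  ψ n = St.ψ (φ̄ n)

  ψ-action : ∀ n → IsAction Γ (ψ n)
  ψ-action n = St.ψ-action (φ̄ n)

  jΣ : ∀ n → Pt n → Fin (suc (M n))
  jΣ n = St.j (φ̄ n)

  jΣ-inj : ∀ n {x y} → jΣ n x ≡ jΣ n y → x ≡ y
  jΣ-inj n = j-inj (St.le (φ̄ n))

  eventually-correct : ∀ K → ∃[ n₀ ] (∀ n → n₀ ≤ n → St.Correct (φ̄ n) K)
  eventually-correct K = proj₁ all-small , λ k le → proj₂ (St.close K) (φ̄ k) (St.scaled-defect-≤ (φ̄ k) (suc K') (suc (N k)) (proj₂ all-small k le))
    where
    K' = proj₁ (St.close K)
    Small : Word (gens Γ) → ℕ → Set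
    Small r k = suc K' * St.movedCount (φ̄ k) r ≤ suc (N k)
    small : ∀ r k → ∃[ c ] (suc K' * c ≤ suc (N k) × Exc c (λ x → act (φ̄ k) r x ≡ x)) → Small r k
    small r k (c , le , ex) = ≤-trans (*-monoʳ-≤ (suc K') (St.movedCount-≤ (φ̄ k) r ex)) le
    all-small : ∃[ n₀ ] (∀ k → n₀ ≤ k → ∀ r → r ∈ rels Γ → Small r k)
    all-small = eventually-all Small (rels Γ) (λ r r∈ → proj₁ (eventually (φ̄-relator r r∈) (suc K')) ,
      λ k le → small r k (proj₂ (eventually (φ̄-relator r r∈) (suc K')) k le))

  ψ-φ̄ : ∀ s → AA (λ n x → jΣ n (φ̄ n s ⟨$⟩ʳ x) ≡ ψ n s ⟨$⟩ʳ jΣ n x)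
  ψ-φ̄ s = aa λ K → let n₀ , h = eventually-correct K in n₀ , λ n le → let d , k , _ , ex = h n le s in d , k , ex

  -- The distance for a single generator already bounds the added points, and a vertex of `X`
  -- provides a generator.
  few-outside : ∀ K → ∃[ n₀ ] (∀ n → n₀ ≤ n → ∃[ d ] (K * d ≤ suc (N n) × suc (M n) ≤ suc (N n) + d))
  few-outside K = let n₀ , h = eventually-correct K in n₀ , λ n le → let d , k , b , _ = h n le (combine v₀ v₀) in d , k , b
    where v₀ = some-vertex X

  aΣ : ∀ n → Fin (gens Γ) → Fin (suc (M n)) → Bool
  aΣ n s = push (jΣ n) (sg s n)

  aΣ-jΣ : ∀ n s x → aΣ n s (jΣ n x) ≡ sg s n x
  aΣ-jΣ n s = push-j (jΣ n) (sg s n) (jΣ-inj n)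

  -- The sign of a decreasing edge is transported along `ψ` from the opposite orientation. Thus
  -- `α-flip` holds exactly and not merely almost everywhere, as a cochain on unordered edges of the
  -- cover requires.
  αk : ∀ n → Kind → V → V → Fin (suc (M n)) → Bool
  αk n null u v y = false
  αk n pos  u v y = aΣ n (combine u v) y
  αk n neg  u v y = aΣ n (combine v u) (ψ n (combine u v) ⟨$⟩ʳ y)

  α : ∀ n → V → V → Fin (suc (M n)) → Bool
  α n u v = αk n (kind u v) u v

  ψ-flip : ∀ n u v y → ψ n (combine u v) ⟨$⟩ʳ (ψ n (combine v u) ⟨$⟩ʳ y) ≡ y
  ψ-flip n u v y = ψ-action n _ (view-rel (invert u v)) y

  α-null : ∀ n {u v} → kind u v ≡ null → ∀ y → α n u v y ≡ false
  α-null n {u} {v} q y = cong (λ k → αk n k u v y) q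

  α-flip : ∀ n u v y → α n u v (ψ n (combine v u) ⟨$⟩ʳ y) ≡ α n v u y
  α-flip n u v y = trans (by-kind (kind u v)) (cong (λ k → αk n k v u y) (sym (kind-flip u v)))
    where
    by-kind : ∀ k → αk n k u v (ψ n (combine v u) ⟨$⟩ʳ y) ≡ αk n (flipK k) v u y
    by-kind null = refl
    by-kind pos  = refl
    by-kind neg  = cong (aΣ n (combine v u)) (ψ-flip n u v y)

  module C = Comparison (λ n → suc (M n)) jΣ jΣ-inj

  lifts-aΣ : ∀ s → C.Lifts (λ n → ψ n s ⟨$⟩ʳ_) (λ n → aΣ n s) (L s)
  lifts-aΣ s = AA-map (λ n x (p , q) → trans (sym p) (cong (jΣ n) (trans q (cong (λ b → A n (zp b) (A n (L s) x)) (sym (aΣ-jΣ n s x))))))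
    (AA-× (ψ-φ̄ s) (φ̄-f s))

  -- Passing from the raw signs to `αk` keeps the lifting relation: for a null generator both sides
  -- are the identity, and for a decreasing edge it is the inverse of the relation for the opposite
  -- orientation.
  lifts-uv : ∀ u v → C.Lifts (λ n → ψ n (combine u v) ⟨$⟩ʳ_) (λ n → α n u v) (Lv u v)
  lifts-uv u v = by-kind (kind u v) refl
    where
    by-kind : ∀ k → kind u v ≡ k → C.Lifts (λ n → ψ n (combine u v) ⟨$⟩ʳ_) (λ n → αk n k u v) (Lk k u v)
    by-kind null q = AA-all (λ n x → act-≈ Γ (ψ-action n) (e-null q) (jΣ n x))
    by-kind pos  q = subst (C.Lifts (λ n → ψ n (combine u v) ⟨$⟩ʳ_) (λ n → aΣ n (combine u v)))
      (trans (curryΓ-combine Lv u v) (cong (λ k → Lk k u v) q)) (lifts-aΣ (combine u v))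
    by-kind neg  q = AA-map conclude (subst (C.Lifts (λ n → ψ n s' ⟨$⟩ˡ_) (λ n y → aΣ n s' (ψ n s' ⟨$⟩ˡ y)))
        (cong invW (trans (curryΓ-combine Lv v u) (cong (λ k → Lk k v u) (trans (kind-flip u v) (cong flipK q)))))
        (C.Lifts-inverse (λ n → ψ n s') (λ n → aΣ n s') (L s') (lifts-aΣ s')))
      where
      s' = combine v u
      inv : ∀ n y → ψ n s' ⟨$⟩ˡ y ≡ ψ n (combine u v) ⟨$⟩ʳ y
      inv n y = trans (cong (ψ n s' ⟨$⟩ˡ_) (sym (ψ-flip n v u y))) (inverseˡ (ψ n s'))
      conclude : ∀ n x → _ → _
      conclude n x p = trans (sym (inv n (jΣ n x))) (trans p (cong (λ y → jΣ n (A n (zp (aΣ n s' y)) (A n (Lk neg u v) x))) (inv n (jΣ n x))))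

  lifts-gen : ∀ s → C.Lifts (λ n → ψ n s ⟨$⟩ʳ_) (λ n → curryΓ (α n) s) (L s)
  lifts-gen s = subst (λ t → C.Lifts (λ n → ψ n t ⟨$⟩ʳ_) (λ n → curryΓ (α n) s) (L s)) (combine-remQuot {n X} (n X) s)
    (lifts-uv (proj₁ (remQuot {n X} (n X) s)) (proj₂ (remQuot {n X} (n X) s)))

  lifts-word : ∀ u → C.Lifts (λ n → act (ψ n) u) (λ n → tw (ψ n) (curryΓ (α n)) u) (L̂ u)
  lifts-word = C.Lifts-word ψ (λ n → curryΓ (α n)) lifts-gen

  zp-fixed : ∀ n x a b → Z n x ≢ x → Z n (Z n x) ≡ x → x ≡ A n (zp a) (A n (zp b) x) → a ≡ b
  zp-fixed n x true  true  z≢ zz p = refl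
  zp-fixed n x false false z≢ zz p = refl
  zp-fixed n x true  false z≢ zz p = ⊥-elim (z≢ (sym p))
  zp-fixed n x false true  z≢ zz p = ⊥-elim (z≢ (sym p))

  -- `ψ` satisfies the triangle relator exactly, while the lift of the relator acts as `z` to the
  -- power `ω u v t`; since `z` moves the point, the sign must compensate.
  triangle-generic : ∀ u v t → AA (λ n x → Face u v t → tw (ψ n) (curryΓ (α n)) (tri u v t) (jΣ n x) ≡ ω u v t)
  triangle-generic u v t = by-face (inY X ⟪ u , v , t ⟫ ≟B true)
    where
    by-face : Dec (inY X ⟪ u , v , t ⟫ ≡ true) → _
    by-face (no ¬F) = AA-all (λ n x F → ⊥-elim (¬F (Face⇒inY F)))
    by-face (yes q) = AA-map (λ n x (p , r , z≢ , zz) _ → zp-fixed n x _ _ z≢ zz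
        (jΣ-inj n (trans (sym (ψ-action n _ (view-rel (triangle F)) (jΣ n x))) (trans p (cong (λ y → jΣ n (A n (zp (tw (ψ n) (curryΓ (α n)) (tri u v t) (jΣ n x))) y)) r)))))
      (AA-× (lifts-word (tri u v t)) (AA-× (AA-≈ (ω-tri F)) (AA-× Z≢ ZZ)))
      where F = inY⇒Face q

  -- `w` is the lift of its image times `z` to the power `cw w`. If the image fixed the point and
  -- the two signs agreed, `w` would fix it too.
  w-generic : AA (λ n x → act (ψ n) (π̂ w) (jΣ n x) ≡ jΣ n x → tw (ψ n) (curryΓ (α n)) (π̂ w) (jΣ n x) xor cw w ≡ true)
  w-generic = AA-map (λ n x (p , r , mv) fx → go n x (tw (ψ n) (curryΓ (α n)) (π̂ w) (jΣ n x)) (cw w) (jΣ-inj n (trans (sym fx) p))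
      (trans r (act-++ (φ n) (zp (cw w)) (L̂ (π̂ w)) x)) mv)
    (AA-× (lifts-word (π̂ w)) (AA-× (AA-≈ (≈trans (cw-spec w) (zp-central (cw w) (L̂ (π̂ w))))) (AA-moved w w-moves)))
    where
    go : ∀ n x t c → x ≡ A n (zp t) (A n (L̂ (π̂ w)) x) → A n w x ≡ A n (zp c) (A n (L̂ (π̂ w)) x) → A n w x ≢ x → t xor c ≡ true
    go n x true  false p q mv = refl
    go n x false true  p q mv = refl
    go n x true  true  p q mv = ⊥-elim (mv (trans q (sym p)))
    go n x false false p q mv = ⊥-elim (mv (trans q (sym p)))

  AA-Generic : AA (λ n x → Generic (ψ n) (α n) (jΣ n x))
  AA-Generic = AA-× (AA-∀ (λ u → AA-∀ (λ v → AA-∀ (λ t → triangle-generic u v t)))) w-generic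

  config : ∀ K → Config K
  -- The factor 2 splits the budget between exceptions and added points; `suc K` in place of `K`
  -- makes the final inequality strict.
  config K = build (proj₂ (eventually AA-Generic (2 * suc K)) k₀ (m≤m⊔n n₀ n₁)) (proj₂ (few-outside (2 * suc K)) k₀ (m≤n⊔m n₀ n₁))
    where
    n₀ n₁ k₀ : ℕ
    n₀ = proj₁ (eventually AA-Generic (2 * suc K))
    n₁ = proj₁ (few-outside (2 * suc K))
    k₀ = n₀ ⊔ n₁
    build : ∃[ c ] (2 * suc K * c ≤ suc (N k₀) × Exc c (λ x → Generic (ψ k₀) (α k₀) (jΣ k₀ x))) →
            ∃[ d ] (2 * suc K * d ≤ suc (N k₀) × suc (M k₀) ≤ suc (N k₀) + d) → Config K
    build (c , hc , ex) (d , hd , bound) = restrict-config (ψ k₀) (ψ-action k₀) (α k₀) (α-null k₀) (α-flip k₀)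
      (Exc-map (λ y (x , p , q) → subst (Generic (ψ k₀) (α k₀)) p q) (Exc-image (St.le (φ̄ k₀)) bound ex))
      (strict (c + d) (≤-trans (halve (suc K) c d (suc (N k₀)) hc hd) (St.le (φ̄ k₀))))
      where
      strict : ∀ x → suc K * x ≤ suc (M k₀) → K * x < suc (M k₀)
      strict zero    _ = s≤s (≤-trans (≤-reflexive (*-zeroʳ K)) z≤n)
      strict (suc x) q = ≤-trans (s≤s (m≤n+m (K * suc x) x)) q

-- The finite cover attached to a transitive action.

bool-iff : ∀ {a b} → (a ≡ true → b ≡ true) → (b ≡ true → a ≡ true) → a ≡ b
bool-iff {true}  {b}     f g = sym (f refl)
bool-iff {false} {true}  f g = g refl
bool-iff {false} {false} f g = refl

subset-ext : ∀ {k} {σ τ : Subset k} → (∀ i → lookup σ i ≡ lookup τ i) → σ ≡ τ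
subset-ext {σ = σ} {τ} h = trans (sym (tabulate∘lookup σ)) (trans (tabulate-cong h) (tabulate∘lookup τ))

count-inj-on : ∀ {a b} (f : Fin a → Bool) (g : Fin b → Bool) (h : Fin a → Fin b) →
  (∀ x y → f x ≡ true → f y ≡ true → h x ≡ h y → x ≡ y) → (∀ x → f x ≡ true → g (h x) ≡ true) →
  count a f ≤ count b g
count-inj-on f g h inj im = ≤-trans (≤-reflexive (sym (count-all (λ i → im (E.r i) (E.r-true i)))))
  (count-inj (h ∘ E.r) (λ {i} {j} q → E.r-inj (inj (E.r i) (E.r j) (E.r-true i) (E.r-true j) q)) g)
  where module E = Enumeration (enumerate f)

Unique-lookup : ∀ {A : Set} {xs : List A} → Unique xs → ∀ i j → List.lookup xs i ≡ List.lookup xs j → i ≡ j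
Unique-lookup (a ∷ u) zero    zero    q = refl
Unique-lookup (a ∷ u) zero    (suc j) q = ⊥-elim (All.lookup a (∈-lookup j) q)
Unique-lookup (a ∷ u) (suc i) zero    q = ⊥-elim (All.lookup a (∈-lookup i) (sym q))
Unique-lookup (a ∷ u) (suc i) (suc j) q = cong suc (Unique-lookup u i j q)

length-product : ∀ {A B C : Set} (f : A → B → C) xs ys → length (cartesianProductWith f xs ys) ≡ length xs * length ys
length-product f [] ys = refl
length-product f (x ∷ xs) ys = trans (length-++ (map (f x) ys)) (cong₂ _+_ (length-map (f x) ys) (length-product f xs ys))

fin-pos : ∀ {k} → Fin k → 0 < k
fin-pos {suc k} _ = s≤s z≤n

Reach-trans : ∀ {k} {R : Fin k → Fin k → Bool} {u v w} → Reach R u v → Reach R v w → Reach R u w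
Reach-trans p here       = p
Reach-trans p (step q e) = step (Reach-trans p q) e

module Covering (X : Complex) (Tr : SpanningTree X) {m : ℕ} (ψ : Perms (gens (π₁Pres X Tr)) m)
                (action : IsAction (π₁Pres X Tr) ψ) where
  open EdgePath X Tr

  -- Words act from the right end, so `c u v` carries sheets over `v` to sheets over `u`.
  c : V → V → Fin m → Fin m
  c u v x = ψ (combine u v) ⟨$⟩ʳ x

  c-flip : ∀ u v x → c u v (c v u x) ≡ x
  c-flip u v x = action _ (view-rel (invert u v)) x

  c-refl : ∀ u x → c u u x ≡ x
  c-refl u x = act-≈ Γ action (e-null (refl-null u)) x

  c-tree : ∀ {u v} → inTree u v ≡ true → ∀ x → c u v x ≡ x
  c-tree q x = act-≈ Γ action (e-tree q) x

  c-comp : ∀ {u v w} → Face u v w → ∀ x → c u v (c v w x) ≡ c u w x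
  c-comp {u} {v} {w} F x = trans (cong (c u v ∘ c v w) (sym (c-flip w u x))) (action _ (view-rel (triangle F)) (c u w x))

  nY : ℕ
  nY = m * n X

  vtx : Fin m → V → Fin nY
  vtx x v = combine x v

  sheet : Fin nY → Fin m
  sheet y = proj₁ (remQuot {m} (n X) y)

  p : Fin nY → V
  p y = proj₂ (remQuot {m} (n X) y)

  sheet-vtx : ∀ x v → sheet (vtx x v) ≡ x
  sheet-vtx x v = cong proj₁ (remQuot-combine x v)

  p-vtx : ∀ x v → p (vtx x v) ≡ v
  p-vtx x v = cong proj₂ (remQuot-combine {m} x v)

  vtx-eta : ∀ y → vtx (sheet y) (p y) ≡ y
  vtx-eta y = combine-remQuot {m} (n X) y

  vtx-ext : ∀ {y y'} → sheet y ≡ sheet y' → p y ≡ p y' → y ≡ y'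
  vtx-ext {y} {y'} q r = trans (sym (vtx-eta y)) (trans (cong₂ vtx q r) (vtx-eta y'))

  facet : Fin (length (facets X)) → Subset (n X)
  facet i = List.lookup (facets X) i

  facet∈ : ∀ i → facet i ∈ facets X
  facet∈ i = ∈-lookup i

  private
    facet-vertex : ∀ i → ∃[ v ] lookup (facet i) v ≡ true
    facet-vertex i = count-witness (lookup (facet i)) (≤-trans (s≤s z≤n) (≤-reflexive (sym (All.lookup (facetSize X) (facet∈ i)))))

  base : Fin (length (facets X)) → V
  base i = proj₁ (facet-vertex i)

  base∈ : ∀ i → lookup (facet i) (base i) ≡ true
  base∈ i = proj₂ (facet-vertex i)

  -- `x` is the sheet of the base vertex. The triangle relators make the transported sheets of the
  -- other vertices consistent along every edge of the facet.
  lift : Fin (length (facets X)) → Fin m → Subset nY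
  lift i x = tabulate (λ y → lookup (facet i) (p y) ∧ (sheet y == c (p y) (base i) x))

  lift-elim : ∀ i x y → lookup (lift i x) y ≡ true → lookup (facet i) (p y) ≡ true × sheet y ≡ c (p y) (base i) x
  lift-elim i x y q = let a , b = ∧-true (trans (sym (lookup∘tabulate _ y)) q) in a , ==⇒≡ b

  lift-intro : ∀ i x y → lookup (facet i) (p y) ≡ true → sheet y ≡ c (p y) (base i) x → lookup (lift i x) y ≡ true
  lift-intro i x y a b = trans (lookup∘tabulate _ y) (trans (cong (_∧ (sheet y == c (p y) (base i) x)) a)
    (trans (cong (_== c (p y) (base i) x) b) (==-refl (c (p y) (base i) x))))

  lift-vtx : ∀ i x v → lookup (facet i) v ≡ true → lookup (lift i x) (vtx (c v (base i) x) v) ≡ true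
  lift-vtx i x v q = lift-intro i x (vtx (c v (base i) x) v) (trans (cong (lookup (facet i)) (p-vtx _ v)) q)
    (trans (sheet-vtx _ v) (cong (λ t → c t (base i) x) (sym (p-vtx (c v (base i) x) v))))

  lift-through : ∀ i y → lookup (facet i) (p y) ≡ true → lookup (lift i (c (base i) (p y) (sheet y))) y ≡ true
  lift-through i y q = lift-intro i _ y q (sym (c-flip (p y) (base i) (sheet y)))

  -- By `c-comp` any vertex of a lifted facet can replace the base vertex.
  lift-sheets : ∀ i x y y' → lookup (lift i x) y ≡ true → lookup (lift i x) y' ≡ true → sheet y' ≡ c (p y') (p y) (sheet y)
  lift-sheets i x y y' h h' with lift-elim i x y h | lift-elim i x y' h'
  ... | a , b | a' , b' = trans b' (trans (sym (c-comp (facet i , facet∈ i , a' , a , base∈ i) x)) (cong (c (p y') (p y)) (sym b)))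

  lift-base : ∀ i x y → lookup (lift i x) y ≡ true → x ≡ c (base i) (p y) (sheet y)
  lift-base i x y h = trans (sym (c-flip (base i) (p y) x)) (cong (c (base i) (p y)) (sym (proj₂ (lift-elim i x y h))))

  lift-facet : ∀ i x → img p (lift i x) ≡ facet i
  lift-facet i x = subset-ext λ v → trans (lookup∘tabulate _ v) (bool-iff (to v) (from v))
    where
    hit : V → Fin nY → Bool
    hit v y = lookup (lift i x) y ∧ (p y == v)
    to : ∀ v → anyFin nY (hit v) ≡ true → lookup (facet i) v ≡ true
    to v q = let y , r = anyFin-elim {f = hit v} q ; r₁ , r₂ = ∧-true r in
      subst (λ t → lookup (facet i) t ≡ true) (==⇒≡ r₂) (proj₁ (lift-elim i x y r₁))
    from : ∀ v → lookup (facet i) v ≡ true → anyFin nY (hit v) ≡ true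
    from v q = anyFin-intro {f = hit v} (vtx (c v (base i) x) v)
      (trans (cong (_∧ (p (vtx (c v (base i) x) v) == v)) (lift-vtx i x v q))
             (trans (cong (_== v) (p-vtx (c v (base i) x) v)) (==-refl v)))

  lift-inj : ∀ {i i' x x'} → lift i x ≡ lift i' x' → i ≡ i' × x ≡ x'
  lift-inj {i} {i'} {x} {x'} q = same-i , trans (lift-base i x y y∈) (trans (cong (λ t → c (base t) (p y) (sheet y)) same-i) (sym (lift-base i' x' y y∈')))
    where
    same-i : i ≡ i'
    same-i = Unique-lookup (distinct X) i i' (trans (sym (lift-facet i x)) (trans (cong (img p) q) (lift-facet i' x')))
    y = vtx (c (base i) (base i) x) (base i)
    y∈ : lookup (lift i x) y ≡ true
    y∈ = lift-vtx i x (base i) (base∈ i)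
    y∈' : lookup (lift i' x') y ≡ true
    y∈' = trans (cong (λ F → lookup F y) (sym q)) y∈

  lift-size : ∀ i x → size (lift i x) ≡ 4
  lift-size i x = trans (≤-antisym
    (count-inj-on (lookup (lift i x)) (lookup (facet i)) p
      (λ y y' h h' q → vtx-ext (trans (proj₂ (lift-elim i x y h)) (trans (cong (λ t → c t (base i) x) q) (sym (proj₂ (lift-elim i x y' h'))))) q)
      (λ y h → proj₁ (lift-elim i x y h)))
    (count-inj-on (lookup (facet i)) (lookup (lift i x)) (λ v → vtx (c v (base i) x) v)
      (λ v v' _ _ q → trans (sym (p-vtx (c v (base i) x) v)) (trans (cong p q) (p-vtx (c v' (base i) x) v')))
      (λ v → lift-vtx i x v)))
    (All.lookup (facetSize X) (facet∈ i))

  facetsY : List (Subset nY)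
  facetsY = cartesianProductWith lift (allFin (length (facets X))) (allFin m)

  facetsY-elim : ∀ {F} → F ∈ facetsY → ∃[ i ] ∃[ x ] F ≡ lift i x
  facetsY-elim F∈ = let i , x , _ , _ , q = ∈-cartesianProductWith⁻ lift (allFin (length (facets X))) (allFin m) F∈ in i , x , q

  facetsY-intro : ∀ i x → lift i x ∈ facetsY
  facetsY-intro i x = ∈-cartesianProductWith⁺ lift (∈-allFin i) (∈-allFin x)

  facetsY-length : length facetsY ≡ length (facets X) * m
  facetsY-length = trans (length-product lift (allFin (length (facets X))) (allFin m))
    (cong₂ _*_ (length-tabulate {n = length (facets X)} id) (length-tabulate {n = m} id))

  index-of : ∀ {G} → G ∈ facets X → ∃[ i ] facet i ≡ G
  index-of G∈ = Any.index G∈ , sym (lookup-index G∈)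

  Y : Fin m → Complex
  Y x₀ = record
    { n = nY
    ; facets = facetsY
    ; facetSize = All.tabulate (λ F∈ → let i , x , q = facetsY-elim F∈ in trans (cong size q) (lift-size i x))
    ; distinct = cartesianProductWith⁺ lift lift-inj (allFin⁺ _) (allFin⁺ _)
    ; nonempty = ≤-trans (*-mono-≤ (nonempty X) (fin-pos x₀)) (≤-reflexive (sym facetsY-length))
    ; vertices = λ y → ≡⇒T (vertices-Y y)
    }
    where
    vertices-Y : ∀ y → anyL (λ F → lookup F y) facetsY ≡ true
    vertices-Y y = let G , G∈ , q = anyL-elim (λ F → lookup F (p y)) (facets X) (T⇒≡ (vertices X (p y)))
                       i , r = index-of G∈
      in anyL-intro (λ F → lookup F y) (facetsY-intro i (c (base i) (p y) (sheet y)))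
           (lift-through i y (trans (cong (λ G → lookup G (p y)) r) q))

  module _ (transitive : ∀ i j → ∃[ u ] act ψ u i ≡ j) (x₀ : Fin m) where
    private
      Y₀ = Y x₀

      edgeY : ∀ {y y'} i x → lookup (lift i x) y ≡ true → lookup (lift i x) y' ≡ true → y ≢ y' → T (isEdge Y₀ y y')
      edgeY {y} {y'} i x h h' y≢y' = ≡⇒T (cong₂ _∧_ (cong not (≢⇒== y≢y')) (anyL-intro (subB (pair y y')) (facetsY-intro i x)
        (subB-intro (pair y y') (lift i x) λ k q →
        [ (λ r → subst (λ k → lookup (lift i x) k ≡ true) (sym (==⇒≡ r)) h) ,
          (λ r → subst (λ k → lookup (lift i x) k ≡ true) (sym (==⇒≡ r)) h') ]′ (∨-elim (trans (sym (lookup∘tabulate _ k)) q)))))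

      edge-lift : ∀ {u v} → isEdge X u v ≡ true → ∀ x → T (isEdge Y₀ (vtx x v) (vtx (c u v x) u))
      edge-lift {u} {v} q x with edge-facet q
      ... | G , G∈ , hu , hv with index-of G∈
      ...   | i , refl = edgeY i x' at-v at-u (λ r → u≢v (trans (sym (p-vtx (c u v x) u)) (trans (cong p (sym r)) (p-vtx x v))))
        where
        x' = c (base i) v x
        u≢v : u ≢ v
        u≢v r = ==false⇒≢ (not≡true (proj₁ (∧-true {not (u == v)} q))) r
        at-v : lookup (lift i x') (vtx x v) ≡ true
        at-v = subst (λ t → lookup (lift i x') (vtx t v) ≡ true) (c-flip v (base i) x) (lift-vtx i x' v hv)
        at-u : lookup (lift i x') (vtx (c u v x) u) ≡ true
        at-u = subst (λ t → lookup (lift i x') (vtx t u) ≡ true) (c-comp (facet i , facet∈ i , hu , base∈ i , hv) x) (lift-vtx i x' u hu)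

      tree-edge : ∀ {u v} → inTree u v ≡ true → isEdge X u v ≡ true
      tree-edge {u} {v} q = [ (λ h → T⇒≡ (proj₂ (All.lookup (valid Tr) h))) ,
                              (λ h → trans (isEdge-sym u v) (T⇒≡ (proj₂ (All.lookup (valid Tr) h)))) ]′ (inTree-elim q)

      -- Tree generators act trivially, so the spanning tree lifts to every sheet.
      in-sheet : ∀ x u v → Reach (isEdge Y₀) (vtx x u) (vtx x v)
      in-sheet x u v = go (spans Tr u v)
        where
        go : ∀ {v} → Reach inTree u v → Reach (isEdge Y₀) (vtx x u) (vtx x v)
        go here = here
        go (step {v = a} {w = b} r q) = step (go r)
          (subst (λ t → T (isEdge Y₀ (vtx x a) (vtx t b))) (c-tree q' x) (edge-lift (tree-edge q') x))
          where
          q' : inTree b a ≡ true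
          q' = trans (inTree-sym b a) (T⇒≡ q)

      by-gen : ∀ u v x a b → Reach (isEdge Y₀) (vtx x a) (vtx (c u v x) b)
      by-gen u v x a b = by-edge (isEdge X u v ≟B true)
        where
        by-edge : Dec (isEdge X u v ≡ true) → Reach (isEdge Y₀) (vtx x a) (vtx (c u v x) b)
        by-edge (yes q) = Reach-trans (step (in-sheet x a v) (edge-lift q x)) (in-sheet (c u v x) u b)
        by-edge (no ¬q) = subst (λ t → Reach (isEdge Y₀) (vtx x a) (vtx t b)) (sym (act-≈ Γ action (e-null (nonedge-null (¬-not ¬q))) x)) (in-sheet x a b)

      by-word : ∀ w x a b → Reach (isEdge Y₀) (vtx x a) (vtx (act ψ w x) b)
      by-word [] x a b = in-sheet x a b
      by-word ((s , t) ∷ w) x a b = Reach-trans (by-word w x a a) (letter (combine-remQuot {n X} (n X) s) t (act ψ w x))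
        where
        u = proj₁ (remQuot {n X} (n X) s)
        v = proj₂ (remQuot {n X} (n X) s)
        letter : combine u v ≡ s → ∀ t x → Reach (isEdge Y₀) (vtx x a) (vtx (applyL ψ (s , t) x) b)
        letter q false x = subst (λ t → Reach (isEdge Y₀) (vtx x a) (vtx (ψ t ⟨$⟩ʳ x) b)) q (by-gen u v x a b)
        letter q true  x = subst (λ t → Reach (isEdge Y₀) (vtx x a) (vtx t b))
          (trans (sym (inverseˡ (ψ s))) (cong (ψ s ⟨$⟩ˡ_) (trans (cong (λ t → ψ t ⟨$⟩ʳ c v u x) (sym q)) (c-flip u v x)))) (by-gen v u x a b)

      connected-Y : Connected Y₀
      connected-Y y y' = let w , q = transitive (sheet y) (sheet y') in
        subst₂ (Reach (isEdge Y₀)) (vtx-eta y) (trans (cong (λ t → vtx t (p y')) q) (vtx-eta y')) (by-word w (sheet y) (p y) (p y'))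

    cover : Cover X
    cover = record
      { Y = Y₀
      ; p = p
      ; connected = connected-Y
      ; facetImg = λ F F∈ → let i , x , q = facetsY-elim F∈ in subst (_∈ facets X) (sym (trans (cong (img p) q) (lift-facet i x))) (facet∈ i)
      ; facetInj = λ F F∈ y y' h h' q → let i , x , r = facetsY-elim F∈ in same-sheet i x y y' (at r h) (at r h') q
      ; starInj = star-inj
      ; starLift = star-lift
      }
      where
      at : ∀ {F F' y} → F ≡ F' → T (lookup F y) → lookup F' y ≡ true
      at refl h = T⇒≡ h
      same-sheet : ∀ i x y y' → lookup (lift i x) y ≡ true → lookup (lift i x) y' ≡ true → p y ≡ p y' → y ≡ y'
      same-sheet i x y y' h h' q = vtx-ext (trans (proj₂ (lift-elim i x y h)) (trans (cong (λ t → c t (base i) x) q) (sym (proj₂ (lift-elim i x y' h'))))) q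
      star-inj : ∀ y a b → InStar Y₀ y a → InStar Y₀ y b → p a ≡ p b → a ≡ b
      star-inj y a b (F , F∈ , hy , ha) (F' , F'∈ , hy' , hb) q with facetsY-elim F∈ | facetsY-elim F'∈
      ... | i , x , r | i' , x' , r' = vtx-ext
        (trans (lift-sheets i x y a (at r hy) (at r ha)) (trans (cong (λ t → c t (p y) (sheet y)) q) (sym (lift-sheets i' x' y b (at r' hy') (at r' hb))))) q
      star-lift : ∀ y G → G ∈ facets X → T (lookup G (p y)) →
        Σ (Subset nY) λ F → F ∈ facetsY × T (lookup F y) × img p F ≡ G ×
          (∀ F' → F' ∈ facetsY → T (lookup F' y) → img p F' ≡ G → F' ≡ F)
      star-lift y G G∈ h with index-of G∈
      ... | i , refl = lift i x , facetsY-intro i x , ≡⇒T (lift-through i y (T⇒≡ h)) , lift-facet i x , unique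
        where
        x = c (base i) (p y) (sheet y)
        unique : ∀ F' → F' ∈ facetsY → T (lookup F' y) → img p F' ≡ facet i → F' ≡ lift i x
        unique F' F'∈ h' q with facetsY-elim F'∈
        ... | i' , x' , r with Unique-lookup (distinct X) i' i (trans (sym (lift-facet i' x')) (trans (cong (img p) (sym r)) q))
        ...   | refl = trans r (cong (lift i) (lift-base i x' y (at r h')))

-- Simplices as increasing lists of vertices.

keep : {A : Set} → (A → Bool) → List A → List A
keep p [] = []
keep p (x ∷ xs) = if p x then x ∷ keep p xs else keep p xs

keep-cong : ∀ {A : Set} {p q : A → Bool} → (∀ a → p a ≡ q a) → ∀ xs → keep p xs ≡ keep q xs
keep-cong h [] = refl
keep-cong h (x ∷ xs) = trans (cong (if_then x ∷ keep _ xs else keep _ xs) (h x)) (cong₂ (λ a b → if _ then x ∷ a else b) (keep-cong h xs) (keep-cong h xs))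

keep-∧ : ∀ {A : Set} (p q : A → Bool) xs → keep (λ a → p a ∧ q a) xs ≡ keep q (keep p xs)
keep-∧ p q [] = refl
keep-∧ p q (x ∷ xs) with p x
... | false = keep-∧ p q xs
... | true with q x
...   | true  = cong (x ∷_) (keep-∧ p q xs)
...   | false = keep-∧ p q xs

keep-∈ : ∀ {A : Set} (p : A → Bool) {xs a} → a ∈ keep p xs → p a ≡ true × a ∈ xs
keep-∈ p {x ∷ xs} a∈ with p x in eq
keep-∈ p {x ∷ xs} (here refl) | true  = eq , here refl
keep-∈ p {x ∷ xs} (there a∈)  | true  = let a , b = keep-∈ p {xs} a∈ in a , there b
keep-∈ p {x ∷ xs} a∈          | false = let a , b = keep-∈ p {xs} a∈ in a , there b

∈-keep : ∀ {A : Set} (p : A → Bool) {xs a} → a ∈ xs → p a ≡ true → a ∈ keep p xs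
∈-keep p {x ∷ xs} (here refl) q rewrite q = here refl
∈-keep p {x ∷ xs} (there a∈) q with p x
... | true  = there (∈-keep p a∈ q)
... | false = ∈-keep p a∈ q

keep-unique : ∀ {A : Set} (p : A → Bool) {xs} → Unique xs → Unique (keep p xs)
keep-unique p [] = []
keep-unique p {x ∷ xs} (a ∷ u) with p x
... | true  = All.tabulate (λ y∈ → All.lookup a (proj₂ (keep-∈ p {xs} y∈))) ∷ keep-unique p u
... | false = keep-unique p u

keep-length : ∀ {k} {A : Set} (p : A → Bool) (g : Fin k → A) → length (keep p (List.tabulate g)) ≡ count k (p ∘ g)
keep-length {zero} p g = refl
keep-length {suc k} p g with p (g zero)
... | true  = cong suc (keep-length p (g ∘ suc))
... | false = keep-length p (g ∘ suc)

elems : ∀ {k} → Subset k → List (Fin k)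
elems {k} σ = keep (lookup σ) (allFin k)

elems-length : ∀ {k} (σ : Subset k) → length (elems σ) ≡ size σ
elems-length σ = keep-length (lookup σ) id

elems-unique : ∀ {k} (σ : Subset k) → Unique (elems σ)
elems-unique {k} σ = keep-unique (lookup σ) (allFin⁺ k)

elems-∈ : ∀ {k} (σ : Subset k) {i} → i ∈ elems σ → lookup σ i ≡ true
elems-∈ {k} σ i∈ = proj₁ (keep-∈ (lookup σ) {allFin k} i∈)

∈-elems : ∀ {k} (σ : Subset k) {i} → lookup σ i ≡ true → i ∈ elems σ
∈-elems σ {i} q = ∈-keep (lookup σ) (∈-allFin i) q

elems-remove : ∀ {k} (σ : Subset k) i → elems (σ [ i ]≔ false) ≡ keep (λ j → not (j == i)) (elems σ)
elems-remove {k} σ i = trans (keep-cong at (allFin k)) (keep-∧ (lookup σ) (λ j → not (j == i)) (allFin k))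
  where
  at : ∀ j → lookup (σ [ i ]≔ false) j ≡ lookup σ j ∧ not (j == i)
  at j with j ≟F i
  ... | yes refl = trans (lookup∘update j σ false) (sym (∧-zeroʳ (lookup σ j)))
  ... | no j≢i   = trans (lookup∘update′ j≢i σ false) (sym (∧-identityʳ (lookup σ j)))

δ-elems : ∀ {k} (α : Cochain k) σ → δ α σ ≡ foldr (λ i acc → α (σ [ i ]≔ false) xor acc) false (elems σ)
δ-elems {k} α σ = go (allFin k)
  where
  go : ∀ xs → foldr (λ i acc → (lookup σ i ∧ α (σ [ i ]≔ false)) xor acc) false xs ≡
              foldr (λ i acc → α (σ [ i ]≔ false) xor acc) false (keep (lookup σ) xs)
  go [] = refl
  go (x ∷ xs) with lookup σ x
  ... | true  = cong (α (σ [ x ]≔ false) xor_) (go xs)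
  ... | false = go xs

δ-cong : ∀ {k} {α β : Cochain k} → (∀ σ → α σ ≡ β σ) → ∀ σ → δ α σ ≡ δ β σ
δ-cong {k} {α} {β} h σ = go (allFin k)
  where
  go : ∀ xs → foldr (λ i acc → (lookup σ i ∧ α (σ [ i ]≔ false)) xor acc) false xs ≡
              foldr (λ i acc → (lookup σ i ∧ β (σ [ i ]≔ false)) xor acc) false xs
  go [] = refl
  go (x ∷ xs) = cong₂ _xor_ (cong (lookup σ x ∧_) (h _)) (go xs)

private
  module _ {k : ℕ} (i : Fin k) where
    without : List (Fin k) → List (Fin k)
    without = keep (λ j → not (j == i))

    without-i : ∀ xs → without (i ∷ xs) ≡ without xs
    without-i xs rewrite ==-refl i = refl

    without-≢ : ∀ {j} xs {ys} → j ≢ i → without xs ≡ ys → without (j ∷ xs) ≡ j ∷ ys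
    without-≢ xs q r rewrite ≢⇒== q = cong (_ ∷_) r

module _ {k : ℕ} (σ : Subset k) {a b c : Fin k} (eq : elems σ ≡ a ∷ b ∷ c ∷ []) where
  elems₃-distinct : a ≢ b × a ≢ c × b ≢ c
  elems₃-distinct with subst Unique eq (elems-unique σ)
  ... | (p ∷ q ∷ []) ∷ (r ∷ []) ∷ _ = p , q , r

  private
    p = proj₁ elems₃-distinct
    q = proj₁ (proj₂ elems₃-distinct)
    r = proj₂ (proj₂ elems₃-distinct)

  elems₃-remove : elems (σ [ a ]≔ false) ≡ b ∷ c ∷ [] × elems (σ [ b ]≔ false) ≡ a ∷ c ∷ [] × elems (σ [ c ]≔ false) ≡ a ∷ b ∷ []
  elems₃-remove =
    trans (elems-remove σ a) (trans (cong (without a) eq) (trans (without-i a (b ∷ c ∷ [])) (without-≢ a (c ∷ []) (p ∘ sym) (without-≢ a [] (q ∘ sym) refl)))) ,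
    trans (elems-remove σ b) (trans (cong (without b) eq) (without-≢ b (b ∷ c ∷ []) p (trans (without-i b (c ∷ [])) (without-≢ b [] (r ∘ sym) refl)))) ,
    trans (elems-remove σ c) (trans (cong (without c) eq) (without-≢ c (b ∷ c ∷ []) q (without-≢ c (c ∷ []) r (without-i c []))))

  δ₃ : ∀ α → δ α σ ≡ α (σ [ a ]≔ false) xor (α (σ [ b ]≔ false) xor α (σ [ c ]≔ false))
  δ₃ α = trans (δ-elems α σ) (trans (cong (foldr (λ i acc → α (σ [ i ]≔ false) xor acc) false) eq)
    (cong (λ t → α (σ [ a ]≔ false) xor (α (σ [ b ]≔ false) xor t)) (xor-identityʳ _)))

module _ {k : ℕ} (σ : Subset k) {a b c d : Fin k} (eq : elems σ ≡ a ∷ b ∷ c ∷ d ∷ []) where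
  private
    distinct₄ : (a ≢ b × a ≢ c × a ≢ d) × (b ≢ c × b ≢ d) × c ≢ d
    distinct₄ with subst Unique eq (elems-unique σ)
    ... | (p ∷ q ∷ r ∷ []) ∷ (s ∷ t ∷ []) ∷ (u ∷ []) ∷ _ = (p , q , r) , (s , t) , u

  elems₄-remove : elems (σ [ a ]≔ false) ≡ b ∷ c ∷ d ∷ [] × elems (σ [ b ]≔ false) ≡ a ∷ c ∷ d ∷ [] ×
                  elems (σ [ c ]≔ false) ≡ a ∷ b ∷ d ∷ [] × elems (σ [ d ]≔ false) ≡ a ∷ b ∷ c ∷ []
  elems₄-remove = let (p , q , r) , (s , t) , u = distinct₄ in
    trans (elems-remove σ a) (trans (cong (without a) eq) (trans (without-i a (b ∷ c ∷ d ∷ [])) (without-≢ a (c ∷ d ∷ []) (p ∘ sym) (without-≢ a (d ∷ []) (q ∘ sym) (without-≢ a [] (r ∘ sym) refl))))) ,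
    trans (elems-remove σ b) (trans (cong (without b) eq) (without-≢ b (b ∷ c ∷ d ∷ []) p (trans (without-i b (c ∷ d ∷ [])) (without-≢ b (d ∷ []) (s ∘ sym) (without-≢ b [] (t ∘ sym) refl))))) ,
    trans (elems-remove σ c) (trans (cong (without c) eq) (without-≢ c (b ∷ c ∷ d ∷ []) q (without-≢ c (c ∷ d ∷ []) s (trans (without-i c (d ∷ [])) (without-≢ c [] (u ∘ sym) refl))))) ,
    trans (elems-remove σ d) (trans (cong (without d) eq) (without-≢ d (b ∷ c ∷ d ∷ []) r (without-≢ d (c ∷ d ∷ []) t (without-≢ d (d ∷ []) u (without-i d [])))))

  δ₄ : ∀ α → δ α σ ≡ α (σ [ a ]≔ false) xor (α (σ [ b ]≔ false) xor (α (σ [ c ]≔ false) xor α (σ [ d ]≔ false)))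
  δ₄ α = trans (δ-elems α σ) (trans (cong (foldr (λ i acc → α (σ [ i ]≔ false) xor acc) false) eq)
    (cong (λ t → α (σ [ a ]≔ false) xor (α (σ [ b ]≔ false) xor (α (σ [ c ]≔ false) xor t))) (xor-identityʳ _)))

length₃ : ∀ {A : Set} (xs : List A) → length xs ≡ 3 → ∃[ a ] ∃[ b ] ∃[ c ] xs ≡ a ∷ b ∷ c ∷ []
length₃ (a ∷ b ∷ c ∷ []) _ = a , b , c , refl

length₄ : ∀ {A : Set} (xs : List A) → length xs ≡ 4 → ∃[ a ] ∃[ b ] ∃[ c ] ∃[ d ] xs ≡ a ∷ b ∷ c ∷ d ∷ []
length₄ (a ∷ b ∷ c ∷ d ∷ []) _ = a , b , c , d , refl

elems-pair : ∀ {k} (σ : Subset k) {a b} → elems σ ≡ a ∷ b ∷ [] → σ ≡ pair a b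
elems-pair σ {a} {b} eq = subset-ext λ i → trans (bool-iff (to i) (from i)) (sym (lookup∘tabulate _ i))
  where
  to : ∀ i → lookup σ i ≡ true → (i == a) ∨ (i == b) ≡ true
  to i q with subst (i ∈_) eq (∈-elems σ q)
  ... | here refl rewrite ==-refl i = refl
  ... | there (here refl) rewrite ==-refl i = ∨-zeroʳ (i == a)
  from : ∀ i → (i == a) ∨ (i == b) ≡ true → lookup σ i ≡ true
  from i q = elems-∈ σ (subst (i ∈_) (sym eq) ([ (λ r → here (==⇒≡ r)) , (λ r → there (here (==⇒≡ r))) ]′ (∨-elim q)))

-- Deciding whether a cochain is a coboundary.

all-subsets? : ∀ k {Q : Subset k → Set} → (∀ σ → Dec (Q σ)) → Dec (∀ σ → Q σ)
all-subsets? zero Q? = map′ (λ { q [] → q }) (λ h → h []) (Q? [])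
all-subsets? (suc k) Q? with all-subsets? k (λ σ → Q? (true ∷ σ)) | all-subsets? k (λ σ → Q? (false ∷ σ))
... | yes p | yes q = yes λ { (true ∷ σ) → p σ ; (false ∷ σ) → q σ }
... | no ¬p | _     = no λ h → ¬p (λ σ → h (true ∷ σ))
... | yes _ | no ¬q = no λ h → ¬q (λ σ → h (false ∷ σ))

-- Up to pointwise equality a cochain is finitely many bits; without function extensionality the
-- property has to respect that equality.
any-cochain? : ∀ k {P : Cochain k → Set} → (∀ f → Dec (P f)) → (∀ {f g} → (∀ σ → f σ ≡ g σ) → P f → P g) → Dec (∃ P)
any-cochain? zero P? ext with P? (λ _ → true) | P? (λ _ → false)
... | yes p | _     = yes (_ , p)
... | no _  | yes q = yes (_ , q)
... | no ¬p | no ¬q = no λ { (f , h) → by-value f h (f []) refl }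
  where
  by-value : ∀ f → _ → ∀ b → f [] ≡ b → ⊥
  by-value f h true  e = ¬p (ext (λ { [] → e }) h)
  by-value f h false e = ¬q (ext (λ { [] → e }) h)
any-cochain? (suc k) {P} P? ext = map′ (λ (f , g , h) → join f g , h)
    (λ (f , h) → (λ σ → f (true ∷ σ)) , (λ σ → f (false ∷ σ)) , ext (λ { (true ∷ σ) → refl ; (false ∷ σ) → refl }) h)
    (any-cochain? k (λ f → any-cochain? k (λ g → P? (join f g)) (λ q → ext (λ { (true ∷ σ) → refl ; (false ∷ σ) → q σ })))
      (λ q (g , h) → g , ext (λ { (true ∷ σ) → q σ ; (false ∷ σ) → refl }) h))
  where
  join : Cochain k → Cochain k → Cochain (suc k)
  join f g (true  ∷ σ) = f σ
  join f g (false ∷ σ) = g σ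

-- `LargeCosystoles` can only refute that a nearby cocycle fails to be a coboundary; decidability
-- turns this into an actual primitive.
Coboundary? : ∀ Y s α → Dec (Coboundary Y s α)
Coboundary? Y s α = any-cochain? (n Y)
  (λ β → all-subsets? (n Y) (λ σ → T-dec (inY Y σ) →-dec ((size σ ≟ s) →-dec (α σ ≟B δ β σ))))
  (λ q h σ a b → trans (h σ a b) (δ-cong q σ))
  where
  T-dec : ∀ b → Dec (T b)
  T-dec true  = yes _
  T-dec false = no λ ()

-- Counting in lists and products.

countL-++ : ∀ {A : Set} (p : A → Bool) xs ys → countL p (xs ++ ys) ≡ countL p xs + countL p ys
countL-++ p [] ys = refl
countL-++ p (x ∷ xs) ys = trans (cong ((if p x then 1 else 0) +_) (countL-++ p xs ys)) (sym (+-assoc (if p x then 1 else 0) _ _))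

countL-map : ∀ {A B : Set} (p : B → Bool) (f : A → B) xs → countL p (map f xs) ≡ countL (p ∘ f) xs
countL-map p f [] = refl
countL-map p f (x ∷ xs) = cong ((if p (f x) then 1 else 0) +_) (countL-map p f xs)

countL-tabulate : ∀ {k} {A : Set} (p : A → Bool) (g : Fin k → A) → countL p (List.tabulate g) ≡ count k (p ∘ g)
countL-tabulate {zero}  p g = refl
countL-tabulate {suc k} p g = cong ((if p (g zero) then 1 else 0) +_) (countL-tabulate p (g ∘ suc))

countL-mono : ∀ {A : Set} {p q : A → Bool} → (∀ a → p a ≡ true → q a ≡ true) → ∀ xs → countL p xs ≤ countL q xs
countL-mono h [] = z≤n
countL-mono {p = p} {q} h (x ∷ xs) with p x | q x | h x
... | true  | true  | _ = s≤s (countL-mono h xs)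
... | true  | false | k = case k refl of λ ()
... | false | true  | _ = m≤n⇒m≤1+n (countL-mono h xs)
... | false | false | _ = countL-mono h xs

countL-product : ∀ {A B C : Set} (p : C → Bool) (f : A → B → C) xs ys k → (∀ x → countL (λ y → p (f x y)) ys ≤ k) →
  countL p (cartesianProductWith f xs ys) ≤ length xs * k
countL-product p f [] ys k h = z≤n
countL-product p f (x ∷ xs) ys k h = ≤-trans (≤-reflexive (countL-++ p (map (f x) ys) _))
  (+-mono-≤ (≤-trans (≤-reflexive (countL-map p (f x) ys)) (h x)) (countL-product p f xs ys k h))

count-≤1 : ∀ {k} (f : Fin k → Bool) a → (∀ i → f i ≡ true → i ≡ a) → count k f ≤ 1
count-≤1 {k} f a h = ≤-trans (count-mono (λ i q → trans (cong (_== a) (h i q)) (==-refl a)))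
  (≤-reflexive (trans (count-point (_== a) a (==-refl a)) (cong suc (count-none (λ i → ∧-inverseʳ (i == a))))))

countL-inj : ∀ {A : Set} {k} (p : A → Bool) (g : Fin k → Bool) (h : A → Fin k) →
  (∀ x y → p x ≡ true → p y ≡ true → h x ≡ h y → x ≡ y) → ∀ {xs} → Unique xs →
  (∀ x → x ∈ xs → p x ≡ true → g (h x) ≡ true) → countL p xs ≤ count k g
countL-inj p g h inj [] im = z≤n
countL-inj p g h inj {x ∷ xs} (a ∷ u) im with p x in px
... | false = countL-inj p g h inj u (λ y y∈ → im y (there y∈))
... | true  = ≤-trans (s≤s (countL-inj p (λ i → g i ∧ not (i == h x)) h inj u
      (λ y y∈ py → cong₂ _∧_ (im y (there y∈) py) (cong not (≢⇒== (λ q → All.lookup a y∈ (inj x y px py (sym q))))))))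
      (≤-reflexive (sym (count-point g (h x) (im x (here refl) px))))

count-product : ∀ m k (f : Fin m → Bool) → count (m * k) (λ y → f (proj₁ (remQuot {m} k y))) ≡ count m f * k
count-product zero k f = refl
count-product (suc m) k f = trans (count-+ k (m * k) _) (trans (cong₂ _+_ first rest) (split (f zero)))
  where
  first : count k (λ i → f (proj₁ (remQuot {suc m} k (i ↑ˡ (m * k))))) ≡ (if f zero then k else 0)
  first = trans (count-cong {k} (λ i → cong (f ∘ proj₁) (remQuot-combine {suc m} {k} zero i))) (const-count (f zero))
    where
    const-count : ∀ b → count k (λ _ → b) ≡ (if b then k else 0)
    const-count true  = count-all {k} (λ _ → refl)
    const-count false = count-none {k} (λ _ → refl)
  rest : count (m * k) (λ i → f (proj₁ (remQuot {suc m} k (k ↑ʳ i)))) ≡ count m (f ∘ suc) * k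
  rest = trans (count-cong shift) (count-product m k (f ∘ suc))
    where
    shift : ∀ i → f (proj₁ (remQuot {suc m} k (k ↑ʳ i))) ≡ f (suc (proj₁ (remQuot {m} k i)))
    shift i = cong (f ∘ proj₁) (trans (cong (λ t → remQuot {suc m} k (k ↑ʳ t)) (sym (combine-remQuot {m} k i)))
      (remQuot-combine {suc m} (suc (proj₁ (remQuot {m} k i))) (proj₂ (remQuot {m} k i))))
  split : ∀ b → (if b then k else 0) + count m (f ∘ suc) * k ≡ ((if b then 1 else 0) + count m (f ∘ suc)) * k
  split true  = refl
  split false = refl

allSubsets-unique : ∀ k → Unique (allSubsets k)
allSubsets-unique zero = [] ∷ []
allSubsets-unique (suc k) = ++⁺ (map⁺ (λ { refl → refl }) (allSubsets-unique k)) (map⁺ (λ { refl → refl }) (allSubsets-unique k))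
  (λ { (p , q) → case ∈-map⁻ _ p of λ { (_ , _ , refl) → case ∈-map⁻ _ q of λ { (_ , _ , ()) } } })

-- Potentials on a spanning tree.

injective⇒onto : ∀ {k} (f : Fin k → Fin k) → (∀ {i j} → f i ≡ f j → i ≡ j) → ∀ t → ∃[ i ] f i ≡ t
injective⇒onto {k} f inj t with any? (λ i → f i ≟F t)
... | yes p = p
... | no ¬p = ⊥-elim (1+n≰n (≤-trans (≤-reflexive (sym (count-point (λ _ → true) t refl)))
    (≤-trans (≤-reflexive (count-all {k} {λ _ → true} (λ _ → refl)))
    (≤-trans (≤-reflexive (sym (count-all (λ i → cong not (≢⇒== (λ q → ¬p (i , q))))))) (count-inj f inj (λ i → not (i == t)))))))

funToFin-cong : ∀ {k l} {f g : Fin k → Fin l} → (∀ i → f i ≡ g i) → funToFin f ≡ funToFin g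
funToFin-cong {zero}  h = refl
funToFin-cong {suc k} h = cong₂ combine (h zero) (funToFin-cong (h ∘ suc))

private
  bit : Fin 2 → Bool
  bit zero    = false
  bit (suc _) = true

  unbit : Bool → Fin 2
  unbit false = zero
  unbit true  = suc zero

  bit-unbit : ∀ b → bit (unbit b) ≡ b
  bit-unbit true  = refl
  bit-unbit false = refl

  bit-inj : ∀ {i j} → bit i ≡ bit j → i ≡ j
  bit-inj {zero}     {zero}     q = refl
  bit-inj {suc zero} {suc zero} q = refl

TreeEdge : ∀ {N} → List (Fin N × Fin N) → Fin N → Fin N → Bool
TreeEdge es a b = anyL (λ e → ((proj₁ e == a) ∧ (proj₂ e == b)) ∨ ((proj₁ e == b) ∧ (proj₂ e == a))) es

-- A connected graph with one edge less than vertices is acyclic: the coboundary from functions vanishing at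
-- a vertex to functions on edges is injective, hence bijective by counting.
tree-potential : ∀ {N} (es : List (Fin N × Fin N)) → length es ≡ N ∸ 1 → (∀ u v → Reach (TreeEdge es) u v) →
  (val : Fin N → Fin N → Bool) → Σ (Fin N → Bool) λ h → ∀ {a b} → (a , b) ∈ es → h a xor h b ≡ val a b
tree-potential {zero} es len spans val = (λ ()) , λ {a} → case a of λ ()
tree-potential {suc k} es len spans val = h i₀ , λ {a} {b} e∈ → begin
    h i₀ a xor h i₀ b               ≡⟨ at-edge (h i₀) e∈ ⟩
    δe (h i₀) (pos-of e∈)           ≡⟨ sym (bit-unbit _) ⟩
    bit (unbit (δe (h i₀) (pos-of e∈))) ≡⟨ cong bit (sym (finToFun-funToFin (λ i → unbit (δe (h i₀) i)) (pos-of e∈))) ⟩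
    bit (finToFun (D i₀) (pos-of e∈)) ≡⟨ cong (λ t → bit (finToFun t (pos-of e∈))) (proj₂ found) ⟩
    bit (finToFun target (pos-of e∈)) ≡⟨ cong bit (finToFun-funToFin (λ i → unbit (vale i)) (pos-of e∈)) ⟩
    bit (unbit (vale (pos-of e∈)))  ≡⟨ bit-unbit _ ⟩
    vale (pos-of e∈)                ≡⟨ cong (λ t → val (proj₁ t) (proj₂ t)) (edge-pos e∈) ⟩
    val a b                         ∎
  where
  open ≡-Reasoning
  edge : Fin k → Fin (suc k) × Fin (suc k)
  edge i = List.lookup es (cast (sym len) i)
  pos-of : ∀ {e} → e ∈ es → Fin k
  pos-of e∈ = cast len (Any.index e∈)
  edge-pos : ∀ {e} (e∈ : e ∈ es) → edge (pos-of e∈) ≡ e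
  edge-pos e∈ = trans (cong (List.lookup es) (cast-back (Any.index e∈))) (sym (lookup-index e∈))
    where
    cast-back : ∀ i → cast (sym len) (cast len i) ≡ i
    cast-back i = trans (cast-trans len (sym len) i) (cast-is-id refl i)
  δe : (Fin (suc k) → Bool) → Fin k → Bool
  δe f i = f (proj₁ (edge i)) xor f (proj₂ (edge i))
  vale : Fin k → Bool
  vale i = val (proj₁ (edge i)) (proj₂ (edge i))
  at-edge : ∀ f {a b} (e∈ : (a , b) ∈ es) → f a xor f b ≡ δe f (pos-of e∈)
  at-edge f e∈ = cong (λ t → f (proj₁ t) xor f (proj₂ t)) (sym (edge-pos e∈))
  h : Fin (2 ^ k) → Fin (suc k) → Bool
  h i zero    = false
  h i (suc v) = bit (finToFun {2} {k} i v)
  D : Fin (2 ^ k) → Fin (2 ^ k)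
  D i = funToFin (λ e → unbit (δe (h i) e))
  transfer : ∀ {x y x' y'} → x xor y ≡ x' xor y' → x ≡ x' → y ≡ y'
  transfer {x} q refl = xor-cancelˡ x q
  D-inj : ∀ {i j} → D i ≡ D j → i ≡ j
  D-inj {i} {j} q = trans (sym (funToFin-finToFin {k} {2} i)) (trans (funToFin-cong (λ v → bit-inj (along (suc v)))) (funToFin-finToFin {k} {2} j))
    where
    same : ∀ e → δe (h i) e ≡ δe (h j) e
    same e = trans (sym (bit-unbit _)) (trans (cong bit (trans (sym (finToFun-funToFin (λ e → unbit (δe (h i) e)) e))
      (trans (cong (λ t → finToFun t e) q) (finToFun-funToFin (λ e → unbit (δe (h j) e)) e)))) (bit-unbit _))
    on-edge : ∀ {a b} → (a , b) ∈ es → h i a xor h i b ≡ h j a xor h j b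
    on-edge e∈ = trans (at-edge (h i) e∈) (trans (same _) (sym (at-edge (h j) e∈)))
    along′ : ∀ {v} → Reach (TreeEdge es) zero v → h i v ≡ h j v
    along′ here = refl
    along′ (step {v = a} {w = b} r t) with anyL-elim _ es (T⇒≡ t)
    ... | (a' , b') , e∈ , q' with ∨-elim q'
    ...   | inj₁ q'' with ∧-true q''
    ...     | s , s' = transfer (on-edge (subst₂ (λ a b → (a , b) ∈ es) (==⇒≡ s) (==⇒≡ s') e∈)) (along′ r)
    along′ (step {v = a} {w = b} r t) | (a' , b') , e∈ , q' | inj₂ q'' with ∧-true q''
    ...     | s , s' = transfer (trans (xor-comm (h i a) _) (trans (on-edge (subst₂ (λ a b → (a , b) ∈ es) (==⇒≡ s) (==⇒≡ s') e∈)) (xor-comm (h j b) _))) (along′ r)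
    along : ∀ v → h i v ≡ h j v
    along v = along′ (spans zero v)
  target : Fin (2 ^ k)
  target = funToFin (λ e → unbit (vale e))
  found : ∃[ i ] D i ≡ target
  found = injective⇒onto D D-inj target
  i₀ = proj₁ found

-- Bounding norms and reordering the vertices of a triangle.

ratio-≤′ : ∀ {a b c d} → 0 < b → 0 < d → a * d ≤ c * b → ratio a b ℚ.≤ ratio c d
ratio-≤′ {a} {suc b} {c} {suc d} _ _ h = ratio-≤⁺ {a} {b} {c} {d} h

ratio-<′ : ∀ {a b c d} → 0 < b → 0 < d → a * d < c * b → ratio a b ℚ.< ratio c d
ratio-<′ {a} {suc b} {c} {suc d} _ _ h = ratio-<⁺ {a} {b} {c} {d} h

sum-bound : ∀ {A : Set} (t : A → Bool) (wt : A → ℚ) D → 0 < D → (∀ a → t a ≡ true → wt a ℚ.≤ ratio 1 D) →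
  ∀ xs → sumℚ (map (λ a → if t a then wt a else 0ℚ) xs) ℚ.≤ ratio (countL t xs) D
sum-bound t wt (suc D) _ h [] = ratio-≥0 0 D
sum-bound t wt (suc D) D>0 h (x ∷ xs) = by-value (t x) refl
  where
  by-value : ∀ b → t x ≡ b → (if b then wt x else 0ℚ) ℚ.+ sumℚ (map (λ a → if t a then wt a else 0ℚ) xs) ℚ.≤ ratio ((if b then 1 else 0) + countL t xs) (suc D)
  by-value true  q = ℚ.≤-trans (ℚ.+-mono-≤ (h x q) (sum-bound t wt (suc D) D>0 h xs)) (ℚ.≤-reflexive (sym (ratio-+ 1 (countL t xs) D)))
  by-value false q = ℚ.≤-trans (ℚ.≤-reflexive (ℚ.+-identityˡ _)) (sum-bound t wt (suc D) D>0 h xs)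

elems-inj : ∀ {k} {σ τ : Subset k} → elems σ ≡ elems τ → σ ≡ τ
elems-inj {σ = σ} {τ} q = subset-ext λ i → bool-iff (λ r → elems-∈ τ (subst (i ∈_) q (∈-elems σ r))) (λ r → elems-∈ σ (subst (i ∈_) (sym q) (∈-elems τ r)))

-- Transpositions of neighbours generate all permutations; this carries a symmetric statement from
-- the increasing order of three vertices to any other order.
permute₃ : ∀ {A : Set} (P : A → A → A → Set) → (∀ {a b c} → P a b c → P b a c) → (∀ {a b c} → P a b c → P a c b) →
  ∀ {y₁ y₂ y₃ a b c} → a ≢ b → a ≢ c → b ≢ c →
  a ≡ y₁ ⊎ a ≡ y₂ ⊎ a ≡ y₃ → b ≡ y₁ ⊎ b ≡ y₂ ⊎ b ≡ y₃ → c ≡ y₁ ⊎ c ≡ y₂ ⊎ c ≡ y₃ → P a b c → P y₁ y₂ y₃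
permute₃ P s t ab ac bc (inj₁ refl) (inj₁ refl) _ h = ⊥-elim (ab refl)
permute₃ P s t ab ac bc (inj₂ (inj₁ refl)) (inj₂ (inj₁ refl)) _ h = ⊥-elim (ab refl)
permute₃ P s t ab ac bc (inj₂ (inj₂ refl)) (inj₂ (inj₂ refl)) _ h = ⊥-elim (ab refl)
permute₃ P s t ab ac bc (inj₁ refl) _ (inj₁ refl) h = ⊥-elim (ac refl)
permute₃ P s t ab ac bc (inj₂ (inj₁ refl)) _ (inj₂ (inj₁ refl)) h = ⊥-elim (ac refl)
permute₃ P s t ab ac bc (inj₂ (inj₂ refl)) _ (inj₂ (inj₂ refl)) h = ⊥-elim (ac refl)
permute₃ P s t ab ac bc _ (inj₁ refl) (inj₁ refl) h = ⊥-elim (bc refl)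
permute₃ P s t ab ac bc _ (inj₂ (inj₁ refl)) (inj₂ (inj₁ refl)) h = ⊥-elim (bc refl)
permute₃ P s t ab ac bc _ (inj₂ (inj₂ refl)) (inj₂ (inj₂ refl)) h = ⊥-elim (bc refl)
permute₃ P s t ab ac bc (inj₁ refl) (inj₂ (inj₁ refl)) (inj₂ (inj₂ refl)) h = h
permute₃ P s t ab ac bc (inj₁ refl) (inj₂ (inj₂ refl)) (inj₂ (inj₁ refl)) h = t h
permute₃ P s t ab ac bc (inj₂ (inj₁ refl)) (inj₁ refl) (inj₂ (inj₂ refl)) h = s h
permute₃ P s t ab ac bc (inj₂ (inj₁ refl)) (inj₂ (inj₂ refl)) (inj₁ refl) h = s (t h)
permute₃ P s t ab ac bc (inj₂ (inj₂ refl)) (inj₁ refl) (inj₂ (inj₁ refl)) h = t (s h)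
permute₃ P s t ab ac bc (inj₂ (inj₂ refl)) (inj₂ (inj₁ refl)) (inj₁ refl) h = s (t (s h))

-- Cochains are functions of subsets, so a function of ordered vertices is evaluated on the
-- increasing list; the value on lists of other lengths is arbitrary.
val₂ : {A : Set} → (A → A → Bool) → List A → Bool
val₂ f (a ∷ b ∷ []) = f a b
val₂ f _            = false

val₃ : {A : Set} → (A → A → A → Bool) → List A → Bool
val₃ f (a ∷ b ∷ c ∷ []) = f a b c
val₃ f _                = false

xor-rotate : ∀ a b c → a xor (b xor c) ≡ b xor (c xor a)
xor-rotate a b c = trans (xor-comm a (b xor c)) (xor-assoc b c a)

xor-swap : ∀ a b c → a xor (b xor c) ≡ b xor (a xor c)
xor-swap a b c = trans (sym (xor-assoc a b c)) (trans (cong (_xor c) (xor-comm a b)) (xor-assoc b a c))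

-- The cocycle on the cover and the cosystole bound.

module Cohomology (X : Complex) (Tr : SpanningTree X) {Γ̃ : Presentation} (E : CentralExt (π₁Pres X Tr) Γ̃)
    {m : ℕ} (ψ : Perms (gens (π₁Pres X Tr)) m) (action : IsAction (π₁Pres X Tr) ψ)
    (transitive : ∀ i j → ∃[ u ] act ψ u i ≡ j) (x₀ : Fin m) where
  open Lifting X Tr E
  open Covering X Tr ψ action

  private
    Y₀ : Complex
    Y₀ = Y x₀

  tw-tri : ∀ (α : V → V → Fin m → Bool) u v t x →
    tw ψ (curryΓ α) (tri u v t) x ≡ α u v (c v t (c t u x)) xor (α v t (c t u x) xor α t u x)
  tw-tri α u v t x = cong₂ _xor_ (at u v _) (cong₂ _xor_ (at v t _) (trans (xor-identityʳ _) (at t u x)))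
    where
    at : ∀ u v x → curryΓ α (combine u v) x ≡ α u v x
    at u v x = cong (λ f → f x) (curryΓ-combine α u v)

  inY-lift : ∀ σ → inY Y₀ σ ≡ true → ∃[ i ] ∃[ x ] (∀ k → lookup σ k ≡ true → lookup (lift i x) k ≡ true)
  inY-lift σ q = let F , F∈ , s = anyL-elim (subB σ) facetsY q ; i , x , r = facetsY-elim F∈ in
    i , x , λ k h → trans (cong (λ F → lookup F k) (sym r)) (subB-elim σ F s k h)

  ωY : Cochain nY
  ωY σ = val₃ (λ a b d → ω (p a) (p b) (p d)) (elems σ)

  -- A tetrahedron of the cover projects into a facet of `X`, where `ω-cocycle` applies to its four
  -- vertices in increasing order.
  ωY-cocycle : Cocycle Y₀ 3 ωY
  ωY-cocycle σ σ∈ sz with inY-lift σ (T⇒≡ σ∈) | length₄ (elems σ) (trans (elems-length σ) sz)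
  ... | i , x , sub | a , b , d , e' , eq with elems₄-remove σ eq
  ...   | ra , rb , rd , re = begin
    δ ωY σ ≡⟨ δ₄ σ eq ωY ⟩
    ωY (σ [ a ]≔ false) xor (ωY (σ [ b ]≔ false) xor (ωY (σ [ d ]≔ false) xor ωY (σ [ e' ]≔ false)))
      ≡⟨ cong₂ _xor_ (cong (val₃ W) ra) (cong₂ _xor_ (cong (val₃ W) rb) (cong₂ _xor_ (cong (val₃ W) rd) (cong (val₃ W) re))) ⟩
    W b d e' xor (W a d e' xor (W a b e' xor W a b d)) ≡⟨ sym (xor-assoc (W b d e') _ _) ⟩
    (W b d e' xor W a d e') xor (W a b e' xor W a b d) ≡⟨ xor-interchange (W b d e') (W a d e') (W a b e') (W a b d) ⟩
    (W b d e' xor W a b e') xor (W a d e' xor W a b d) ≡⟨ cong₂ _xor_ (sym cocycle) (xor-comm (W a d e') _) ⟩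
    (W a b d xor W a d e') xor (W a b d xor W a d e') ≡⟨ xor-same (W a b d xor W a d e') ⟩
    false ∎
    where
    open ≡-Reasoning
    W : Fin nY → Fin nY → Fin nY → Bool
    W a b d = ω (p a) (p b) (p d)
    on : ∀ {k} → k ∈ elems σ → lookup (facet i) (p k) ≡ true
    on {k} k∈ = proj₁ (lift-elim i x k (sub k (elems-∈ σ k∈)))
    on' : ∀ {k} → k ∈ (a ∷ b ∷ d ∷ e' ∷ []) → lookup (facet i) (p k) ≡ true
    on' k∈ = on (subst (_ ∈_) (sym eq) k∈)
    cocycle : W a b d xor W a d e' ≡ W b d e' xor W a b e'
    cocycle = ω-cocycle (facet∈ i) (on' (here refl)) (on' (there (here refl))) (on' (there (there (here refl)))) (on' (there (there (there (here refl)))))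

  module _ (α : V → V → Fin m → Bool) (α-flip : ∀ u v y → α u v (c v u y) ≡ α v u y)
           {k : ℕ} (ex : Exc k (λ y → ∀ u v t → Face u v t → tw ψ (curryΓ α) (tri u v t) y ≡ ω u v t)) where
    private
      -- The sign of the edge from `y` to `y'`; on edges of the cover `A-sym` makes it independent
      -- of the direction.
      A : Fin nY → Fin nY → Bool
      A y y' = α (p y') (p y) (sheet y)

      A-sym : ∀ {y y'} → sheet y' ≡ c (p y') (p y) (sheet y) → A y' y ≡ A y y'
      A-sym {y} {y'} q = trans (cong (α (p y) (p y')) q) (α-flip (p y) (p y') (sheet y))

      αY : Cochain nY
      αY σ = val₂ A (elems σ)

      -- In the cover the word runs from `a` through `d` and `b` back to `a`, so its holonomy is the
      -- coboundary of `αY` on this triangle.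
      tri-eq : ∀ i x a b d → lookup (lift i x) a ≡ true → lookup (lift i x) b ≡ true → lookup (lift i x) d ≡ true →
        tw ψ (curryΓ α) (tri (p a) (p b) (p d)) (sheet a) ≡ A b d xor (A a d xor A a b)
      tri-eq i x a b d ha hb hd = begin
        tw ψ (curryΓ α) (tri (p a) (p b) (p d)) (sheet a)    ≡⟨ tw-tri α (p a) (p b) (p d) (sheet a) ⟩
        α (p a) (p b) (c (p b) (p d) (c (p d) (p a) (sheet a))) xor (α (p b) (p d) (c (p d) (p a) (sheet a)) xor A a d)
          ≡⟨ cong (λ s → α (p a) (p b) (c (p b) (p d) s) xor (α (p b) (p d) s xor A a d)) (sym (lift-sheets i x a d ha hd)) ⟩
        α (p a) (p b) (c (p b) (p d) (sheet d)) xor (A d b xor A a d)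
          ≡⟨ cong (λ s → α (p a) (p b) s xor (A d b xor A a d)) (sym (lift-sheets i x d b hd hb)) ⟩
        A b a xor (A d b xor A a d)  ≡⟨ cong₂ (λ s t → s xor (t xor A a d)) (A-sym {a} {b} (lift-sheets i x a b ha hb)) (A-sym {b} {d} (lift-sheets i x b d hb hd)) ⟩
        A a b xor (A b d xor A a d)  ≡⟨ xor-rotate (A a b) (A b d) (A a d) ⟩
        A b d xor (A a d xor A a b)  ∎
        where open ≡-Reasoning

      test : Subset nY → Bool
      test σ = (size σ ≡ᵇ 3) ∧ inY Y₀ σ ∧ (ωY σ xor δ αY σ)

      test-elim : ∀ σ → test σ ≡ true → size σ ≡ 3 × inY Y₀ σ ≡ true × ωY σ xor δ αY σ ≡ true
      test-elim σ q = let a , q' = ∧-true {size σ ≡ᵇ 3} q ; b , d = ∧-true {inY Y₀ σ} q' in ≡ᵇ⇒≡ (size σ) 3 (≡⇒T a) , b , d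

      record Shape (σ : Subset nY) : Set where
        constructor shape
        field
          {a b d} : Fin nY
          eq      : elems σ ≡ a ∷ b ∷ d ∷ []
          i       : Fin (length (facets X))
          x       : Fin m
          ha      : lookup (lift i x) a ≡ true
          hb      : lookup (lift i x) b ≡ true
          hd      : lookup (lift i x) d ≡ true

      shape-of : ∀ σ → size σ ≡ 3 → inY Y₀ σ ≡ true → Shape σ
      shape-of σ sz σ∈ with inY-lift σ σ∈ | length₃ (elems σ) (trans (elems-length σ) sz)
      ... | i , x , sub | a , b , d , eq = shape eq i x (mem (here refl)) (mem (there (here refl))) (mem (there (there (here refl))))
        where
        mem : ∀ {k} → k ∈ (a ∷ b ∷ d ∷ []) → lookup (lift i x) k ≡ true
        mem k∈ = sub _ (elems-∈ σ (subst (_ ∈_) (sym eq) k∈))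

      -- On a sheet without exceptions the holonomy equals `ω`, so a discrepancy on `σ` makes the
      -- sheet of its first vertex exceptional.
      first-bad : ∀ σ → (s : Shape σ) → ωY σ xor δ αY σ ≡ true → bad ex (sheet (Shape.a s)) ≡ true
      first-bad σ (shape {a} {b} {d} eq i x ha hb hd) q = by-value (bad ex (sheet a)) refl
        where
        on : ∀ {k} → lookup (lift i x) k ≡ true → lookup (facet i) (p k) ≡ true
        on {k} h = proj₁ (lift-elim i x k h)
        rm = elems₃-remove σ eq
        δα : δ αY σ ≡ A b d xor (A a d xor A a b)
        δα = trans (δ₃ σ eq αY) (cong₂ _xor_ (cong (val₂ A) (proj₁ rm)) (cong₂ _xor_ (cong (val₂ A) (proj₁ (proj₂ rm))) (cong (val₂ A) (proj₂ (proj₂ rm)))))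
        by-value : ∀ t → bad ex (sheet a) ≡ t → t ≡ true
        by-value true  _ = refl
        by-value false r = trans (sym (xor-same (ωY σ))) (trans (cong (ωY σ xor_) (trans (cong (val₃ (λ a b d → ω (p a) (p b) (p d))) eq)
          (trans (sym (good ex (sheet a) r (p a) (p b) (p d) (facet i , facet∈ i , on ha , on hb , on hd)))
          (trans (tri-eq i x a b d ha hb hd) (sym δα))))) q)

      N = n X
      NN = N * (N * N)

      -- A lifted triangle is determined by its three projected vertices and the sheet of one of
      -- them, so each exceptional sheet accounts for at most `NN` bad triangles.
      code : List (Fin nY) → Fin (m * NN)
      code (a ∷ b ∷ d ∷ []) = combine (sheet a) (combine (p a) (combine (p b) (p d)))
      code _ = combine x₀ (combine v₀ (combine v₀ v₀))
        where v₀ = some-vertex X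

      code-inj : ∀ σ τ → test σ ≡ true → test τ ≡ true → code (elems σ) ≡ code (elems τ) → σ ≡ τ
      code-inj σ τ tσ tτ q with test-elim σ tσ | test-elim τ tτ
      ... | sσ , iσ , _ | sτ , iτ , _ with shape-of σ sσ iσ | shape-of τ sτ iτ
      ...   | shape {a} {b} {d} eq i x ha hb hd | shape {a'} {b'} {d'} eq' i' x' ha' hb' hd' =
        elems-inj (trans eq (trans (cong₂ _∷_ ea (cong₂ _∷_ eb (cong (_∷ []) ed))) (sym eq')))
        where
        q' : combine (sheet a) (combine (p a) (combine (p b) (p d))) ≡ combine (sheet a') (combine (p a') (combine (p b') (p d')))
        q' = trans (cong code (sym eq)) (trans q (cong code eq'))
        q₁ = combine-injective {m} {NN} (sheet a) _ (sheet a') _ q'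
        q₂ = combine-injective {N} {N * N} (p a) _ (p a') _ (proj₂ q₁)
        q₃ = combine-injective {N} {N} (p b) (p d) (p b') (p d') (proj₂ q₂)
        ea : a ≡ a'
        ea = vtx-ext (proj₁ q₁) (proj₁ q₂)
        eb : b ≡ b'
        eb = vtx-ext (trans (lift-sheets i x a b ha hb) (trans (cong₂ (λ s t → c s (p t) (sheet t)) (proj₁ q₃) ea) (sym (lift-sheets i' x' a' b' ha' hb')))) (proj₁ q₃)
        ed : d ≡ d'
        ed = vtx-ext (trans (lift-sheets i x a d ha hd) (trans (cong₂ (λ s t → c s (p t) (sheet t)) (proj₂ q₃) ea) (sym (lift-sheets i' x' a' d' ha' hd')))) (proj₂ q₃)

      count-test : countL test (allSubsets nY) ≤ k * NN
      count-test = ≤-trans (countL-inj test g (code ∘ elems) code-inj (allSubsets-unique nY) im)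
        (≤-trans (≤-reflexive (count-product m NN (bad ex))) (*-monoˡ-≤ NN (few ex)))
        where
        g : Fin (m * NN) → Bool
        g y = bad ex (proj₁ (remQuot {m} NN y))
        im : ∀ σ → σ ∈ allSubsets nY → test σ ≡ true → g (code (elems σ)) ≡ true
        im σ _ t with test-elim σ t
        ... | sz , σ∈ , q = trans (cong g (cong code (Shape.eq s))) (trans (cong (bad ex ∘ proj₁) (remQuot-combine {m} {NN} (sheet (Shape.a s)) _)) (first-bad σ s q))
          where
          s : Shape σ
          s = shape-of σ sz σ∈

      fX = length (facets X)

      -- Each facet of `X` has at most one lift through a given vertex of the cover.
      count-facets : ∀ σ y → lookup σ y ≡ true → countL (subB σ) facetsY ≤ fX
      count-facets σ y h = ≤-trans (countL-mono (λ F q → subB-elim σ F q y h) facetsY)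
        (≤-trans (countL-product (λ F → lookup F y) lift (allFin fX) (allFin m) 1 one)
          (≤-reflexive (trans (*-identityʳ _) (length-tabulate {n = fX} id))))
        where
        one : ∀ i → countL (λ x → lookup (lift i x) y) (allFin m) ≤ 1
        one i = ≤-trans (≤-reflexive (countL-tabulate (λ x → lookup (lift i x) y) id)) (count-≤1 _ (c (base i) (p y) (sheet y)) (λ x q → lift-base i x y q))

      m>0 : 0 < m
      m>0 = fin-pos x₀

      -- `4 C 3` is 4, and the cover has `fX * m` facets, of which at most `fX` contain `σ`.
      weight-bound : ∀ σ → test σ ≡ true → weight Y₀ σ ℚ.≤ ratio 1 (4 * m)
      weight-bound σ t with test-elim σ t
      ... | sz , σ∈ , q = subst (λ s → ratio (countL (subB σ) facetsY) ((4 C s) * length facetsY) ℚ.≤ ratio 1 (4 * m)) (sym sz)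
        (ratio-≤′ {countL (subB σ) facetsY} {4 * length facetsY} {1} {4 * m} (*-mono-≤ {1} {4} (s≤s z≤n) (nonempty Y₀)) (*-mono-≤ {1} {4} (s≤s z≤n) m>0)
          (≤-trans (*-monoˡ-≤ (4 * m) (count-facets σ (Shape.a s) (elems-∈ σ (subst (Shape.a s ∈_) (sym (Shape.eq s)) (here refl)))))
            (≤-reflexive (trans (trans (sym (*-assoc fX 4 m)) (trans (cong (_* m) (*-comm fX 4)) (*-assoc 4 fX m))) (trans (cong (4 *_) (sym facetsY-length)) (sym (+-identityʳ _)))))))
        where
        s : Shape σ
        s = shape-of σ sz σ∈

      norm-bound : norm Y₀ 3 (λ σ → ωY σ xor δ αY σ) ℚ.≤ ratio (k * NN) (4 * m)
      norm-bound = ℚ.≤-trans (sum-bound test (weight Y₀) (4 * m) 4m>0 weight-bound (allSubsets nY))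
        (ratio-≤′ {countL test (allSubsets nY)} {4 * m} {k * NN} {4 * m} 4m>0 4m>0 (*-monoˡ-≤ (4 * m) count-test))
        where
        4m>0 : 0 < 4 * m
        4m>0 = *-mono-≤ {1} {4} (s≤s z≤n) m>0

    abstract
      -- `αY` puts `ωY` at distance less than `κ` from the coboundaries, which large cosystoles
      -- exclude unless `ωY` is itself a coboundary.
      coboundary : ∀ {κ} k₀ → ratio 1 (suc k₀) ℚ.≤ κ → (suc k₀ * NN) * k < m → LargeCosystoles κ Y₀ → Coboundary Y₀ 3 ωY
      coboundary {κ} k₀ k₀≤κ small large = by-cases (Coboundary? Y₀ 3 ωY)
        where
        norm<κ : norm Y₀ 3 (λ σ → ωY σ xor δ αY σ) ℚ.< κ
        norm<κ = ℚ.≤-<-trans norm-bound (ℚ.<-≤-trans (ratio-<′ {k * NN} {4 * m} {1} {suc k₀} (*-mono-≤ {1} {4} (s≤s z≤n) m>0) (s≤s z≤n)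
          (≤-trans (s≤s (≤-reflexive (trans (*-comm (k * NN) (suc k₀)) (trans (cong (suc k₀ *_) (*-comm k NN)) (sym (*-assoc (suc k₀) NN k))))))
            -- The factor 4 from the weights is slack.
            (≤-trans small (≤-trans (m≤m+n m (3 * m)) (≤-reflexive (sym (+-identityʳ (4 * m)))))))) k₀≤κ)
        by-cases : Dec (Coboundary Y₀ 3 ωY) → Coboundary Y₀ 3 ωY
        by-cases (yes q) = q
        by-cases (no ¬q) = ⊥-elim (ℚ.<-irrefl refl (ℚ.<-≤-trans norm<κ (large 2 ≤-refl ωY ωY-cocycle ¬q αY)))

  -- Normalising the primitive along the spanning tree.

  module Gauge (βc : Cochain nY) (βc-spec : ∀ σ → T (inY Y₀ σ) → size σ ≡ 3 → ωY σ ≡ δ βc σ) where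
    private
      B : Fin nY → Fin nY → Bool
      B y y' = βc (pair y y')

      B-sym : ∀ y y' → B y y' ≡ B y' y
      B-sym y y' = cong βc (tabulate-cong λ i → ∨-comm (i == y) (i == y'))

      Good : Fin nY → Fin nY → Fin nY → Set
      Good a b d = ω (p a) (p b) (p d) ≡ B b d xor (B a d xor B a b)

      module _ (i : Fin (length (facets X))) (x : Fin m) where
        In : Fin nY → Set
        In y = lookup (lift i x) y ≡ true

        GoodIn : Fin nY → Fin nY → Fin nY → Set
        GoodIn a b d = In a × In b × In d × Good a b d

        on : ∀ {k} → In k → lookup (facet i) (p k) ≡ true
        on {k} h = proj₁ (lift-elim i x k h)

        swap₁₂ : ∀ {a b d} → GoodIn a b d → GoodIn b a d
        swap₁₂ {a} {b} {d} (ha , hb , hd , q) = hb , ha , hd , (begin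
          ω (p b) (p a) (p d) ≡⟨ ω-rev (facet i , facet∈ i , on hd , on ha , on hb) ⟩
          ω (p d) (p a) (p b) ≡⟨ sym (ω-cyc (facet i , facet∈ i , on hd , on ha , on hb)) ⟩
          ω (p a) (p b) (p d) ≡⟨ q ⟩
          B b d xor (B a d xor B a b) ≡⟨ xor-swap (B b d) (B a d) (B a b) ⟩
          B a d xor (B b d xor B a b) ≡⟨ cong (λ t → B a d xor (B b d xor t)) (B-sym a b) ⟩
          B a d xor (B b d xor B b a) ∎)
          where open ≡-Reasoning

        swap₂₃ : ∀ {a b d} → GoodIn a b d → GoodIn a d b
        swap₂₃ {a} {b} {d} (ha , hb , hd , q) = ha , hd , hb , (begin
          ω (p a) (p d) (p b) ≡⟨ ω-rev (facet i , facet∈ i , on hb , on hd , on ha) ⟩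
          ω (p b) (p d) (p a) ≡⟨ ω-cyc (facet i , facet∈ i , on ha , on hb , on hd) ⟩
          ω (p a) (p b) (p d) ≡⟨ q ⟩
          B b d xor (B a d xor B a b) ≡⟨ cong₂ _xor_ (B-sym b d) (xor-comm (B a d) (B a b)) ⟩
          B d b xor (B a b xor B a d) ∎)
          where open ≡-Reasoning

        -- `βc-spec` speaks of the increasing order only; the symmetry of `ω` and of unordered pairs
        -- extends it to every order.
        triple-good : ∀ {y₁ y₂ y₃} → y₁ ≢ y₂ → y₁ ≢ y₃ → y₂ ≢ y₃ → In y₁ → In y₂ → In y₃ → Good y₁ y₂ y₃
        triple-good {y₁} {y₂} {y₃} d₁₂ d₁₃ d₂₃ h₁ h₂ h₃ = from-list (length₃ (elems σ) (trans (elems-length σ) σ-size))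
          where
          f : Fin nY → Bool
          f k = (k == y₁) ∨ (k == y₂) ∨ (k == y₃)
          σ : Subset nY
          σ = tabulate f
          f-elim : ∀ k → f k ≡ true → k ≡ y₁ ⊎ k ≡ y₂ ⊎ k ≡ y₃
          f-elim k q = [ (λ r → inj₁ (==⇒≡ r)) , (λ r → [ (λ r → inj₂ (inj₁ (==⇒≡ r))) , (λ r → inj₂ (inj₂ (==⇒≡ r))) ]′ (∨-elim r)) ]′ (∨-elim q)
          σ-elim : ∀ k → lookup σ k ≡ true → k ≡ y₁ ⊎ k ≡ y₂ ⊎ k ≡ y₃
          σ-elim k q = f-elim k (trans (sym (lookup∘tabulate f k)) q)
          f₂ f₃ f₄ : Fin nY → Bool
          f₂ k = f k ∧ not (k == y₁)
          f₃ k = f₂ k ∧ not (k == y₂)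
          f₄ k = f₃ k ∧ not (k == y₃)
          at₁ : f y₁ ≡ true
          at₁ = cong (_∨ ((y₁ == y₂) ∨ (y₁ == y₃))) (==-refl y₁)
          at₂ : f₂ y₂ ≡ true
          at₂ = cong₂ (λ s t → (s ∨ t ∨ (y₂ == y₃)) ∧ not s) (≢⇒== (d₁₂ ∘ sym)) (==-refl y₂)
          at₃ : f₃ y₃ ≡ true
          at₃ = trans (cong₂ (λ s t → ((s ∨ t ∨ (y₃ == y₃)) ∧ not s) ∧ not t) (≢⇒== (d₁₃ ∘ sym)) (≢⇒== (d₂₃ ∘ sym)))
                      (cong (λ s → (s ∧ true) ∧ true) (==-refl y₃))
          none : ∀ k → f₄ k ≡ false
          none k with k == y₁ | k == y₂ | k == y₃
          ... | true  | _     | _     = refl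
          ... | false | true  | _     = refl
          ... | false | false | true  = refl
          ... | false | false | false = refl
          σ-size : size σ ≡ 3
          σ-size = trans (count-cong (lookup∘tabulate f)) (trans (count-point f y₁ at₁) (cong suc (trans (count-point f₂ y₂ at₂)
            (cong suc (trans (count-point f₃ y₃ at₃) (cong suc (count-none none)))))))
          In-σ : ∀ k → lookup σ k ≡ true → In k
          In-σ k q = [ (λ r → subst In (sym r) h₁) , [ (λ r → subst In (sym r) h₂) , (λ r → subst In (sym r) h₃) ]′ ]′ (σ-elim k q)
          σ∈Y : inY Y₀ σ ≡ true
          σ∈Y = anyL-intro (subB σ) (facetsY-intro i x) (subB-intro σ (lift i x) In-σ)
          from-list : (∃[ a ] ∃[ b ] ∃[ d ] elems σ ≡ a ∷ b ∷ d ∷ []) → Good y₁ y₂ y₃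
          from-list (a , b , d , eq) = proj₂ (proj₂ (proj₂ (permute₃ GoodIn swap₁₂ swap₂₃
              (proj₁ dist) (proj₁ (proj₂ dist)) (proj₂ (proj₂ dist)) (σ-elim a ma) (σ-elim b mb) (σ-elim d md)
              (In-σ a ma , In-σ b mb , In-σ d md , sorted))))
            where
            dist = elems₃-distinct σ eq
            rm = elems₃-remove σ eq
            ma : lookup σ a ≡ true
            ma = elems-∈ σ (subst (a ∈_) (sym eq) (here refl))
            mb : lookup σ b ≡ true
            mb = elems-∈ σ (subst (b ∈_) (sym eq) (there (here refl)))
            md : lookup σ d ≡ true
            md = elems-∈ σ (subst (d ∈_) (sym eq) (there (there (here refl))))
            sorted : Good a b d
            sorted = trans (sym (cong (val₃ (λ a b d → ω (p a) (p b) (p d))) eq)) (trans (βc-spec σ (≡⇒T σ∈Y) σ-size)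
              (trans (δ₃ σ eq βc) (cong₂ _xor_ (cong βc (elems-pair _ (proj₁ rm)))
                (cong₂ _xor_ (cong βc (elems-pair _ (proj₁ (proj₂ rm)))) (cong βc (elems-pair _ (proj₂ (proj₂ rm))))))))

      -- Tree generators act trivially, so lifts of tree edges stay inside one sheet and the sheets
      -- can be treated independently.
      potential : ∀ z → Σ (V → Bool) λ h → ∀ {a b} → (a , b) ∈ edges Tr → h a xor h b ≡ B (vtx z a) (vtx z b)
      potential z = tree-potential (edges Tr) (count≡ Tr) (spans Tr) (λ a b → B (vtx z a) (vtx z b))

      h : Fin m → V → Bool
      h z = proj₁ (potential z)

      h-tree : ∀ z {u v} → inTree u v ≡ true → h z v xor h z u ≡ B (vtx z v) (vtx z u)
      h-tree z {u} {v} q = [ (λ e∈ → trans (xor-comm (h z v) _) (trans (proj₂ (potential z) e∈) (B-sym (vtx z u) (vtx z v)))) ,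
                             (λ e∈ → proj₂ (potential z) e∈) ]′ (inTree-elim q)

      -- `βc` plus the coboundary of `h`: the sum around a triangle is unchanged, and lifts of tree
      -- edges receive zero.
      raw : V → V → Fin m → Bool
      raw u v z = B (vtx z v) (vtx (c u v z) u) xor (h z v xor h (c u v z) u)

      -- `raw` is meaningless on non-edges, where zero is forced. Tree edges are masked too, but
      -- there `raw` already vanishes.
      masked : Kind → Bool → Bool
      masked null b = false
      masked pos  b = b
      masked neg  b = b

      masked-flip : ∀ k b → masked (flipK k) b ≡ masked k b
      masked-flip null b = refl
      masked-flip pos  b = refl
      masked-flip neg  b = refl

      raw-tree : ∀ u v → inTree u v ≡ true → ∀ z → raw u v z ≡ false
      raw-tree u v q z = trans (cong (λ s → B (vtx z v) (vtx s u) xor (h z v xor h s u)) (c-tree q z))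
        (trans (cong (B (vtx z v) (vtx z u) xor_) (h-tree z q)) (xor-same (B (vtx z v) (vtx z u))))

      raw-flip : ∀ u v z → raw u v (c v u z) ≡ raw v u z
      raw-flip u v z = trans (cong (λ s → B (vtx (c v u z) v) (vtx s u) xor (h (c v u z) v xor h s u)) (c-flip u v z))
        (cong₂ _xor_ (B-sym (vtx (c v u z) v) (vtx z u)) (xor-comm (h (c v u z) v) (h z u)))

    β : V → V → Fin m → Bool
    β u v z = masked (kind u v) (raw u v z)

    β-null : ∀ {u v} → kind u v ≡ null → ∀ z → β u v z ≡ false
    β-null {u} {v} q z = cong (λ k → masked k (raw u v z)) q

    β-flip : ∀ u v z → β u v (c v u z) ≡ β v u z
    β-flip u v z = trans (cong (masked (kind u v)) (raw-flip u v z))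
      (trans (sym (masked-flip (kind u v) (raw v u z))) (cong (λ k → masked k (raw v u z)) (sym (kind-flip u v))))

    private
      β-edge : ∀ {u v} → isEdge X u v ≡ true → ∀ z → β u v z ≡ raw u v z
      β-edge {u} {v} q z = by-kind (kind u v) refl
        where
        by-kind : ∀ k → kind u v ≡ k → masked k (raw u v z) ≡ raw u v z
        by-kind pos  _ = refl
        by-kind neg  _ = refl
        by-kind null r = [ (λ s → case trans (sym q) s of λ ()) , (λ s → sym (raw-tree u v s z)) ]′ (kind-null r)

      telescope : ∀ P Q R a b d → (P xor (b xor a)) xor ((Q xor (d xor b)) xor (R xor (a xor d))) ≡ Q xor (R xor P)
      telescope P Q R a b d = begin
        (P xor (b xor a)) xor ((Q xor (d xor b)) xor (R xor (a xor d))) ≡⟨ cong ((P xor (b xor a)) xor_) (xor-interchange Q (d xor b) R (a xor d)) ⟩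
        (P xor (b xor a)) xor ((Q xor R) xor ((d xor b) xor (a xor d))) ≡⟨ xor-interchange P (b xor a) (Q xor R) _ ⟩
        (P xor (Q xor R)) xor ((b xor a) xor ((d xor b) xor (a xor d))) ≡⟨ cong₂ _xor_ (xor-rotate P Q R) (cycle a b d) ⟩
        (Q xor (R xor P)) xor false ≡⟨ xor-identityʳ _ ⟩
        Q xor (R xor P) ∎
        where
        open ≡-Reasoning
        cycle : ∀ a b d → (b xor a) xor ((d xor b) xor (a xor d)) ≡ false
        cycle true  true  true  = refl
        cycle true  true  false = refl
        cycle true  false true  = refl
        cycle true  false false = refl
        cycle false true  true  = refl
        cycle false true  false = refl
        cycle false false true  = refl
        cycle false false false = refl

    -- For distinct vertices the contributions of `h` telescope around the closed path and
    -- `triple-good` remains. Degenerate triples are relators as well; there the two remaining edge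
    -- signs cancel and `ω` is zero.
    β-triangle : ∀ u v t → Face u v t → ∀ x → tw ψ (curryΓ β) (tri u v t) x ≡ ω u v t
    β-triangle u v t F@(G , G∈ , hu , hv , ht) x = trans (tw-tri β u v t x) (by-cases (u ≟F v) (v ≟F t) (t ≟F u))
      where
      Goal = β u v (c v t (c t u x)) xor (β v t (c t u x) xor β t u x) ≡ ω u v t
      by-cases : Dec (u ≡ v) → Dec (v ≡ t) → Dec (t ≡ u) → Goal
      by-cases (yes refl) _ _ = trans (cong₂ (λ s s' → s xor (s' xor β t u x)) (β-null (refl-null u) _) (β-flip u t x))
        (trans (xor-same (β t u x)) (sym (ω-degenerate₁ F)))
      by-cases (no _) (yes refl) _ = trans (cong₂ (λ s s' → β u v s xor (s' xor β v u x)) (c-refl v (c v u x)) (β-null (refl-null v) _))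
        (trans (cong (_xor β v u x) (β-flip u v x)) (trans (xor-same (β v u x))
          (sym (trans (sym (ω-cyc F)) (ω-degenerate₁ (G , G∈ , hv , hv , hu))))))
      by-cases (no _) (no _) (yes refl) = trans (cong₂ (λ s s' → β u v (c v u s) xor (β v u s xor s')) (c-refl u x) (β-null (refl-null u) x))
        (trans (cong₂ _xor_ (β-flip u v x) (xor-identityʳ (β v u x))) (trans (xor-same (β v u x))
          (sym (trans (ω-cyc {u} {u} {v} (G , G∈ , hu , hu , hv)) (ω-degenerate₁ (G , G∈ , hu , hu , hv))))))
      by-cases (no u≢v) (no v≢t) (no t≢u) = begin
        β u v (c v t (c t u x)) xor (β v t (c t u x) xor β t u x)
          ≡⟨ cong₂ _xor_ (β-edge (facet-edge G∈ hu hv u≢v) _) (cong₂ _xor_ (β-edge (facet-edge G∈ hv ht v≢t) _) (β-edge (facet-edge G∈ ht hu t≢u) x)) ⟩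
        raw u v (c v t (c t u x)) xor (raw v t (c t u x) xor raw t u x)
          ≡⟨ cong (λ s → raw u v s xor ((B y₃ (vtx s v) xor (h (c t u x) t xor h s v)) xor raw t u x)) (c-comp (G , G∈ , hv , ht , hu) x) ⟩
        raw u v (c v u x) xor ((B y₃ y₂ xor (h (c t u x) t xor h (c v u x) v)) xor raw t u x)
          ≡⟨ cong (_xor ((B y₃ y₂ xor (h (c t u x) t xor h (c v u x) v)) xor raw t u x))
               (cong (λ s → B y₂ (vtx s u) xor (h (c v u x) v xor h s u)) (c-flip u v x)) ⟩
        (B y₂ y₁ xor (h (c v u x) v xor h x u)) xor ((B y₃ y₂ xor (h (c t u x) t xor h (c v u x) v)) xor (B y₁ y₃ xor (h x u xor h (c t u x) t)))
          ≡⟨ telescope (B y₂ y₁) (B y₃ y₂) (B y₁ y₃) (h x u) (h (c v u x) v) (h (c t u x) t) ⟩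
        B y₃ y₂ xor (B y₁ y₃ xor B y₂ y₁) ≡⟨ cong₂ (λ s s' → s xor (B y₁ y₃ xor s')) (B-sym y₃ y₂) (B-sym y₂ y₁) ⟩
        B y₂ y₃ xor (B y₁ y₃ xor B y₁ y₂) ≡⟨ sym (triple-good i x' (≢-vtx u≢v) (≢-vtx (t≢u ∘ sym)) (≢-vtx v≢t) in₁ in₂ in₃) ⟩
        ω (p y₁) (p y₂) (p y₃) ≡⟨ trans (cong (λ s → ω s (p y₂) (p y₃)) (p-vtx x u)) (cong₂ (ω u) (p-vtx (c v u x) v) (p-vtx (c t u x) t)) ⟩
        ω u v t ∎
        where
        open ≡-Reasoning
        y₁ = vtx x u
        y₂ = vtx (c v u x) v
        y₃ = vtx (c t u x) t
        ≢-vtx : ∀ {a b s s'} → a ≢ b → vtx s a ≢ vtx s' b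
        ≢-vtx {a} {b} {s} {s'} q r = q (trans (sym (p-vtx s a)) (trans (cong p r) (p-vtx s' b)))
        i = proj₁ (index-of G∈)
        inG : ∀ {a} → lookup G a ≡ true → lookup (facet i) a ≡ true
        inG {a} q = trans (cong (λ G → lookup G a) (proj₂ (index-of G∈))) q
        x' = c (base i) u x
        in-lift : ∀ a → lookup G a ≡ true → lookup (lift i x') (vtx (c a u x) a) ≡ true
        in-lift a q = subst (λ s → lookup (lift i x') (vtx s a) ≡ true)
          (c-comp (facet i , facet∈ i , inG q , base∈ i , inG hu) x) (lift-vtx i x' a (inG q))
        in₁ : lookup (lift i x') y₁ ≡ true
        in₁ = subst (λ s → lookup (lift i x') (vtx s u) ≡ true) (c-refl u x) (in-lift u hu)
        in₂ = in-lift v hv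
        in₃ = in-lift t ht

-- Extending an action of `Γ` to the central extension.

module LiftedAction (X : Complex) (Tr : SpanningTree X) {Γ̃ : Presentation} (E : CentralExt (π₁Pres X Tr) Γ̃)
    {m : ℕ} (ψ : Perms (gens (π₁Pres X Tr)) m) (action : IsAction (π₁Pres X Tr) ψ) where
  open Lifting X Tr E

  module _ (β : V → V → Fin m → Bool) (β-null : ∀ {u v} → kind u v ≡ null → ∀ y → β u v y ≡ false)
           (β-flip : ∀ u v y → β u v (ψ (combine v u) ⟨$⟩ʳ y) ≡ β v u y) where
    private
      at : ∀ u v x → curryΓ β (combine u v) x ≡ β u v x
      at u v x = cong (λ f → f x) (curryΓ-combine β u v)

    tw-null : ∀ {u v} → kind u v ≡ null → ∀ x → tw ψ (curryΓ β) (e u v ∷ []) x ≡ false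
    tw-null {u} {v} q x = trans (xor-identityʳ _) (trans (at u v x) (β-null q x))

    tw-invert : ∀ u v x → tw ψ (curryΓ β) (e u v ∷ e v u ∷ []) x ≡ false
    tw-invert u v x = trans (cong₂ _xor_ (trans (at u v _) (β-flip u v x)) (trans (xor-identityʳ _) (at v u x))) (xor-same (β v u x))

  module _ (β : V → V → Fin m → Bool) (β-null : ∀ {u v} → kind u v ≡ null → ∀ y → β u v y ≡ false)
           (β-flip : ∀ u v y → β u v (ψ (combine v u) ⟨$⟩ʳ y) ≡ β v u y)
           (β-triangle : ∀ u v t → Face u v t → ∀ x → tw ψ (curryΓ β) (tri u v t) x ≡ ω u v t) where
    private
      tβ : Word (gens Γ) → Fin m → Bool
      tβ = tw ψ (curryΓ β)

    -- A single `b` measures both how the lift changes in `Γ̃` and how the holonomy changes; this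
    -- ties the cochain to the extension.
    Same : Word (gens Γ) → Word (gens Γ) → Set
    Same u v = ∃[ b ] (Γ̃ ⊢ L̂ u ≈ (L̂ v ++ zp b) × (∀ x → tβ u x ≡ tβ v x xor b))

    private
      rel-same : ∀ {r} → RelView r → Same r []
      rel-same (nonedge u v q) = false , ≡⇒≈ (trans (L̂-e u v []) (trans (++-identityʳ _) (Lv-null (nonedge-null q)))) ,
        tw-null β β-null β-flip (nonedge-null q)
      rel-same (tree {u} {v} q) = false , ≡⇒≈ (trans (L̂-e u v []) (trans (++-identityʳ _) (Lv-null (tree-null (inTree-intro q))))) ,
        tw-null β β-null β-flip (tree-null (inTree-intro q))
      rel-same (invert u v) = false , ≈trans (≡⇒≈ (trans (L̂-e u v (e v u ∷ [])) (cong (Lv u v ++_) (trans (L̂-e v u []) (++-identityʳ _))))) (Lv-flip u v) ,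
        tw-invert β β-null β-flip u v
      rel-same (triangle {u} {v} {t} F) = ω u v t , ω-tri F , β-triangle u v t F

    -- Induction on the derivation. Among the relators only triangles contribute, and there
    -- `β-triangle` matches the exponent `ω` of the lift.
    same : ∀ {u v} → Γ ⊢ u ≈ v → Same u v
    same {u} ≈refl = false , ≡⇒≈ (sym (++-identityʳ (L̂ u))) , λ x → sym (xor-identityʳ _)
    same (≈sym {u} {v} q) = let b , r , s = same q in b ,
      ≈trans (≡⇒≈ (sym (++-identityʳ (L̂ v)))) (≈trans (≈cong {u = L̂ v} ≈refl (≈sym (≈trans (zp-xor b b) (≡⇒≈ (cong zp (xor-same b))))))
        (≈trans (≡⇒≈ (sym (++-assoc (L̂ v) (zp b) (zp b)))) (≈cong {v = zp b} (≈sym r) ≈refl))) ,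
      λ x → sym (trans (cong (_xor b) (s x)) (xor-cancelʳ² (tβ v x) b))
    same (≈trans {u} {v} {t} q q') = let b , r , s = same q ; b' , r' , s' = same q' in b' xor b ,
      ≈trans r (≈trans (≈cong {v = zp b} r' ≈refl) (≈trans (≡⇒≈ (++-assoc (L̂ t) (zp b') (zp b))) (≈cong {u = L̂ t} ≈refl (zp-xor b' b)))) ,
      λ x → trans (s x) (trans (cong (_xor b) (s' x)) (xor-assoc (tβ t x) b' b))
    same (≈cong {u} {u'} {v} {v'} q q') = let b , r , s = same q ; b' , r' , s' = same q' in b xor b' ,
      ≈trans (≡⇒≈ (ext-++ Γ̃ Γ L u v)) (≈trans (up-to-zp {u' = L̂ u'} {v' = L̂ v'} {a = b} {b = b'} r r')
        (≡⇒≈ (cong (_++ zp (b xor b')) (sym (ext-++ Γ̃ Γ L u' v'))))) ,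
      λ x → begin
        tβ (u ++ v) x                                      ≡⟨ tw-++ ψ (curryΓ β) u v x ⟩
        tβ u (act ψ v x) xor tβ v x                        ≡⟨ cong₂ _xor_ (s (act ψ v x)) (s' x) ⟩
        (tβ u' (act ψ v x) xor b) xor (tβ v' x xor b')     ≡⟨ xor-interchange (tβ u' (act ψ v x)) b (tβ v' x) b' ⟩
        (tβ u' (act ψ v x) xor tβ v' x) xor (b xor b')     ≡⟨ cong (λ y → (tβ u' y xor tβ v' x) xor (b xor b')) (act-≈ Γ action q' x) ⟩
        (tβ u' (act ψ v' x) xor tβ v' x) xor (b xor b')    ≡⟨ cong (_xor (b xor b')) (sym (tw-++ ψ (curryΓ β) u' v' x)) ⟩
        tβ (u' ++ v') x xor (b xor b')                     ∎
      where open ≡-Reasoning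
    -- For the presentation without relators `L̂` is a homomorphism; with the relators of `Γ` it is
    -- one only up to powers of `z`.
    same (≈free s t) = false , ext-≈ Γ̃ (record { gens = gens Γ ; rels = [] }) L (λ r ()) (≈free s t) ,
      λ x → trans (cong (twL ψ (curryΓ β) (s , t) (applyL ψ (s , not t) x) xor_) (trans (xor-identityʳ _) (twL-inv ψ (curryΓ β) (s , t) x)))
                  (xor-same (twL ψ (curryΓ β) (s , t) (applyL ψ (s , not t) x)))
    same (≈rel r∈) = rel-same (rel-view r∈)

    private
      ψ̃ : Perms (gens Γ̃) m
      ψ̃ = pull Γ Γ̃ π ψ

      -- The holonomy of the image, corrected by the power of `z` that separates the generator from
      -- the lift of its image.
      β̃ : Fin (gens Γ̃) → Fin m → Bool
      β̃ s x = tβ (π s) x xor cw ((s , false) ∷ [])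

      cw-inv : ∀ s → cw ((s , true) ∷ []) ≡ cw ((s , false) ∷ [])
      cw-inv s = sym (xor≡false (trans (sym (cw-++ S S⁻)) (sym (zp-inj false (cw (S ++ S⁻)) both))))
        where
        S S⁻ : Word (gens Γ̃)
        S  = (s , false) ∷ []
        S⁻ = (s , true) ∷ []
        lifted : Γ̃ ⊢ L̂ (π̂ (S ++ S⁻)) ≈ []
        lifted = ≈trans (≡⇒≈ (trans (cong L̂ (cong (π s ++_) (++-identityʳ (invW (π s))))) (ext-++ Γ̃ Γ L (π s) (invW (π s)))))
          (≈trans (≈cong {u = L̂ (π s)} ≈refl (ext-inv Γ̃ Γ L (π s))) (inv-rightW Γ̃ (L̂ (π s))))
        both : Γ̃ ⊢ [] ≈ zp (cw (S ++ S⁻))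
        both = ≈trans (≈sym (≈free s false)) (≈trans (cw-spec (S ++ S⁻)) (≈cong {v = zp (cw (S ++ S⁻))} lifted ≈refl))

      -- Both summands on the right are additive in the word; `tw-inv` and `cw-inv` settle the
      -- inverse letters.
      tw-pull : ∀ v x → tw ψ̃ β̃ v x ≡ tβ (π̂ v) x xor cw v
      tw-pull [] x = sym cw-[]
      tw-pull (l ∷ v) x = begin
        twL ψ̃ β̃ l (act ψ̃ v x) xor tw ψ̃ β̃ v x            ≡⟨ cong₂ _xor_ (cong (twL ψ̃ β̃ l) (act-pull Γ Γ̃ π ψ v x)) (tw-pull v x) ⟩
        twL ψ̃ β̃ l y xor (tβ (π̂ v) x xor cw v)            ≡⟨ cong (_xor (tβ (π̂ v) x xor cw v)) (letter l y) ⟩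
        (tβ (π̂ (l ∷ [])) y xor cw (l ∷ [])) xor (tβ (π̂ v) x xor cw v) ≡⟨ xor-interchange (tβ (π̂ (l ∷ [])) y) (cw (l ∷ [])) (tβ (π̂ v) x) (cw v) ⟩
        (tβ (π̂ (l ∷ [])) y xor tβ (π̂ v) x) xor (cw (l ∷ []) xor cw v) ≡⟨ cong₂ _xor_ (sym (tw-++ ψ (curryΓ β) (π̂ (l ∷ [])) (π̂ v) x)) (sym (cw-++ (l ∷ []) v)) ⟩
        tβ (π̂ (l ∷ []) ++ π̂ v) x xor cw (l ∷ v)          ≡⟨ cong (λ u → tβ u x xor cw (l ∷ v)) (sym (ext-++ Γ Γ̃ π (l ∷ []) v)) ⟩
        tβ (π̂ (l ∷ v)) x xor cw (l ∷ v)                  ∎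
        where
        open ≡-Reasoning
        y = act ψ (π̂ v) x
        letter : ∀ l y → twL ψ̃ β̃ l y ≡ tβ (π̂ (l ∷ [])) y xor cw (l ∷ [])
        letter (s , false) y = cong (λ u → tβ u y xor cw ((s , false) ∷ [])) (sym (++-identityʳ (π s)))
        letter (s , true)  y = cong₂ _xor_ (trans (sym (tw-inv ψ (curryΓ β) (π s) y)) (cong (λ u → tβ u y) (sym (++-identityʳ (invW (π s)))))) (sym (cw-inv s))

    Ψ : Perms (gens Γ̃) (m + m)
    Ψ = twist ψ̃ β̃

    -- By `same` the image of a relator has constant holonomy `b`, and its lift is `z` to the power
    -- `b`. As the relator is trivial in `Γ̃` and `z` is not, `b` cancels `cw r`.
    Ψ-action : IsAction Γ̃ Ψ
    Ψ-action r r∈ = act-twist-fixed ψ̃ β̃ {r} (pull-action Γ Γ̃ π πhom action r r∈) (λ x → trans (tw-pull r x) (trans (cong (_xor cw r) (s x)) closes))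
      where
      b = proj₁ (same (πhom r r∈))
      s = proj₂ (proj₂ (same (πhom r r∈)))
      closes : b xor cw r ≡ false
      closes = sym (zp-inj false (b xor cw r) (≈trans (≈sym (≈rel r∈)) (≈trans (cw-spec r)
        (≈trans (≈cong {v = zp (cw r)} (proj₁ (proj₂ (same (πhom r r∈)))) ≈refl) (zp-xor b (cw r))))))

    Ψ-fixed : ∀ v x → act Ψ v (pt x false) ≡ pt x false → act ψ (π̂ v) x ≡ x × tβ (π̂ v) x ≡ cw v
    Ψ-fixed v x q = trans (sym (act-pull Γ Γ̃ π ψ v x)) (pt-injˡ {s = tw ψ̃ β̃ v x} {false} r) , xor≡false (trans (sym (tw-pull v x)) (pt-injʳ {s = tw ψ̃ β̃ v x} {false} r))
      where
      r : pt (act ψ̃ v x) (tw ψ̃ β̃ v x) ≡ pt x false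
      r = trans (sym (act-twist ψ̃ β̃ v x false)) q

-- Either the extended action on the double cover moves w, or the difference of the two cochains
-- defines an almost action of Γ whose correction moves w.
module Stage3 (X : Complex) (Tr : SpanningTree X) {Γ̃ : Presentation} (E : CentralExt (π₁Pres X Tr) Γ̃)
    {κ : ℚ} (0<κ : 0ℚ ℚ.< κ) (large : ∀ (C : Cover X) → LargeCosystoles κ (Cover.Y C))
    {ρ : ℚ → ℚ} (rate : RateFunction ρ) (stab : Stable (π₁Pres X Tr) ρ) (w : Word (gens Γ̃)) where
  open Configurations X Tr E w
  private
    module St = Stability {π₁Pres X Tr} {ρ} rate stab

  Detected : Set
  Detected = ∃[ M ] Σ (Perms (gens Γ̃) M) λ χ → IsAction Γ̃ χ × ∃[ x ] (¬ (act χ w x ≡ x))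

  -- Whether a finite action moves `w` is decidable, so the continuation may assume that `w` acts
  -- trivially.
  detect : ∀ {M} (χ : Perms (gens Γ̃) M) → IsAction Γ̃ χ → ((∀ x → act χ w x ≡ x) → Detected) → Detected
  detect {M} χ χ-action otherwise = by-cases (any? (λ x → ¬? (act χ w x ≟F x)))
    where
    by-cases : Dec (∃[ x ] (¬ (act χ w x ≡ x))) → Detected
    by-cases (yes q) = M , χ , χ-action , q
    by-cases (no ¬q) = otherwise (λ x → decidable-stable (act χ w x ≟F x) (λ ¬p → ¬q (x , ¬p)))

  -- `K₁` pushes the norm on the cover below `κ`. `K₂` makes the twisted action so close to its
  -- correction that `ℓ` letters accumulate at most `m` exceptions among its `m + m` points; the
  -- argument `2 * suc ℓ` is chosen for this.
  ℓ k₀ K₁ K₂ : ℕ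
  ℓ  = length (π̂ w)
  k₀ = proj₁ (archimedean 0<κ)
  K₁ = suc k₀ * (n X * (n X * n X))
  K₂ = suc (proj₁ (St.close (2 * suc ℓ)))

  module _ {m' : ℕ} (ψ : Perms (gens Γ) (suc m')) (action : IsAction Γ ψ)
           (transitive : ∀ i j → ∃[ u ] act ψ u i ≡ j)
           (α : V → V → Fin (suc m') → Bool) (α-null : ∀ {u v} → kind u v ≡ null → ∀ y → α u v y ≡ false)
           (α-flip : ∀ u v y → α u v (ψ (combine v u) ⟨$⟩ʳ y) ≡ α v u y)
           {c : ℕ} (small₁ : K₁ * c < suc m') (small₂ : K₂ * c < suc m') (small₃ : 2 * c < suc m')
           (generic : Exc c (Generic ψ α)) where
    private
      m : ℕ
      m = suc m'

      module Coh = Cohomology X Tr E ψ action transitive zero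
      module LA = LiftedAction X Tr E ψ action

      cob : Coboundary (Cover.Y (Covering.cover X Tr ψ action transitive zero)) 3 Coh.ωY
      cob = Coh.coboundary α α-flip (Exc-map (λ y → proj₁) generic) {κ} k₀ (proj₂ (archimedean 0<κ)) small₁
              (large (Covering.cover X Tr ψ action transitive zero))

      module G = Coh.Gauge (proj₁ cob) (proj₂ cob)

      α̂ β̂ γ̂ : Fin (gens Γ) → Fin m → Bool
      α̂ = curryΓ α
      β̂ = curryΓ G.β
      γ̂ s y = α̂ s y xor β̂ s y

      φ' : Perms (gens Γ) (m + m)
      φ' = twist ψ γ̂

      -- On triangles both holonomies equal `ω` and cancel; on the other relators each of them
      -- vanishes by itself.
      γ-relator : ∀ {r} → RelView r → ∀ x → Generic ψ α x → tw ψ γ̂ r x ≡ false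
      γ-relator {r} view x gen = trans (tw-xor ψ α̂ β̂ r x) (vanish view)
        where
        vanish : RelView r → tw ψ α̂ r x xor tw ψ β̂ r x ≡ false
        vanish (nonedge u v q) = cong₂ _xor_ (LA.tw-null α α-null α-flip (nonedge-null q) x) (LA.tw-null G.β G.β-null G.β-flip (nonedge-null q) x)
        vanish (tree q) = cong₂ _xor_ (LA.tw-null α α-null α-flip (tree-null (inTree-intro q)) x) (LA.tw-null G.β G.β-null G.β-flip (tree-null (inTree-intro q)) x)
        vanish (invert u v) = cong₂ _xor_ (LA.tw-invert α α-null α-flip u v x) (LA.tw-invert G.β G.β-null G.β-flip u v x)
        vanish (triangle {u} {v} {t} F) = trans (cong₂ _xor_ (proj₁ gen u v t F) (G.β-triangle u v t F x)) (xor-same (ω u v t))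

      φ'-relator : ∀ r → r ∈ rels Γ → Exc (c + c) (λ p → act φ' r p ≡ p)
      φ'-relator r r∈ = Exc-map fixed (Exc-double {m} generic)
        where
        fixed : ∀ p → Generic ψ α (proj₁ (unpt {m} p)) → act φ' r p ≡ p
        fixed p gen = begin
          act φ' r p                                   ≡⟨ cong (act φ' r) (sym (pt-unpt {m} p)) ⟩
          act φ' r (pt x t)                            ≡⟨ act-twist ψ γ̂ r x t ⟩
          pt (act ψ r x) (t xor tw ψ γ̂ r x)            ≡⟨ cong₂ pt (action r r∈ x) (trans (cong (t xor_) (γ-relator (rel-view r∈) x gen)) (xor-identityʳ t)) ⟩
          pt x t                                       ≡⟨ pt-unpt {m} p ⟩
          p                                            ∎
          where
          open ≡-Reasoning
          x = proj₁ (unpt {m} p)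
          t = proj₂ (unpt {m} p)

      defect-small : K₂ * St.defect φ' ≤ m + m
      defect-small = ≤-trans (*-monoʳ-≤ K₂ (St.defect-≤ φ' (c + c) (λ r r∈ → St.movedCount-≤ φ' r (φ'-relator r r∈))))
        (≤-trans (≤-reflexive (*-distribˡ-+ K₂ c c)) (+-mono-≤ (<⇒≤ small₂) (<⇒≤ small₂)))

      abstract
        correct : St.Correct φ' (2 * suc ℓ)
        correct = proj₂ (St.close (2 * suc ℓ)) φ' defect-small

        along-w : ∃[ d ] (2 * suc ℓ * d ≤ ℓ * (m + m) × Exc d (λ p → St.j φ' (act φ' (π̂ w) p) ≡ act (St.ψ φ') (π̂ w) (St.j φ' p)))
        along-w = act-close φ' (St.ψ φ') (St.j φ') {2 * suc ℓ} {m + m} (λ s → let d , k , _ , ex = correct s in d , k , ex) (π̂ w)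

      d = proj₁ along-w

      d≤m : d ≤ m
      d≤m = *-cancelˡ-≤ (2 * suc ℓ) (≤-trans (proj₁ (proj₂ along-w)) (≤-trans (*-monoˡ-≤ (m + m) (n≤1+n ℓ)) (≤-reflexive (begin
        suc ℓ * (m + m)      ≡⟨ cong (λ t → suc ℓ * (m + t)) (sym (+-identityʳ m)) ⟩
        suc ℓ * (2 * m)      ≡⟨ sym (*-assoc (suc ℓ) 2 m) ⟩
        suc ℓ * 2 * m        ≡⟨ cong (_* m) (*-comm (suc ℓ) 2) ⟩
        2 * suc ℓ * m        ∎))))
        where open ≡-Reasoning

      -- At most `m` exceptions come from the correction and fewer than `m` from the exceptional
      -- points, each counted twice, so some point avoids both.
      few-exceptions : d + (c + c) < m + m
      few-exceptions = +-mono-≤-< d≤m (≤-trans (s≤s (≤-reflexive (cong (c +_) (sym (+-identityʳ c))))) small₃)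

      -- If the extended action fixes everything, the holonomy of `β` along the image of `w` is
      -- `cw w`. At a generic point that of the difference is then `true`, so the fibre is swapped,
      -- whereas the correction, which agrees with the twisted action there, fixes the point.
      contradiction-at : (∀ x → act ψ (π̂ w) x ≡ x × tw ψ β̂ (π̂ w) x ≡ cw w) → (∀ y → act (St.ψ φ') (π̂ w) y ≡ y) → ⊥
      contradiction-at fixed fixed' = pt-moved x t (trans (sym swapped) stays)
        where
        found = Exc-∃ few-exceptions (Exc-× (proj₂ (proj₂ along-w)) (Exc-double {m} generic))
        p₀ = proj₁ found
        x = proj₁ (unpt {m} p₀)
        t = proj₂ (unpt {m} p₀)
        stays : act φ' (π̂ w) p₀ ≡ pt x t
        stays = trans (j-inj (St.le φ') (trans (proj₁ (proj₂ found)) (fixed' (St.j φ' p₀)))) (sym (pt-unpt {m} p₀))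
        γ-w : tw ψ γ̂ (π̂ w) x ≡ true
        γ-w = trans (tw-xor ψ α̂ β̂ (π̂ w) x) (trans (cong (tw ψ α̂ (π̂ w) x xor_) (proj₂ (fixed x))) (proj₂ (proj₂ (proj₂ found)) (proj₁ (fixed x))))
        swapped : act φ' (π̂ w) p₀ ≡ pt x (t xor true)
        swapped = trans (cong (act φ' (π̂ w)) (sym (pt-unpt {m} p₀))) (trans (act-twist ψ γ̂ (π̂ w) x t)
          (cong₂ pt (proj₁ (fixed x)) (cong (t xor_) γ-w)))

    detected : Detected
    detected = detect (LA.Ψ G.β G.β-null G.β-flip G.β-triangle) (LA.Ψ-action G.β G.β-null G.β-flip G.β-triangle) (λ fixed →
      -- The second candidate is an action of `Γ`, made into one of `Γ̃` through `π`.
      detect (pull Γ Γ̃ π (St.ψ φ')) (pull-action Γ Γ̃ π πhom (St.ψ-action φ')) (λ fixed' →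
      ⊥-elim (contradiction-at (λ x → LA.Ψ-fixed G.β G.β-null G.β-flip G.β-triangle w x (fixed (pt x false)))
        (λ y → trans (sym (act-pull Γ Γ̃ π (St.ψ φ') w y)) (fixed' y)))))

  from-config : Config (K₁ + (K₂ + 2)) → Detected
  from-config record { m = suc m' ; ψ = ψ ; action = action ; transitive = transitive ; α = α ; α-null = α-null ; α-flip = α-flip ; c = c ; c-small = small ; generic = generic } =
    detected ψ action transitive α α-null α-flip {c}
      (below (m≤m+n K₁ (K₂ + 2))) (below (≤-trans (m≤m+n K₂ 2) (m≤n+m (K₂ + 2) K₁))) (below (≤-trans (m≤n+m 2 K₂) (m≤n+m (K₂ + 2) K₁))) generic
    where
    below : ∀ {K} → K ≤ K₁ + (K₂ + 2) → K * c < suc m'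
    below le = ≤-trans (s≤s (*-monoˡ-≤ c le)) small

theorem1p10 : (X : Complex) → Connected X → (Tr : SpanningTree X) →
    (κ : ℚ) → 0ℚ ℚ.< κ → (∀ (C : Cover X) → LargeCosystoles κ (Cover.Y C)) →
    (ρ : ℚ → ℚ) → RateFunction ρ → Stable (π₁Pres X Tr) ρ →
    (Γ̃ : Presentation) → CentralExt (π₁Pres X Tr) Γ̃ → ¬ ResiduallyFinite Γ̃ →
    ¬ Sofic Γ̃
theorem1p10 X _ Tr κ 0<κ large ρ rate stab Γ̃ E ¬rf (N , φ , ε , def , ε→0 , separates) =
  -- The precision left as `_` is the one demanded by `from-config`; it depends on `w` but not on
  -- the approximation, which is sampled only afterwards.
  ¬rf λ w w≉1 → Stage3.from-config X Tr E 0<κ large rate stab w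
    (Stage1.config X Tr E N φ ε def ε→0 (separates (CentralExt.z E) (CentralExt.ιinj E)) rate stab w (separates w w≉1) _)
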